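{- Every psd-stable binomial $f\in\mathbb{C}[Z]$ on the space of complex symmetric $n\times n$ matrices is of one of the following forms, where $c_1,c_2\in\mathbb{C}\setminus\{0\}$ and $Z^\gamma$ is a diagonal monomial: a) Only diagonal variables appear in $f$, and $f(Z)=Z^\gamma(c_1Z^{\alpha_1}+c_2Z^{\alpha_2})$, where $Z^{\alpha_1},Z^{\alpha_2}$ have no common factor, $|\alpha_1-\alpha_2|\le 2$, at least one of $\alpha_1,\alpha_2$ is non-zero, and one of the following holds: (i) $\{Z^{\alpha_1},Z^{\alpha_2}\}=\{1,z_{ii}\}$ for some $i\in[n]$; (ii) $\{Z^{\alpha_1},Z^{\alpha_2}\}=\{z_{ii},z_{jj}\}$ for some $i,j\in[n]$ and $\frac{c_1}{c_2}\in\mathbb{R}_{\ge 0}$; (iii) $\{Z^{\alpha_1},Z^{\alpha_2}\}=\{1,z_{ii}z_{jj}\}$ for some $i,j\in[n]$ (possibly equal) and $\frac{c_1}{c_2}\in\mathbb{R}_{<0}$. b) $f(Z)=Z^\gamma(c_1z_{ii}z_{jj}+c_2z_{ij}^2)$ for some $i<j$, with $\frac{c_1}{c_2}\in\mathbb{R}$.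
   Context: $[n]=\{1,\dots,n\}$. $\mathbb{C}[Z]$ denotes the ring of polynomials in the entries $z_{ij}$ of a symmetric $n\times n$ variable matrix $Z=(z_{ij})$, with $z_{ij}$ and $z_{ji}$ identified. Monomials are written $Z^\alpha=\prod_{1\le i,j\le n} z_{ij}^{\alpha_{ij}}$, where $\alpha$ is a symmetric matrix with non-negative entries, whose diagonal entries are integers and whose off-diagonal entries are half-integers (so for $i<j$ the variable $z_{ij}$ has exponent $2\alpha_{ij}$). For a symmetric matrix $\alpha$, $|\alpha|=\sum_{i,j}|\alpha_{ij}|$. The variables $z_{ii}$ are the diagonal variables; a monomial $Z^\gamma$ is diagonal if $\gamma_{ij}=0$ for all $i\neq j$ (constants are diagonal monomials). A binomial is a polynomial with exactly two distinct monomials having non-zero coefficients. A polynomial $f\in\mathbb{C}[Z]$ is psd-stable if $f(M)\ne 0$ for every complex symmetric $n\times n$ matrix $M$ whose entrywise imaginary part $\mathrm{Im}(M)$ is positive definite. -}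

module Defs where

open import Level using (Level; suc)
open import Algebra.Bundles.Raw using (RawRing)
import Algebra.Definitions.RawMonoid as RawMonoidDefs
import Algebra.Definitions.RawSemiring as RawSemiringDefs
open import Algebra.Structures using (IsCommutativeRing)
open import Data.Bool.Base using (if_then_else_; _∨_; _∧_)
open import Data.Bool.Properties using (∨-comm)
open import Data.Fin.Base using (Fin)
open import Data.Fin.Properties using (_≟_; _≤?_; all?)
open import Data.List.Base using (List; []; _∷_; _++_; cartesianProductWith)
open import Data.Nat.Base as ℕ using (ℕ; ∣_-_∣; +-0-rawMonoid)
import Data.Nat.Properties as ℕ
open import Data.Product.Base using (_×_; _,_; proj₁; proj₂; ∃; ∃-syntax)
open import Data.Sum.Base using (_⊎_)
open import Relation.Binary.Core using (Rel)
open import Relation.Binary.Definitions using (Decidable)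
open import Relation.Binary.PropositionalEquality using (_≡_; refl; cong; cong₂)
open import Relation.Binary.Structures using (IsDecTotalOrder)
open import Relation.Nullary using (¬_)
open import Relation.Nullary.Decidable using (⌊_⌋)
open import Relation.Unary using (Pred)

-- The library has no real numbers.  They are axiomatised as a Dedekind-complete
-- totally ordered field, which classically determines ℝ up to unique
-- isomorphism.  The value of _⁻¹ at 0# is unspecified and never relevant.

record CompleteOrderedField (ℓ : Level) : Set (suc ℓ) where
  infix  8 -_
  infix  9 _⁻¹
  infixl 7 _*_
  infixl 6 _+_
  infix  4 _≈_ _≉_ _≤_ _<_
  field
    Carrier           : Set ℓ
    _≈_ _≤_           : Rel Carrier ℓ
    _+_ _*_           : Carrier → Carrier → Carrier
    -_ _⁻¹            : Carrier → Carrier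
    0# 1#             : Carrier
    isCommutativeRing : IsCommutativeRing _≈_ _+_ _*_ -_ 0# 1#
    isDecTotalOrder   : IsDecTotalOrder _≈_ _≤_

  _≉_ : Rel Carrier ℓ
  x ≉ y = ¬ (x ≈ y)

  _<_ : Rel Carrier ℓ
  x < y = x ≤ y × x ≉ y

  UpperBound : Pred Carrier ℓ → Pred Carrier ℓ
  UpperBound P b = ∀ x → P x → x ≤ b

  field
    0≉1             : 0# ≉ 1#
    inverseʳ        : ∀ x → x ≉ 0# → x * x ⁻¹ ≈ 1#
    +-monoˡ-≤       : ∀ x {y z} → y ≤ z → y + x ≤ z + x
    *-nonNegative   : ∀ {x y} → 0# ≤ x → 0# ≤ y → 0# ≤ x * y
    supremum        : ∀ (P : Pred Carrier ℓ) → ∃ P → ∃ (UpperBound P) →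
                      ∃[ s ] UpperBound P s × (∀ b → UpperBound P b → s ≤ b)

  rawRing : RawRing ℓ ℓ
  rawRing = record
    { Carrier = Carrier ; _≈_ = _≈_ ; _+_ = _+_ ; _*_ = _*_
    ; -_ = -_ ; 0# = 0# ; 1# = 1# }

-- A monomial in the entries of a symmetric n×n variable matrix, where `exp i j`
-- is the exponent of the variable z_ij = z_ji.  The half-integral matrix α of
-- Z^α therefore has α_ii = exp i i and α_ij = exp i j / 2 for i ≠ j.

record Exponent (n : ℕ) : Set where
  field
    exp     : Fin n → Fin n → ℕ
    exp-sym : ∀ i j → exp i j ≡ exp j i

open Exponent public

module _ {n : ℕ} where

  infix  4 _≐_ _≐?_ _∣ₘ_ ⟅_,_⟆≐⟅_,_⟆
  infixl 7 _∙_

  _≐_ : Rel (Exponent n) _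
  α ≐ β = ∀ i j → exp α i j ≡ exp β i j

  _≐?_ : Decidable _≐_
  α ≐? β = all? λ i → all? λ j → exp α i j ℕ.≟ exp β i j

  ⟅_,_⟆≐⟅_,_⟆ : (α β γ δ : Exponent n) → Set
  ⟅ α , β ⟆≐⟅ γ , δ ⟆ = (α ≐ γ × β ≐ δ) ⊎ (α ≐ δ × β ≐ γ)

  𝟙 : Exponent n
  𝟙 = record { exp = λ _ _ → 0 ; exp-sym = λ _ _ → refl }

  z : Fin n → Fin n → Exponent n
  z i j = record
    { exp     = λ k l → if (⌊ k ≟ i ⌋ ∧ ⌊ l ≟ j ⌋) ∨ (⌊ l ≟ i ⌋ ∧ ⌊ k ≟ j ⌋)
                        then 1 else 0
    ; exp-sym = λ k l → cong (λ b → if b then 1 else 0)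
                  (∨-comm (⌊ k ≟ i ⌋ ∧ ⌊ l ≟ j ⌋) (⌊ l ≟ i ⌋ ∧ ⌊ k ≟ j ⌋))
    }

  _∙_ : Exponent n → Exponent n → Exponent n
  α ∙ β = record
    { exp     = λ i j → exp α i j ℕ.+ exp β i j
    ; exp-sym = λ i j → cong₂ ℕ._+_ (exp-sym α i j) (exp-sym β i j)
    }

  _∣ₘ_ : Rel (Exponent n) _
  δ ∣ₘ α = ∃[ ε ] α ≐ δ ∙ ε

  NoCommonFactor : Rel (Exponent n) _
  NoCommonFactor α β = ∀ δ → δ ∣ₘ α → δ ∣ₘ β → δ ≐ 𝟙

  Diagonal : Exponent n → Set
  Diagonal γ = ∀ i j → ¬ (i ≡ j) → exp γ i j ≡ 0

  twice : Exponent n → Fin n → Fin n → ℕ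
  twice α i j = if ⌊ i ≟ j ⌋ then 2 ℕ.* exp α i j else exp α i j

  -- 2|α − β| = Σ_{i,j} |2α_ij − 2β_ij|; doubling keeps the half-integral
  -- entries in ℕ.
  2∥_-_∥ : Exponent n → Exponent n → ℕ
  2∥ α - β ∥ = sum λ i → sum λ j → ∣ twice α i j - twice β i j ∣
    where open RawMonoidDefs +-0-rawMonoid using (sum)

module Complex {ℓ} (ℝ : CompleteOrderedField ℓ) where

  private module ℝ = CompleteOrderedField ℝ

  record ℂ : Set ℓ where
    constructor _+i_
    field
      re im : ℝ.Carrier

  open ℂ public

  ℂ-rawRing : RawRing ℓ ℓ
  ℂ-rawRing = record
    { Carrier = ℂ
    ; _≈_     = λ w z → re w ℝ.≈ re z × im w ℝ.≈ im z
    ; _+_     = λ w z → (re w ℝ.+ re z) +i (im w ℝ.+ im z)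
    ; _*_     = λ w z → (re w ℝ.* re z ℝ.+ ℝ.- (im w ℝ.* im z))
                        +i (re w ℝ.* im z ℝ.+ im w ℝ.* re z)
    ; -_      = λ z → (ℝ.- re z) +i (ℝ.- im z)
    ; 0#      = ℝ.0# +i ℝ.0#
    ; 1#      = ℝ.1# +i ℝ.0#
    }

  open RawRing ℂ-rawRing public
    using (_≈_; _≉_; _+_; _*_; -_; 0#; 1#; rawSemiring)

  infixl 7 _/_

  _⁻¹ : ℂ → ℂ
  z ⁻¹ = (re z ℝ.* N ℝ.⁻¹) +i (ℝ.- im z ℝ.* N ℝ.⁻¹)
    where N = re z ℝ.* re z ℝ.+ im z ℝ.* im z

  _/_ : ℂ → ℂ → ℂ
  w / z = w * z ⁻¹

  Real NonNegativeReal NegativeReal : ℂ → Set ℓ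
  Real z            = im z ℝ.≈ ℝ.0#
  NonNegativeReal z = Real z × ℝ.0# ℝ.≤ re z
  NegativeReal z    = Real z × re z ℝ.< ℝ.0#

  open RawSemiringDefs rawSemiring public using (_^_; product)
  open RawSemiringDefs (RawRing.rawSemiring ℝ.rawRing) using () renaming (sum to ∑)

  Symmetric : ∀ {n} → (Fin n → Fin n → ℂ) → Set ℓ
  Symmetric M = ∀ i j → M i j ≈ M j i

  PositiveDefinite : ∀ {n} → (Fin n → Fin n → ℝ.Carrier) → Set ℓ
  PositiveDefinite {n} A = ∀ (v : Fin n → ℝ.Carrier) → (∃[ i ] v i ℝ.≉ ℝ.0#) →
    ℝ.0# ℝ.< (∑ λ i → ∑ λ j → v i ℝ.* A i j ℝ.* v j)

  -- ℂ[Z] as finite formal sums of terms c Z^α; a list may repeat monomials or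
  -- contain zero coefficients, and equality of polynomials is _≈ₚ_.

  Polynomial : ℕ → Set ℓ
  Polynomial n = List (ℂ × Exponent n)

  module _ {n : ℕ} where

    infix  4 _≈ₚ_
    infixl 6 _+ₚ_
    infixl 7 _*ₚ_

    coeff : Polynomial n → Exponent n → ℂ
    coeff []            α = 0#
    coeff ((c , β) ∷ f) α = if ⌊ β ≐? α ⌋ then c + coeff f α else coeff f α

    _≈ₚ_ : Rel (Polynomial n) ℓ
    f ≈ₚ g = ∀ α → coeff f α ≈ coeff g α

    term : ℂ → Exponent n → Polynomial n
    term c α = (c , α) ∷ []

    _+ₚ_ : Polynomial n → Polynomial n → Polynomial n
    _+ₚ_ = _++_

    _*ₚ_ : Polynomial n → Polynomial n → Polynomial n
    _*ₚ_ = cartesianProductWith λ (c , α) (d , β) → c * d , α ∙ β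

    -- One factor for each variable z_ij, i ≤ j.
    evalMonomial : Exponent n → (Fin n → Fin n → ℂ) → ℂ
    evalMonomial α M = product λ i → product λ j →
      if ⌊ i ≤? j ⌋ then M i j ^ exp α i j else 1#

    eval : Polynomial n → (Fin n → Fin n → ℂ) → ℂ
    eval []            M = 0#
    eval ((c , α) ∷ f) M = c * evalMonomial α M + eval f M

    PsdStable : Polynomial n → Set ℓ
    PsdStable f = ∀ M → Symmetric M → PositiveDefinite (λ i j → im (M i j)) →
      eval f M ≉ 0#

    Binomial : Polynomial n → Set ℓ
    Binomial f = ∃[ α ] ∃[ β ] (¬ (α ≐ β)) × coeff f α ≉ 0# × coeff f β ≉ 0# ×
      (∀ γ → ¬ (γ ≐ α) → ¬ (γ ≐ β) → coeff f γ ≈ 0#)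

    OnlyDiagonalVariables : Polynomial n → Set ℓ
    OnlyDiagonalVariables f = ∀ α → coeff f α ≉ 0# → Diagonal α

{-# OPTIONS --safe #-}

-- Only f = c₁ Z^α + c₂ Z^β matters, evaluated at suitable matrices with positive
-- definite imaginary part.  At i·I every off-diagonal variable vanishes, so one of the
-- monomials is diagonal.
--
-- With off-diagonal entries 1, the diagonal entries range freely over the upper half
-- plane; choosing them among y and −1/y reduces f = 0 to y^N = w with
-- N = Σ |α_ii − β_ii|.  Every w ≠ 0 has an N-th root in the upper half plane unless
-- N ≤ 1, or N = 2 and w > 0; hence N ≤ 2, with the stated sign of c₁ / c₂ when N = 2.
--
-- If z_kl occurs in Z^α only, put z_kk = i r, z_kl = u, the other diagonal entries i and
-- the remaining ones 1.  The u solving f = 0 must violate positivity, |u|² ≥ r, for every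
-- r > 0, and comparing the growth in r gives 2 β_kk = 2 α_kk + exp α k l (and likewise for
-- l).  With N ≤ 2 this forces Z^α = Z^γ z_kl² and Z^β = Z^γ z_kk z_ll.
module Submission where

open import Defs
open import Algebra.Bundles using (CommutativeMonoid; CommutativeRing)
import Algebra.Properties.AbelianGroup as AbelianGroupProperties
import Algebra.Properties.CommutativeMonoid.Sum as MonoidSum
import Algebra.Properties.CommutativeSemiring.Exp as CommutativeExp
import Algebra.Properties.Ring as RingProperties
import Algebra.Properties.Semiring.Exp as Exp
import Algebra.Properties.Semiring.Mult.TCOptimised as Multiples
import Algebra.Solver.Ring as RingSolver
open import Algebra.Solver.Ring.AlmostCommutativeRing
  using (fromCommutativeRing; _-Raw-AlmostCommutative⟶_)
open import Data.Bool.Base using (if_then_else_)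
open import Data.Empty using (⊥; ⊥-elim)
open import Data.Fin.Base as Fin using (Fin)
import Data.Fin.Properties as Fin
open import Data.Integer.Base as ℤ using (ℤ; +_; -[1+_]; _⊖_; _◃_)
import Data.Integer.Properties as ℤ
open import Data.List.Base using ([]; _∷_; length)
open import Data.Maybe.Base using (Maybe; just; nothing)
open import Data.Nat.Base as ℕ using (ℕ; z≤n; s≤s; _∸_; ∣_-_∣)
import Data.Nat.Properties as ℕ
open import Data.Product.Base using (_×_; _,_; proj₁; proj₂; ∃-syntax)
import Data.Sign.Base as Sign
open import Data.Sum.Base using (_⊎_; inj₁; inj₂)
open import Function.Base using (_∘_)
open import Relation.Binary.Definitions using (tri<; tri≈; tri>)
open import Relation.Binary.PropositionalEquality as ≡ using (_≡_; _≢_)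
import Relation.Binary.Reasoning.Setoid as SetoidReasoning
open import Relation.Binary.Structures using (IsDecTotalOrder)
open import Relation.Nullary using (¬_; Dec; yes; no)
open import Relation.Nullary.Decidable using (⌊_⌋; ¬?; _×-dec_; decidable-stable)

-- The upper half plane consists of the arguments in (0, π), so N-th powers of its points cover the
-- arguments in (0, N π): everything when N ≥ 3, everything but the positive axis when N = 2. This
-- is proved without angles: up to positive scaling the half plane is the line t + i, and suprema
-- produce the points of that line at which (t + i)^n is a negative real.
--
-- The substitution uses -1/y and not 1/y because only the former stays in the half plane. Its minus
-- sign separates the two cases with N = 2: after cancelling the common factor, degrees (1, 1) leave
-- one sign and force c₁ / c₂ > 0, while (0, 2) and (2, 0) leave none and force c₁ / c₂ < 0.
--
-- The growth comparison holds for all r > 0, so large and small r bound the exponents from opposite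
-- sides and give an equality. A variable z_kl of exponent e ≥ 1 is thus met on the other side by
-- z_kk and z_ll, each with surplus e / 2. These surpluses are positive integers with sum at most 2,
-- whence e = 2.

-- Integer coefficients for the ring solver, so that constants cancel by computation in ℤ.

module IntegerCoefficients {c ℓ} (R : CommutativeRing c ℓ) where

  open CommutativeRing R
  open RingProperties ring using (-‿distribˡ-*; -‿distribʳ-*; -‿involutive; -0#≈0#)
  open AbelianGroupProperties +-abelianGroup using (⁻¹-∙-comm)
  open Multiples semiring using (×-homo-+; ×1-homo-*; 1+×) renaming (_×_ to _·_)
  open SetoidReasoning setoid

  ⟦_⟧ : ℤ → Carrier
  ⟦ + n ⟧      = n · 1#
  ⟦ -[1+ n ] ⟧ = - (ℕ.suc n · 1#)

  private
    cancel : ∀ a b c → (a + b) - (a + c) ≈ b - c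
    cancel a b c = begin
      (a + b) - (a + c)       ≈⟨ +-cong (+-comm b a) (⁻¹-∙-comm a c) ⟨
      (b + a) + (- a + - c)   ≈⟨ +-assoc b a _ ⟩
      b + (a + (- a + - c))   ≈⟨ +-congˡ (+-assoc a (- a) (- c)) ⟨
      b + ((a - a) + - c)     ≈⟨ +-congˡ (+-congʳ (-‿inverseʳ a)) ⟩
      b + (0# + - c)          ≈⟨ +-congˡ (+-identityˡ (- c)) ⟩
      b - c                   ∎

    ⊖-homo : ∀ m n → ⟦ m ⊖ n ⟧ ≈ m · 1# - n · 1#
    ⊖-homo ℕ.zero    ℕ.zero    = sym (-‿inverseʳ 0#)
    ⊖-homo ℕ.zero    (ℕ.suc n) = sym (+-identityˡ _)
    ⊖-homo (ℕ.suc m) ℕ.zero    = sym (trans (+-congˡ -0#≈0#) (+-identityʳ _))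
    ⊖-homo (ℕ.suc m) (ℕ.suc n) = begin
      ⟦ ℕ.suc m ⊖ ℕ.suc n ⟧               ≡⟨ ≡.cong ⟦_⟧ (ℤ.[1+m]⊖[1+n]≡m⊖n m n) ⟩
      ⟦ m ⊖ n ⟧                           ≈⟨ ⊖-homo m n ⟩
      m · 1# - n · 1#                     ≈⟨ cancel 1# _ _ ⟨
      (1# + m · 1#) - (1# + n · 1#)       ≈⟨ +-cong (1+× m 1#) (-‿cong (1+× n 1#)) ⟨
      ℕ.suc m · 1# - ℕ.suc n · 1#         ∎

    +-homo : ∀ i j → ⟦ i ℤ.+ j ⟧ ≈ ⟦ i ⟧ + ⟦ j ⟧
    +-homo (+ m)    (+ n)    = ×-homo-+ 1# m n
    +-homo (+ m)    -[1+ n ] = ⊖-homo m (ℕ.suc n)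
    +-homo -[1+ m ] (+ n)    = trans (⊖-homo n (ℕ.suc m)) (+-comm _ _)
    +-homo -[1+ m ] -[1+ n ] = begin
      - (ℕ.suc (ℕ.suc (m ℕ.+ n)) · 1#)        ≡⟨ ≡.cong (λ k → - (ℕ.suc k · 1#)) (ℕ.+-suc m n) ⟨
      - ((ℕ.suc m ℕ.+ ℕ.suc n) · 1#)          ≈⟨ -‿cong (×-homo-+ 1# (ℕ.suc m) (ℕ.suc n)) ⟩
      - (ℕ.suc m · 1# + ℕ.suc n · 1#)         ≈⟨ ⁻¹-∙-comm _ _ ⟨
      - (ℕ.suc m · 1#) + - (ℕ.suc n · 1#)     ∎
      where import Data.Nat.Properties as ℕ

    -‿homo : ∀ i → ⟦ ℤ.- i ⟧ ≈ - ⟦ i ⟧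
    -‿homo (+ ℕ.zero)  = sym -0#≈0#
    -‿homo (+ ℕ.suc n) = refl
    -‿homo -[1+ n ]    = sym (-‿involutive _)

    +◃-homo : ∀ n → ⟦ Sign.+ ◃ n ⟧ ≈ n · 1#
    +◃-homo ℕ.zero    = refl
    +◃-homo (ℕ.suc n) = refl

    -◃-homo : ∀ n → ⟦ Sign.- ◃ n ⟧ ≈ - (n · 1#)
    -◃-homo ℕ.zero    = sym -0#≈0#
    -◃-homo (ℕ.suc n) = refl

    *-homo : ∀ i j → ⟦ i ℤ.* j ⟧ ≈ ⟦ i ⟧ * ⟦ j ⟧
    *-homo (+ m)    (+ n)    = trans (+◃-homo (m ℕ.* n)) (×1-homo-* m n)
    *-homo (+ m)    -[1+ n ] = begin
      ⟦ Sign.- ◃ m ℕ.* ℕ.suc n ⟧        ≈⟨ -◃-homo (m ℕ.* ℕ.suc n) ⟩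
      - ((m ℕ.* ℕ.suc n) · 1#)          ≈⟨ -‿cong (×1-homo-* m (ℕ.suc n)) ⟩
      - (m · 1# * (ℕ.suc n · 1#))       ≈⟨ -‿distribʳ-* _ _ ⟩
      m · 1# * - (ℕ.suc n · 1#)         ∎
    *-homo -[1+ m ] (+ n)    = begin
      ⟦ Sign.- ◃ ℕ.suc m ℕ.* n ⟧        ≈⟨ -◃-homo (ℕ.suc m ℕ.* n) ⟩
      - ((ℕ.suc m ℕ.* n) · 1#)          ≈⟨ -‿cong (×1-homo-* (ℕ.suc m) n) ⟩
      - (ℕ.suc m · 1# * (n · 1#))       ≈⟨ -‿distribˡ-* _ _ ⟩
      - (ℕ.suc m · 1#) * (n · 1#)       ∎
    *-homo -[1+ m ] -[1+ n ] = begin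
      ⟦ Sign.+ ◃ ℕ.suc m ℕ.* ℕ.suc n ⟧             ≈⟨ +◃-homo (ℕ.suc m ℕ.* ℕ.suc n) ⟩
      (ℕ.suc m ℕ.* ℕ.suc n) · 1#                   ≈⟨ ×1-homo-* (ℕ.suc m) (ℕ.suc n) ⟩
      ℕ.suc m · 1# * (ℕ.suc n · 1#)                ≈⟨ -‿involutive _ ⟨
      - - (ℕ.suc m · 1# * (ℕ.suc n · 1#))          ≈⟨ -‿cong (-‿distribˡ-* _ _) ⟩
      - (- (ℕ.suc m · 1#) * (ℕ.suc n · 1#))        ≈⟨ -‿distribʳ-* _ _ ⟩
      - (ℕ.suc m · 1#) * - (ℕ.suc n · 1#)          ∎

    morphism : ℤ.+-*-rawRing -Raw-AlmostCommutative⟶ fromCommutativeRing R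
    morphism = record
      { ⟦_⟧ = ⟦_⟧ ; +-homo = +-homo ; *-homo = *-homo ; -‿homo = -‿homo
      ; 0-homo = refl ; 1-homo = refl }

    _coeff≟_ : ∀ i j → Maybe (⟦ i ⟧ ≈ ⟦ j ⟧)
    i coeff≟ j with i ℤ.≟ j
    ... | yes i≡j = just (reflexive (≡.cong ⟦_⟧ i≡j))
    ... | no  _   = nothing

  open RingSolver _ _ morphism _coeff≟_ public
    using (Polynomial; solve; con; _:+_; _:*_; _:-_; :-_; _:=_)

-- Order arithmetic in a complete ordered field.

module OrderedField {ℓ} (ℝ : CompleteOrderedField ℓ) where

  open CompleteOrderedField ℝ public

  commutativeRing : CommutativeRing ℓ ℓ
  commutativeRing = record { isCommutativeRing = isCommutativeRing }

  open CommutativeRing commutativeRing public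
    using ( refl; sym; trans; setoid; +-cong; *-cong; *-congˡ; *-congʳ; +-congˡ; +-congʳ; -‿cong
          ; *-identityˡ; *-identityʳ; *-comm; zeroˡ; zeroʳ; +-identityˡ; +-identityʳ; -‿inverseʳ; ring; semiring
          ; commutativeSemiring; +-commutativeMonoid )
  open IsDecTotalOrder isDecTotalOrder public
    using ()
    renaming ( _≟_ to _≈?_; _≤?_ to _≤?_; total to ≤-total; antisym to ≤-antisym
             ; trans to ≤-trans; reflexive to ≤-reflexive; refl to ≤-refl
             ; ≤-respʳ-≈ to ≤-respʳ; ≤-respˡ-≈ to ≤-respˡ )
  open IntegerCoefficients commutativeRing public
    using (solve; con; _:+_; _:*_; _:-_; :-_; _:=_)
  open RingProperties ring public using (-0#≈0#)
  open Exp semiring public using (_^_; ^-congˡ; ^-homo-*)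
  open CommutativeExp commutativeSemiring public using (^-distrib-*)
  open SetoidReasoning setoid

  infixl 6 _-_
  _-_ : Carrier → Carrier → Carrier
  x - y = x + - y

  -- Inequalities are kept in the form `0# ≤ t`. An order argument then writes `t` as a sum of
  -- products of non-negative terms, with the ring solver checking the identity and this lemma
  -- passing across it.
  0≤-resp : ∀ {x y} → x ≈ y → 0# ≤ x → 0# ≤ y
  0≤-resp = ≤-respʳ

  0<-resp : ∀ {x y} → x ≈ y → 0# < x → 0# < y
  0<-resp x≈y (0≤x , 0≉x) = ≤-respʳ x≈y 0≤x , λ 0≈y → 0≉x (trans 0≈y (sym x≈y))

  ≤⇒0≤ : ∀ {x y} → x ≤ y → 0# ≤ y - x
  ≤⇒0≤ {x} x≤y = ≤-respˡ (-‿inverseʳ x) (+-monoˡ-≤ (- x) x≤y)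

  0≤⇒≤ : ∀ {x y} → 0# ≤ y - x → x ≤ y
  0≤⇒≤ {x} {y} p = ≤-respʳ (solve 2 (λ x y → y :- x :+ x := y) refl x y)
                     (≤-respˡ (+-identityˡ x) (+-monoˡ-≤ x p))

  <⇒0< : ∀ {x y} → x < y → 0# < y - x
  <⇒0< {x} {y} (x≤y , x≉y) = ≤⇒0≤ x≤y , λ p → x≉y (begin
    x          ≈⟨ +-identityˡ x ⟨
    0# + x     ≈⟨ +-congʳ p ⟩
    y - x + x  ≈⟨ solve 2 (λ x y → y :- x :+ x := y) refl x y ⟩
    y          ∎)

  0<⇒< : ∀ {x y} → 0# < y - x → x < y
  0<⇒< {x} {y} (p , q) = 0≤⇒≤ p , λ x≈y → q (trans (sym (-‿inverseʳ x)) (+-congʳ x≈y))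

  0≤+ : ∀ {x y} → 0# ≤ x → 0# ≤ y → 0# ≤ x + y
  0≤+ {x} {y} p q = ≤-trans q (≤-respˡ (+-identityˡ y) (+-monoˡ-≤ y p))

  0<+ : ∀ {x y} → 0# < x → 0# ≤ y → 0# < x + y
  0<+ {x} {y} (p , x≉0) q = 0≤+ p q , λ r → x≉0 (≤-antisym p
    (≤-respʳ (sym r) (≤-respʳ (solve 2 (λ x y → y :+ x := x :+ y) refl x y)
      (≤-respˡ (+-identityˡ x) (+-monoˡ-≤ x q)))))

  0<+′ : ∀ {x y} → 0# ≤ x → 0# < y → 0# < x + y
  0<+′ {x} {y} p q = 0<-resp (solve 2 (λ x y → y :+ x := x :+ y) refl x y) (0<+ q p)

  *-cancel-0 : ∀ {x y} → x ≉ 0# → x * y ≈ 0# → y ≈ 0#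
  *-cancel-0 {x} {y} x≉0 xy≈0 = begin
    y                ≈⟨ *-identityˡ y ⟨
    1# * y           ≈⟨ *-congʳ (inverseʳ x x≉0) ⟨
    x * x ⁻¹ * y     ≈⟨ solve 3 (λ x i y → x :* i :* y := i :* (x :* y)) refl x (x ⁻¹) y ⟩
    x ⁻¹ * (x * y)   ≈⟨ *-congˡ xy≈0 ⟩
    x ⁻¹ * 0#        ≈⟨ zeroʳ _ ⟩
    0#               ∎

  0<* : ∀ {x y} → 0# < x → 0# < y → 0# < x * y
  0<* (p , x≉0) (q , y≉0) = *-nonNegative p q ,
    λ r → y≉0 (sym (*-cancel-0 (λ e → x≉0 (sym e)) (sym r)))

  >⇒≉0 : ∀ {x} → 0# < x → x ≉ 0#
  >⇒≉0 (_ , x≉0) e = x≉0 (sym e)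

  data SignOf (x : Carrier) : Set ℓ where
    positive : 0# < x → SignOf x
    zero     : x ≈ 0# → SignOf x
    negative : 0# < - x → SignOf x

  sign : ∀ x → SignOf x
  sign x with x ≈? 0# | ≤-total 0# x
  ... | yes p | _      = zero p
  ... | no  p | inj₁ q = positive (q , λ e → p (sym e))
  ... | no  p | inj₂ q = negative
    ( 0≤-resp (+-identityˡ (- x)) (≤⇒0≤ q)
    , λ e → p (trans (solve 1 (λ x → x := :- (:- x)) refl x) (trans (-‿cong (sym e)) -0#≈0#)) )

  0≤∧0<-⇒⊥ : ∀ {x} {a} {A : Set a} → 0# ≤ x → 0# < - x → A
  0≤∧0<-⇒⊥ {x} p q = ⊥-elim (proj₂ (0<+′ p q) (sym (-‿inverseʳ x)))

  ≰⇒0< : ∀ {x} → ¬ (x ≤ 0#) → 0# < x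
  ≰⇒0< {x} x≰0 with sign x
  ... | positive p = p
  ... | zero p     = ⊥-elim (x≰0 (≤-reflexive p))
  ... | negative p = ⊥-elim (x≰0 (0≤⇒≤ (0≤-resp (sym (+-identityˡ (- x))) (proj₁ p))))

  0≤² : ∀ x → 0# ≤ x * x
  0≤² x with ≤-total 0# x
  ... | inj₁ p = *-nonNegative p p
  ... | inj₂ p = 0≤-resp (solve 1 (λ x → (con (+ 0) :- x) :* (con (+ 0) :- x) := x :* x) refl x)
                   (*-nonNegative (≤⇒0≤ p) (≤⇒0≤ p))

  0<1 : 0# < 1#
  0<1 = 0≤-resp (*-identityˡ 1#) (0≤² 1#) , 0≉1

  0<² : ∀ {x} → x ≉ 0# → 0# < x * x
  0<² {x} x≉0 = 0≤² x , λ e → x≉0 (*-cancel-0 x≉0 (sym e))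

  0<⁻¹ : ∀ {x} → 0# < x → 0# < x ⁻¹
  0<⁻¹ {x} 0<x = 0<-resp
    (begin
      x * (x ⁻¹ * x ⁻¹)  ≈⟨ solve 2 (λ x i → x :* (i :* i) := x :* i :* i) refl x (x ⁻¹) ⟩
      x * x ⁻¹ * x ⁻¹    ≈⟨ *-congʳ x*x⁻¹≈1 ⟩
      1# * x ⁻¹          ≈⟨ *-identityˡ _ ⟩
      x ⁻¹               ∎)
    (0<* 0<x (0<² λ e → 0≉1 (trans (sym (zeroʳ x)) (trans (*-congˡ (sym e)) x*x⁻¹≈1))))
    where x*x⁻¹≈1 = inverseʳ x (>⇒≉0 0<x)

  halve : ∀ {x} → 0# ≤ x + x → 0# ≤ x
  halve {x} p with sign x
  ... | positive q = proj₁ q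
  ... | zero q     = ≤-reflexive (sym q)
  ... | negative q = 0≤∧0<-⇒⊥ p
    (0<-resp (solve 1 (λ x → :- x :+ :- x := :- (x :+ x)) refl x) (0<+ q (proj₁ q)))

  -- Absolute value bounds, continuity, and the last root of a continuous function.

  infix 4 ∣_∣≤_
  ∣_∣≤_ : Carrier → Carrier → Set ℓ
  ∣ q ∣≤ B = 0# ≤ B - q × 0# ≤ B + q

  bounded : ∀ q → ∃[ B ] ∣ q ∣≤ B
  bounded q with ≤-total 0# q
  ... | inj₁ p = q , 0≤-resp (sym (-‿inverseʳ q)) ≤-refl , 0≤+ p p
  ... | inj₂ p = - q , 0≤-resp (solve 1 (λ x → (con (+ 0) :- x) :+ (con (+ 0) :- x) := :- x :- x) refl q)
                              (0≤+ (≤⇒0≤ p) (≤⇒0≤ p))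
                     , 0≤-resp (solve 1 (λ x → con (+ 0) := :- x :+ x) refl q) ≤-refl

  ∣+∣≤ : ∀ {p q A B} → ∣ p ∣≤ A → ∣ q ∣≤ B → ∣ p + q ∣≤ A + B
  ∣+∣≤ {p} {q} {A} {B} (a , b) (c , d) =
    0≤-resp (solve 4 (λ p q A B → A :- p :+ (B :- q) := A :+ B :- (p :+ q)) refl p q A B) (0≤+ a c) ,
    0≤-resp (solve 4 (λ p q A B → A :+ p :+ (B :+ q) := A :+ B :+ (p :+ q)) refl p q A B) (0≤+ b d)

  -- Twice `A * B ± p * q` is a sum of two products of the non-negative numbers `A ± p` and `B ± q`;
  -- `halve` removes the factor 2 without a division.
  ∣*∣≤ : ∀ {p q A B} → ∣ p ∣≤ A → ∣ q ∣≤ B → ∣ p * q ∣≤ A * B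
  ∣*∣≤ {p} {q} {A} {B} (a , b) (c , d) =
    halve (0≤-resp (solve 4 (λ p q A B → (A :- p) :* (B :+ q) :+ (A :+ p) :* (B :- q)
                                := A :* B :- p :* q :+ (A :* B :- p :* q)) refl p q A B)
             (0≤+ (*-nonNegative a d) (*-nonNegative b c))) ,
    halve (0≤-resp (solve 4 (λ p q A B → (A :- p) :* (B :- q) :+ (A :+ p) :* (B :+ q)
                                := A :* B :+ p :* q :+ (A :* B :+ p :* q)) refl p q A B)
             (0≤+ (*-nonNegative a c) (*-nonNegative b d)))

  ∣∣≤⇒0≤ : ∀ {q B} → ∣ q ∣≤ B → 0# ≤ B
  ∣∣≤⇒0≤ {q} {B} (a , b) =
    halve (0≤-resp (solve 2 (λ q B → B :- q :+ (B :+ q) := B :+ B) refl q B) (0≤+ a b))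

  -- A Lipschitz bound at each point is all the root argument uses, and unlike ε–δ
  -- continuity it passes to products by a single identity.
  record Continuous (f : Carrier → Carrier) : Set ℓ where
    field
      cong      : ∀ {x y} → x ≈ y → f x ≈ f y
      lipschitz : ∀ a → ∃[ L ] ∀ h → ∣ h ∣≤ 1# → ∃[ q ] f (a + h) ≈ f a + h * q × ∣ q ∣≤ L

  open Continuous

  const-continuous : ∀ c → Continuous (λ _ → c)
  const-continuous c .cong _ = refl
  const-continuous c .lipschitz a = 0# , λ h _ →
    0# , solve 2 (λ c h → c := c :+ h :* con (+ 0)) refl c h ,
    0≤-resp (solve 0 (con (+ 0) := con (+ 0) :- con (+ 0)) refl) ≤-refl ,
    0≤-resp (solve 0 (con (+ 0) := con (+ 0) :+ con (+ 0)) refl) ≤-refl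

  id-continuous : Continuous (λ x → x)
  id-continuous .cong x≈y = x≈y
  id-continuous .lipschitz a = 1# , λ h _ →
    1# , solve 2 (λ a h → a :+ h := a :+ h :* con (+ 1)) refl a h ,
    0≤-resp (sym (-‿inverseʳ 1#)) ≤-refl , 0≤+ (proj₁ 0<1) (proj₁ 0<1)

  +-continuous : ∀ {f g} → Continuous f → Continuous g → Continuous (λ x → f x + g x)
  +-continuous F G .cong x≈y = +-cong (cong F x≈y) (cong G x≈y)
  +-continuous {f} {g} F G .lipschitz a with lipschitz F a | lipschitz G a
  ... | L , l | M , m = L + M , λ h ∣h∣≤1 →
    let q , e , ∣q∣≤L = l h ∣h∣≤1
        p , d , ∣p∣≤M = m h ∣h∣≤1
    in q + p ,
       trans (+-cong e d)
         (solve 5 (λ x y h q p → x :+ h :* q :+ (y :+ h :* p) := x :+ y :+ h :* (q :+ p))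
           refl (f a) (g a) h q p) ,
       ∣+∣≤ ∣q∣≤L ∣p∣≤M

  *-continuous : ∀ {f g} → Continuous f → Continuous g → Continuous (λ x → f x * g x)
  *-continuous F G .cong x≈y = *-cong (cong F x≈y) (cong G x≈y)
  *-continuous {f} {g} F G .lipschitz a with lipschitz F a | lipschitz G a | bounded (f a) | bounded (g a)
  ... | L , l | M , m | A , ∣fa∣≤A | B , ∣ga∣≤B = L * B + (A * M + 1# * (L * M)) , λ h ∣h∣≤1 →
    let q , e , ∣q∣≤L = l h ∣h∣≤1
        p , d , ∣p∣≤M = m h ∣h∣≤1
    in q * g a + (f a * p + h * (q * p)) ,
       trans (*-cong e d)
         (solve 5 (λ x y h q p → (x :+ h :* q) :* (y :+ h :* p)
                     := x :* y :+ h :* (q :* y :+ (x :* p :+ h :* (q :* p))))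
           refl (f a) (g a) h q p) ,
       ∣+∣≤ (∣*∣≤ ∣q∣≤L ∣ga∣≤B) (∣+∣≤ (∣*∣≤ ∣fa∣≤A ∣p∣≤M) (∣*∣≤ ∣h∣≤1 (∣*∣≤ ∣q∣≤L ∣p∣≤M)))

  neg-continuous : ∀ {f} → Continuous f → Continuous (λ x → - f x)
  neg-continuous F .cong x≈y = -‿cong (cong F x≈y)
  neg-continuous {f} F .lipschitz a with lipschitz F a
  ... | L , l = L , λ h ∣h∣≤1 →
    let q , e , u , v = l h ∣h∣≤1
    in - q ,
       trans (-‿cong e) (solve 3 (λ x h q → :- (x :+ h :* q) := :- x :+ h :* :- q) refl (f a) h q) ,
       0≤-resp (solve 2 (λ q L → L :+ q := L :- :- q) refl q L) v , u

  abstract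
    positive-near : ∀ {f} → Continuous f → ∀ {a} → 0# < f a →
      ∃[ δ ] 0# < δ × (∀ h → ∣ h ∣≤ δ → 0# < f (a + h))
    positive-near {f} F {a} 0<fa with lipschitz F a
    ... | L , l = δ , 0<δ , near
      where
      -- A Lipschitz constant comes without a sign. Its bound at `h = 0` exhibits some `q` with
      -- `∣ q ∣≤ L`, which is possible only for non-negative `L`.
      0≤L : 0# ≤ L
      0≤L = let _ , _ , p = l 0# ( 0≤-resp (solve 1 (λ x → x := x :- con (+ 0)) refl 1#) (proj₁ 0<1)
                                 , 0≤-resp (sym (+-identityʳ 1#)) (proj₁ 0<1)) in ∣∣≤⇒0≤ p
      v d δ : Carrier
      v = f a
      d = v + (L + 1#)
      -- The quotient v / (v + L + 1) is below 1, inside the range of the Lipschitz estimate, and v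
      -- - δ L = v (v + 1) / d stays positive.
      δ = v * d ⁻¹
      0<L+1 : 0# < L + 1#
      0<L+1 = 0<+′ 0≤L 0<1
      0<d : 0# < d
      0<d = 0<+ 0<fa (proj₁ 0<L+1)
      0<δ : 0# < δ
      0<δ = 0<* 0<fa (0<⁻¹ 0<d)
      d*d⁻¹ : d * d ⁻¹ ≈ 1#
      d*d⁻¹ = inverseʳ d (>⇒≉0 0<d)
      0<1-δ : 0# < 1# - δ
      0<1-δ = 0<-resp (begin
        (L + 1#) * d ⁻¹        ≈⟨ solve 3 (λ v L i → L :* i := (v :+ L) :* i :- v :* i) refl v (L + 1#) (d ⁻¹) ⟩
        d * d ⁻¹ - δ           ≈⟨ +-congʳ d*d⁻¹ ⟩
        1# - δ                 ∎) (0<* 0<L+1 (0<⁻¹ 0<d))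
      0<v-δL : 0# < v - δ * L
      0<v-δL = 0<-resp (begin
        v * d ⁻¹ * (v + 1#)    ≈⟨ solve 3 (λ v L i → v :* i :* (v :+ con (+ 1)) :=
                                    v :* ((v :+ (L :+ con (+ 1))) :* i) :- v :* i :* L) refl v L (d ⁻¹) ⟩
        v * (d * d ⁻¹) - δ * L ≈⟨ +-congʳ (trans (*-congˡ d*d⁻¹) (*-identityʳ v)) ⟩
        v - δ * L              ∎) (0<* 0<δ (0<+ 0<fa (proj₁ 0<1)))
      near : ∀ h → ∣ h ∣≤ δ → 0# < f (a + h)
      near h ∣h∣≤δ@(u , w) =
        let q , e , ∣q∣≤L = l h ( 0≤-resp (solve 2 (λ h δ → con (+ 1) :- δ :+ (δ :- h) := con (+ 1) :- h) refl h δ)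
                                    (0≤+ (proj₁ 0<1-δ) u)
                                , 0≤-resp (solve 2 (λ h δ → con (+ 1) :- δ :+ (δ :+ h) := con (+ 1) :+ h) refl h δ)
                                    (0≤+ (proj₁ 0<1-δ) w) )
        in 0<-resp (trans (solve 4 (λ v δL h q → v :- δL :+ (δL :+ h :* q) := v :+ h :* q) refl v (δ * L) h q) (sym e))
             (0<+ 0<v-δL (proj₂ (∣*∣≤ ∣h∣≤δ ∣q∣≤L)))

  ∣x∣≤x : ∀ {x} → 0# < x → ∣ x ∣≤ x
  ∣x∣≤x {x} p = 0≤-resp (sym (-‿inverseʳ x)) ≤-refl , 0≤+ (proj₁ p) (proj₁ p)

  module _ {f : Carrier → Carrier} (F : Continuous f) (s : Carrier)
    (s-upper : UpperBound (λ t → f t ≤ 0#) s)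
    (s-least : ∀ b → UpperBound (λ t → f t ≤ 0#) b → s ≤ b) where

    sup-not-negative : ¬ (0# < - f s)
    sup-not-negative p with positive-near (neg-continuous F) p
    ... | δ , 0<δ , near =
      0≤∧0<-⇒⊥ (≤⇒0≤ (s-upper (s + δ)
                 (0≤⇒≤ (0≤-resp (sym (+-identityˡ _)) (proj₁ (near δ (∣x∣≤x 0<δ)))))))
               (0<-resp (solve 2 (λ s d → d := :- (s :- (s :+ d))) refl s δ) 0<δ)

    -- If `f s` were positive, so would be `f` on the interval from `s - δ` to `s`, and `s - δ`
    -- would already bound the set where `f t ≤ 0#`.
    sup-not-positive : ¬ (0# < f s)
    sup-not-positive p with positive-near F p
    ... | δ , 0<δ , near =
      0≤∧0<-⇒⊥ (≤⇒0≤ (s-least (s - δ) upper))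
               (0<-resp (solve 2 (λ s d → d := :- (s :- d :- s)) refl s δ) 0<δ)
      where
      upper : UpperBound (λ t → f t ≤ 0#) (s - δ)
      upper t t∈S with ≤-total t (s - δ)
      ... | inj₁ q = q
      ... | inj₂ q = ⊥-elim (proj₂ ft>0 (≤-antisym (proj₁ ft>0) t∈S))
        where
        ft>0 : 0# < f t
        ft>0 = 0<-resp (cong F (solve 2 (λ s t → s :+ (t :- s) := t) refl s t))
          (near (t - s)
            ( 0≤-resp (solve 3 (λ s t d → d :+ (s :- t) := d :- (t :- s)) refl s t δ)
                (0≤+ (proj₁ 0<δ) (≤⇒0≤ (s-upper t t∈S)))
            , 0≤-resp (solve 3 (λ s t d → t :- (s :- d) := d :+ (t :- s)) refl s t δ) (≤⇒0≤ q) ))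

    sup-root : f s ≈ 0#
    sup-root with sign (f s)
    ... | zero p     = p
    ... | negative p = ⊥-elim (sup-not-negative p)
    ... | positive p = ⊥-elim (sup-not-positive p)

  abstract
    -- The root is the supremum of all `t` with `f t ≤ 0#`. Unlike a root found by bisection, it
    -- comes with positivity of `f` everywhere to its right, which is what half turns need.
    last-root : ∀ {f} → Continuous f → ∀ a → 0# < - f a → ∃[ T ] (∀ t → T ≤ t → 0# < f t) →
      ∃[ s ] a < s × f s ≈ 0# × (∀ t → s < t → 0# < f t)
    last-root {f} F a fa<0 (T , T≤) = s , (a≤s , a≉s) , fs≈0 , beyond
      where
      S : Carrier → Set ℓ
      S t = f t ≤ 0#
      S-bound : UpperBound S T
      S-bound t ft≤0 with ≤-total t T
      ... | inj₁ p = p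
      ... | inj₂ p = ⊥-elim (proj₂ (T≤ t p) (≤-antisym (proj₁ (T≤ t p)) ft≤0))
      a∈S : S a
      a∈S = 0≤⇒≤ (0≤-resp (sym (+-identityˡ _)) (proj₁ fa<0))
      sup : ∃[ s ] UpperBound S s × (∀ b → UpperBound S b → s ≤ b)
      sup = supremum S (a , a∈S) (T , S-bound)
      s : Carrier
      s = proj₁ sup
      s-upper : UpperBound S s
      s-upper = proj₁ (proj₂ sup)
      s-least : ∀ b → UpperBound S b → s ≤ b
      s-least = proj₂ (proj₂ sup)
      a≤s : a ≤ s
      a≤s = s-upper a a∈S
      beyond : ∀ t → s < t → 0# < f t
      beyond t (s≤t , s≉t) = ≰⇒0< λ ft≤0 → s≉t (≤-antisym s≤t (s-upper t ft≤0))
      fs≈0 : f s ≈ 0#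
      fs≈0 = sup-root F s s-upper s-least
      a≉s : a ≉ s
      a≉s a≈s = proj₂ fa<0 (sym (trans (-‿cong (trans (cong F a≈s) fs≈0)) -0#≈0#))

  -- Powers and the comparison of growth.

  1≤^ : ∀ {x} k → 0# ≤ x - 1# → 0# ≤ x ^ k - 1#
  1≤^ ℕ.zero    p = ≤-reflexive (sym (-‿inverseʳ 1#))
  1≤^ {x} (ℕ.suc k) p = 0≤-resp
    (solve 2 (λ x y → (x :- con (+ 1)) :* (y :- con (+ 1)) :+ (x :- con (+ 1)) :+ (y :- con (+ 1))
                := x :* y :- con (+ 1)) refl x (x ^ k))
    (0≤+ (0≤+ (*-nonNegative p (1≤^ k p)) p) (1≤^ k p))

  0≤^ : ∀ {x} k → 0# ≤ x → 0# ≤ x ^ k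
  0≤^ ℕ.zero    p = proj₁ 0<1
  0≤^ (ℕ.suc k) p = *-nonNegative p (0≤^ k p)

  0<^ : ∀ {x} k → 0# < x → 0# < x ^ k
  0<^ ℕ.zero    p = 0<1
  0<^ (ℕ.suc k) p = 0<* p (0<^ k p)

  ^-mono : ∀ {x y} k → 0# ≤ x → 0# ≤ y - x → 0# ≤ y ^ k - x ^ k
  ^-mono ℕ.zero    _ _ = ≤-reflexive (sym (-‿inverseʳ 1#))
  ^-mono {x} {y} (ℕ.suc k) p q = 0≤-resp
    (solve 4 (λ x y a b → (y :- x) :* b :+ x :* (b :- a) := y :* b :- x :* a) refl x y (x ^ k) (y ^ k))
    (0≤+ (*-nonNegative q (0≤^ k (0≤-resp (solve 2 (λ x y → x :+ (y :- x) := y) refl x y) (0≤+ p q))))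
           (*-nonNegative p (^-mono k p q)))

  1^ : ∀ k → 1# ^ k ≈ 1#
  1^ ℕ.zero    = refl
  1^ (ℕ.suc k) = trans (*-identityˡ (1# ^ k)) (1^ k)

  module _ {K : Carrier} (0<K : 0# < K) where

    private
      R : Carrier
      -- Larger than both 1 and `K`, so each of its positive powers exceeds `K`.
      R = K + 1#

      0<R : 0# < R
      0<R = 0<+ 0<K (proj₁ 0<1)

      K<R^ : ∀ d → 0# < R ^ ℕ.suc d - K
      K<R^ d = 0<-resp
        (solve 2 (λ K x → (K :+ con (+ 1)) :* (x :- con (+ 1)) :+ con (+ 1) := (K :+ con (+ 1)) :* x :- K)
          refl K (R ^ d))
        (0<+′ (*-nonNegative (proj₁ 0<R)
          (1≤^ d (0≤-resp (solve 1 (λ K → K := K :+ con (+ 1) :- con (+ 1)) refl K) (proj₁ 0<K)))) 0<1)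

      not-larger : ∀ b d → ¬ (0# ≤ K * R ^ b - R ^ (b ℕ.+ ℕ.suc d))
      not-larger b d p = 0≤∧0<-⇒⊥ p (0<-resp
        (trans (solve 3 (λ x y K → x :* (y :- K) := :- (K :* x :- x :* y)) refl (R ^ b) (R ^ ℕ.suc d) K)
          (-‿cong (+-congˡ (-‿cong (sym (^-homo-* R b (ℕ.suc d)))))))
        (0<* (0<^ b 0<R) (K<R^ d)))

      not-smaller : ∀ a d → ¬ (0# ≤ K * (R ⁻¹) ^ (a ℕ.+ ℕ.suc d) - (R ⁻¹) ^ a)
      not-smaller a d p = not-larger 0 d (0≤-resp clear-denominator
        (*-nonNegative p (0≤^ (a ℕ.+ ℕ.suc d) (proj₁ 0<R))))
        where
        S : Carrier
        S = R ⁻¹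
        cancel : ∀ m → S ^ m * R ^ m ≈ 1#
        cancel m = trans (sym (^-distrib-* S R m)) (trans
          (^-congˡ m (trans (*-comm S R) (inverseʳ R (>⇒≉0 0<R)))) (1^ m))
        m = a ℕ.+ ℕ.suc d
        clear-denominator : (K * S ^ m - S ^ a) * R ^ m ≈ K * R ^ 0 - R ^ (ℕ.suc d)
        clear-denominator = begin
          (K * S ^ m - S ^ a) * R ^ m
            ≈⟨ solve 4 (λ K x y w → (K :* x :- y) :* w := K :* (x :* w) :- y :* w) refl K (S ^ m) (S ^ a) (R ^ m) ⟩
          K * (S ^ m * R ^ m) - S ^ a * R ^ m
            ≈⟨ +-cong (*-congˡ (cancel m)) (-‿cong (*-congˡ (^-homo-* R a (ℕ.suc d)))) ⟩
          K * 1# - S ^ a * (R ^ a * R ^ ℕ.suc d)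
            ≈⟨ +-congˡ (-‿cong (solve 3 (λ x y w → x :* (y :* w) := x :* y :* w) refl (S ^ a) (R ^ a) (R ^ ℕ.suc d))) ⟩
          K * 1# - S ^ a * R ^ a * R ^ ℕ.suc d
            ≈⟨ +-congˡ (-‿cong (trans (*-congʳ (cancel a)) (*-identityˡ _))) ⟩
          K * 1# - R ^ ℕ.suc d ∎

    -- One test point for each direction suffices. With `R = K + 1#`, the case `a > b` fails at `R`,
    -- because `R` to the power a - b exceeds `K`; the case `a < b` fails at `R ⁻¹` for the same
    -- reason after clearing denominators.
    same-growth : ∀ a b → (∀ r → 0# < r → 0# ≤ K * r ^ b - r ^ a) → a ≡ b
    same-growth a b dominates with ℕ.<-cmp a b
    ... | tri≈ _ a≡b _ = a≡b
    ... | tri< a<b _ _ = ⊥-elim (not-smaller a (b ∸ ℕ.suc a)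
      (≡.subst (λ c → 0# ≤ K * (R ⁻¹) ^ c - (R ⁻¹) ^ a) (≡.sym (split a<b)) (dominates _ (0<⁻¹ 0<R))))
      where
      split : ∀ {a b} → a ℕ.< b → a ℕ.+ ℕ.suc (b ∸ ℕ.suc a) ≡ b
      split {a} {b} a<b = ≡.trans (ℕ.+-suc a _) (ℕ.m+[n∸m]≡n a<b)
    ... | tri> _ _ b<a = ⊥-elim (not-larger b (a ∸ ℕ.suc b)
      (≡.subst (λ c → 0# ≤ K * R ^ b - R ^ c) (≡.sym (split b<a)) (dominates R 0<R)))
      where
      split : ∀ {a b} → a ℕ.< b → a ℕ.+ ℕ.suc (b ∸ ℕ.suc a) ≡ b
      split {a} {b} a<b = ≡.trans (ℕ.+-suc a _) (ℕ.m+[n∸m]≡n a<b)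

-- The field of complex numbers.

module ComplexField {ℓ} (ℝ : CompleteOrderedField ℓ) where

  private
    module ℝ = OrderedField ℝ
    open ℝ using (solve; con; _:+_; _:*_; _:-_; :-_; _:=_)

  open Complex ℝ

  ℂ-commutativeRing : CommutativeRing ℓ ℓ
  ℂ-commutativeRing = record
    { Carrier = ℂ ; _≈_ = _≈_ ; _+_ = _+_ ; _*_ = _*_ ; -_ = -_ ; 0# = 0# ; 1# = 1#
    ; isCommutativeRing = record
      { isRing = record
        { +-isAbelianGroup = record
          { isGroup = record
            { isMonoid = record
              { isSemigroup = record
                { isMagma = record
                  { isEquivalence = record
                    { refl  = ℝ.refl , ℝ.refl
                    ; sym   = λ (p , q) → ℝ.sym p , ℝ.sym q
                    ; trans = λ (p , q) (r , s) → ℝ.trans p r , ℝ.trans q s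
                    }
                  ; ∙-cong = λ (p , q) (r , s) → ℝ.+-cong p r , ℝ.+-cong q s
                  }
                ; assoc = λ (a +i b) (c +i d) (e +i f) → assoc a c e , assoc b d f
                }
              ; identity = (λ (a +i b) → ℝ.+-identityˡ a , ℝ.+-identityˡ b)
                         , (λ (a +i b) → ℝ.+-identityʳ a , ℝ.+-identityʳ b)
              }
            ; inverse = (λ (a +i b) → inverseˡ a , inverseˡ b)
                      , (λ (a +i b) → ℝ.-‿inverseʳ a , ℝ.-‿inverseʳ b)
            ; ⁻¹-cong = λ (p , q) → ℝ.-‿cong p , ℝ.-‿cong q
            }
          ; comm = λ (a +i b) (c +i d) → comm a c , comm b d
          }
        ; *-cong = λ (p , q) (r , s) →
            ℝ.+-cong (ℝ.*-cong p r) (ℝ.-‿cong (ℝ.*-cong q s)) , ℝ.+-cong (ℝ.*-cong p s) (ℝ.*-cong q r)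
        ; *-assoc = λ (a +i b) (c +i d) (e +i f) →
            solve 6 (λ a b c d e f → (a :* c :- b :* d) :* e :- (a :* d :+ b :* c) :* f
              := a :* (c :* e :- d :* f) :- b :* (c :* f :+ d :* e)) ℝ.refl a b c d e f ,
            solve 6 (λ a b c d e f → (a :* c :- b :* d) :* f :+ (a :* d :+ b :* c) :* e
              := a :* (c :* f :+ d :* e) :+ b :* (c :* e :- d :* f)) ℝ.refl a b c d e f
        ; *-identity = (λ (a +i b) →
              solve 2 (λ a b → con (+ 1) :* a :- con (+ 0) :* b := a) ℝ.refl a b ,
              solve 2 (λ a b → con (+ 1) :* b :+ con (+ 0) :* a := b) ℝ.refl a b)
            , (λ (a +i b) →
              solve 2 (λ a b → a :* con (+ 1) :- b :* con (+ 0) := a) ℝ.refl a b ,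
              solve 2 (λ a b → a :* con (+ 0) :+ b :* con (+ 1) := b) ℝ.refl a b)
        ; distrib = (λ (a +i b) (c +i d) (e +i f) →
              solve 6 (λ a b c d e f → a :* (c :+ e) :- b :* (d :+ f)
                := a :* c :- b :* d :+ (a :* e :- b :* f)) ℝ.refl a b c d e f ,
              solve 6 (λ a b c d e f → a :* (d :+ f) :+ b :* (c :+ e)
                := a :* d :+ b :* c :+ (a :* f :+ b :* e)) ℝ.refl a b c d e f)
            , (λ (a +i b) (c +i d) (e +i f) →
              solve 6 (λ a b c d e f → (c :+ e) :* a :- (d :+ f) :* b
                := c :* a :- d :* b :+ (e :* a :- f :* b)) ℝ.refl a b c d e f ,
              solve 6 (λ a b c d e f → (c :+ e) :* b :+ (d :+ f) :* a
                := c :* b :+ d :* a :+ (e :* b :+ f :* a)) ℝ.refl a b c d e f)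
        }
      ; *-comm = λ (a +i b) (c +i d) →
          solve 4 (λ a b c d → a :* c :- b :* d := c :* a :- d :* b) ℝ.refl a b c d ,
          solve 4 (λ a b c d → a :* d :+ b :* c := c :* b :+ d :* a) ℝ.refl a b c d
      }
    }
    where
    assoc : ∀ a b c → a ℝ.+ b ℝ.+ c ℝ.≈ a ℝ.+ (b ℝ.+ c)
    assoc = solve 3 (λ a b c → a :+ b :+ c := a :+ (b :+ c)) ℝ.refl
    comm : ∀ a b → a ℝ.+ b ℝ.≈ b ℝ.+ a
    comm = solve 2 (λ a b → a :+ b := b :+ a) ℝ.refl
    inverseˡ : ∀ a → ℝ.- a ℝ.+ a ℝ.≈ ℝ.0#
    inverseˡ = solve 1 (λ a → :- a :+ a := con (+ 0)) ℝ.refl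

  open CommutativeRing ℂ-commutativeRing public
    using ( refl; sym; trans; setoid; reflexive; +-cong; +-congˡ; +-congʳ; *-cong; *-congˡ; *-congʳ; -‿cong
          ; *-identityˡ; *-identityʳ; *-assoc; zeroˡ; zeroʳ; +-identityˡ; +-identityʳ; -‿inverseʳ
          ; semiring; commutativeSemiring; *-commutativeMonoid )
  open Exp semiring public using (^-congˡ; ^-homo-*)
  open IntegerCoefficients ℂ-commutativeRing public using ()
    renaming (solve to ℂ-solve; _:+_ to _⊕_; _:*_ to _⊗_; :-_ to ⊝_; _:=_ to _⊜_; con to ℂ-con)
  module ℂ-Reasoning = SetoidReasoning setoid
  open CommutativeExp commutativeSemiring public using (^-distrib-*)
  open SetoidReasoning ℝ.setoid

  -- The squared modulus, multiplicative without any square root. Its square is why doubled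
  -- exponents appear in the growth comparison.
  norm : ℂ → ℝ.Carrier
  norm (a +i b) = a ℝ.* a ℝ.+ b ℝ.* b

  0<norm : ∀ {w} → w ≉ 0# → ℝ.0# ℝ.< norm w
  0<norm {a +i b} w≉0 with a ℝ.≈? ℝ.0# | b ℝ.≈? ℝ.0#
  ... | no p  | _     = ℝ.0<+ (ℝ.0<² p) (ℝ.0≤² b)
  ... | yes _ | no q  = ℝ.0<+′ (ℝ.0≤² a) (ℝ.0<² q)
  ... | yes p | yes q = ⊥-elim (w≉0 (p , q))

  norm-cong : ∀ {v w} → v ≈ w → norm v ℝ.≈ norm w
  norm-cong (p , q) = ℝ.+-cong (ℝ.*-cong p p) (ℝ.*-cong q q)

  norm-* : ∀ v w → norm (v * w) ℝ.≈ norm v ℝ.* norm w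
  norm-* (a +i b) (c +i d) = solve 4 (λ a b c d →
    (a :* c :- b :* d) :* (a :* c :- b :* d) :+ (a :* d :+ b :* c) :* (a :* d :+ b :* c)
      := (a :* a :+ b :* b) :* (c :* c :+ d :* d)) ℝ.refl a b c d

  norm-^ : ∀ w n → norm (w ^ n) ℝ.≈ norm w ℝ.^ n
  norm-^ w ℕ.zero    = solve 0 (con (+ 1) :* con (+ 1) :+ con (+ 0) :* con (+ 0) := con (+ 1)) ℝ.refl
  norm-^ w (ℕ.suc n) = ℝ.trans (norm-* w (w ^ n)) (ℝ.*-congˡ (norm-^ w n))

  0<norm⇒≉0 : ∀ {w} → ℝ.0# ℝ.< norm w → w ≉ 0#
  0<norm⇒≉0 p q = proj₂ p (ℝ.sym (ℝ.trans (norm-cong q)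
    (solve 0 (con (+ 0) :* con (+ 0) :+ con (+ 0) :* con (+ 0) := con (+ 0)) ℝ.refl)))

  *-≉0 : ∀ {v w} → v ≉ 0# → w ≉ 0# → v * w ≉ 0#
  *-≉0 {v} {w} p q = 0<norm⇒≉0 (ℝ.0<-resp (ℝ.sym (norm-* v w)) (ℝ.0<* (0<norm p) (0<norm q)))

  1≉0 : 1# ≉ 0#
  1≉0 (p , _) = ℝ.0≉1 (ℝ.sym p)

  ^-≉0 : ∀ {w} → w ≉ 0# → ∀ n → w ^ n ≉ 0#
  ^-≉0 p ℕ.zero    = 1≉0
  ^-≉0 p (ℕ.suc n) = *-≉0 p (^-≉0 p n)

  0<im⇒≉0 : ∀ {w} → ℝ.0# ℝ.< im w → w ≉ 0#
  0<im⇒≉0 p (_ , q) = ℝ.>⇒≉0 p q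

  -≉0 : ∀ {w} → w ≉ 0# → - w ≉ 0#
  -≉0 {a +i b} p (q , r) = p (neg q , neg r)
    where
    neg : ∀ {x} → ℝ.- x ℝ.≈ ℝ.0# → x ℝ.≈ ℝ.0#
    neg {x} e = ℝ.trans (solve 1 (λ x → x := :- :- x) ℝ.refl x) (ℝ.trans (ℝ.-‿cong e) ℝ.-0#≈0#)

  *-inverseʳ : ∀ {w} → w ≉ 0# → w * w ⁻¹ ≈ 1#
  *-inverseʳ {a +i b} w≉0 =
    ℝ.trans (solve 3 (λ a b i → a :* (a :* i) :- b :* (:- b :* i) := (a :* a :+ b :* b) :* i) ℝ.refl a b (N ℝ.⁻¹))
      (ℝ.inverseʳ N (ℝ.>⇒≉0 (0<norm w≉0))) ,
    solve 3 (λ a b i → a :* (:- b :* i) :+ b :* (a :* i) := con (+ 0)) ℝ.refl a b (N ℝ.⁻¹)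
    where N = norm (a +i b)

  ⁻¹≉0 : ∀ {w} → w ≉ 0# → w ⁻¹ ≉ 0#
  ⁻¹≉0 {w} w≉0 e = 1≉0 (trans (sym (*-inverseʳ w≉0)) (trans (*-congˡ e) (zeroʳ w)))

  ofℝ : ℝ.Carrier → ℂ
  ofℝ x = x +i ℝ.0#

  ofℝ-cong : ∀ {x y} → x ℝ.≈ y → ofℝ x ≈ ofℝ y
  ofℝ-cong p = p , ℝ.refl

  ofℝ-* : ∀ x y → ofℝ x * ofℝ y ≈ ofℝ (x ℝ.* y)
  ofℝ-* x y = solve 2 (λ x y → x :* y :- con (+ 0) :* con (+ 0) := x :* y) ℝ.refl x y ,
              solve 2 (λ x y → x :* con (+ 0) :+ con (+ 0) :* y := con (+ 0)) ℝ.refl x y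

  ofℝ-*ˡ : ∀ x w → ofℝ x * w ≈ (x ℝ.* re w) +i (x ℝ.* im w)
  ofℝ-*ˡ x (a +i b) = solve 3 (λ x a b → x :* a :- con (+ 0) :* b := x :* a) ℝ.refl x a b ,
                      solve 3 (λ x a b → x :* b :+ con (+ 0) :* a := x :* b) ℝ.refl x a b

  ofℝ-^ : ∀ x n → ofℝ x ^ n ≈ ofℝ (x ℝ.^ n)
  ofℝ-^ x ℕ.zero    = refl
  ofℝ-^ x (ℕ.suc n) = trans (*-congˡ (ofℝ-^ x n)) (ofℝ-* x (x ℝ.^ n))

-- Roots in the upper half plane, found along the line t + i.

module ComplexRoots {ℓ} (ℝ : CompleteOrderedField ℓ) where

  private
    module ℝ = OrderedField ℝ
    open ℝ using (solve; con; _:+_; _:*_; _:-_; :-_; _:=_; _-_)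

  open Complex ℝ
  open ComplexField ℝ
  open SetoidReasoning ℝ.setoid
  open ℝ.Continuous

  -- Up to a positive factor these are all points of the upper half plane, with the argument falling
  -- from π to 0 as `t` grows. Directions are thereby parametrised by one real variable, t being the
  -- cotangent of the argument.
  line : ℝ.Carrier → ℂ
  line t = t +i ℝ.1#

  Re Im : ℕ → ℝ.Carrier → ℝ.Carrier
  Re n t = re (line t ^ n)
  Im n t = im (line t ^ n)

  Re-continuous : ∀ n → ℝ.Continuous (Re n)
  Im-continuous : ∀ n → ℝ.Continuous (Im n)
  Re-continuous ℕ.zero    = ℝ.const-continuous ℝ.1#
  Re-continuous (ℕ.suc n) = ℝ.+-continuous (ℝ.*-continuous ℝ.id-continuous (Re-continuous n))
    (ℝ.neg-continuous (ℝ.*-continuous (ℝ.const-continuous ℝ.1#) (Im-continuous n)))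
  Im-continuous ℕ.zero    = ℝ.const-continuous ℝ.0#
  Im-continuous (ℕ.suc n) = ℝ.+-continuous (ℝ.*-continuous ℝ.id-continuous (Im-continuous n))
    (ℝ.*-continuous (ℝ.const-continuous ℝ.1#) (Re-continuous n))

  ^-continuous : ∀ n → ℝ.Continuous (ℝ._^ n)
  ^-continuous ℕ.zero    = ℝ.const-continuous ℝ.1#
  ^-continuous (ℕ.suc n) = ℝ.*-continuous ℝ.id-continuous (^-continuous n)

  -- The direction of (t + i)ⁿ tends to that of the positive real axis as t → ∞.
  Re-dominates : ∀ n K → ℝ.0# ℝ.≤ K →
    ∃[ T ] ℝ.0# ℝ.≤ T × (∀ t → T ℝ.≤ t → ℝ.0# ℝ.< Re n t - K ℝ.* Im n t × ℝ.0# ℝ.≤ Im n t)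
  Re-dominates ℕ.zero K 0≤K = ℝ.0# , ℝ.≤-refl , λ t _ →
    ℝ.0<-resp (solve 1 (λ K → con (+ 1) := con (+ 1) :- K :* con (+ 0)) ℝ.refl K) ℝ.0<1 , ℝ.≤-refl
  Re-dominates (ℕ.suc n) K 0≤K
    -- The induction needs the steeper slope K + 1: with Q and P the real and imaginary parts of the
    -- n-th power, the new difference is (t - K)(Q - (K + 1) P) plus a multiple of P that is
    -- non-negative for large t.
    with Re-dominates n (K ℝ.+ ℝ.1#) (ℝ.0≤+ 0≤K (proj₁ ℝ.0<1))
  ... | T , 0≤T , T≤ = T ℝ.+ B , ℝ.0≤+ 0≤T 0≤B , λ t T+B≤t → eventually t (ℝ.≤⇒0≤ T+B≤t)
    where
    1≥0 = proj₁ ℝ.0<1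
    B : ℝ.Carrier
    -- Chosen so that t ≥ B makes both coefficients in the identity below, t - K and t - (K (K + 1)
    -- + 1), non-negative, the former strictly positive.
    B = K ℝ.* (K ℝ.+ ℝ.1#) ℝ.+ (ℝ.1# ℝ.+ ℝ.1#)
    0≤K[K+1] = ℝ.*-nonNegative 0≤K (ℝ.0≤+ 0≤K 1≥0)
    0≤B : ℝ.0# ℝ.≤ B
    0≤B = ℝ.0≤+ 0≤K[K+1] (ℝ.0≤+ 1≥0 1≥0)
    eventually : ∀ t → ℝ.0# ℝ.≤ t - (T ℝ.+ B) →
      ℝ.0# ℝ.< Re (ℕ.suc n) t - K ℝ.* Im (ℕ.suc n) t × ℝ.0# ℝ.≤ Im (ℕ.suc n) t
    eventually t 0≤d =
      ℝ.0<-resp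
        (solve 4 (λ t K Q P → (t :- K) :* (Q :- (K :+ con (+ 1)) :* P)
            :+ (t :- (K :* (K :+ con (+ 1)) :+ con (+ 1))) :* P
            := t :* Q :- con (+ 1) :* P :- K :* (t :* P :+ con (+ 1) :* Q)) ℝ.refl t K Q P)
        (ℝ.0<+ (ℝ.0<* 0<t-K 0<Q-K′P) (ℝ.*-nonNegative 0≤t-B+1 0≤P)) ,
      ℝ.0≤+ (ℝ.*-nonNegative 0≤t 0≤P) (ℝ.*-nonNegative 1≥0 0≤Q)
      where
      Q P : ℝ.Carrier
      Q = Re n t
      P = Im n t
      ih = T≤ t (ℝ.0≤⇒≤ (ℝ.0≤-resp (solve 3 (λ t T B → t :- (T :+ B) :+ B := t :- T) ℝ.refl t T B) (ℝ.0≤+ 0≤d 0≤B)))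
      0<Q-K′P = proj₁ ih
      0≤P = proj₂ ih
      0≤Q : ℝ.0# ℝ.≤ Q
      0≤Q = ℝ.0≤-resp (solve 3 (λ Q K P → Q :- K :* P :+ K :* P := Q) ℝ.refl Q (K ℝ.+ ℝ.1#) P)
              (ℝ.0≤+ (proj₁ 0<Q-K′P) (ℝ.*-nonNegative (ℝ.0≤+ 0≤K 1≥0) 0≤P))
      0≤t-B : ℝ.0# ℝ.≤ t - B
      0≤t-B = ℝ.0≤-resp (solve 3 (λ t T B → t :- (T :+ B) :+ T := t :- B) ℝ.refl t T B) (ℝ.0≤+ 0≤d 0≤T)
      0≤t : ℝ.0# ℝ.≤ t
      0≤t = ℝ.0≤-resp (solve 2 (λ t B → t :- B :+ B := t) ℝ.refl t B) (ℝ.0≤+ 0≤t-B 0≤B)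
      0≤t-B+1 : ℝ.0# ℝ.≤ t - (K ℝ.* (K ℝ.+ ℝ.1#) ℝ.+ ℝ.1#)
      0≤t-B+1 = ℝ.0≤-resp (solve 2 (λ t B → t :- (B :+ (con (+ 1) :+ con (+ 1))) :+ con (+ 1) := t :- (B :+ con (+ 1)))
                  ℝ.refl t (K ℝ.* (K ℝ.+ ℝ.1#))) (ℝ.0≤+ 0≤t-B 1≥0)
      0<t-K : ℝ.0# ℝ.< t - K
      0<t-K = ℝ.0<-resp (solve 2 (λ t K → t :- (K :* (K :+ con (+ 1)) :+ con (+ 1)) :+ K :* K :+ con (+ 1) := t :- K) ℝ.refl t K)
                (ℝ.0<+′ (ℝ.0≤+ 0≤t-B+1 (ℝ.0≤² K)) ℝ.0<1)

  -- τ = cot (π / n): on t > τ the argument of (t + i)ⁿ stays in (0, π), and it reaches π at τ.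
  record HalfTurn (n : ℕ) : Set ℓ where
    field
      τ      : ℝ.Carrier
      0≤τ    : ℝ.0# ℝ.≤ τ
      Im≈0   : Im n τ ℝ.≈ ℝ.0#
      Re<0   : ℝ.0# ℝ.< ℝ.- Re n τ
      beyond : ∀ t → τ ℝ.< t → ℝ.0# ℝ.< Im n t

  open HalfTurn

  -- The induction starts at 2, with cot (π / 2) = 0. Exponent 1 has no half-turn point, since t + i
  -- is never real.
  half-turn-2 : HalfTurn 2
  half-turn-2 = record
    { τ      = ℝ.0#
    ; 0≤τ    = ℝ.≤-refl
    ; Im≈0   = solve 0 (con (+ 0) :* (con (+ 0) :* con (+ 0) :+ con (+ 1) :* con (+ 1))
                 :+ con (+ 1) :* (con (+ 0) :* con (+ 1) :- con (+ 1) :* con (+ 0)) := con (+ 0)) ℝ.refl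
    ; Re<0   = ℝ.0<-resp
                 (solve 0 (con (+ 1) := :- (con (+ 0) :* (con (+ 0) :* con (+ 1) :- con (+ 1) :* con (+ 0))
                   :- con (+ 1) :* (con (+ 0) :* con (+ 0) :+ con (+ 1) :* con (+ 1)))) ℝ.refl) ℝ.0<1
    ; beyond = λ t 0<t → ℝ.0<-resp
                 (solve 1 (λ t → t :+ t := t :* (t :* con (+ 0) :+ con (+ 1) :* con (+ 1))
                   :+ con (+ 1) :* (t :* con (+ 1) :- con (+ 1) :* con (+ 0))) ℝ.refl t)
                 (ℝ.0<+ 0<t (proj₁ 0<t))
    }

  -- At the old `τ` the n-th power is a negative real, so one more factor t + i makes the imaginary
  -- part negative; it is eventually positive, so its last root lies strictly to the right.
  -- Strictness is recorded because it makes `τ` positive from exponent 3 on.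
  half-turn-suc : ∀ {n} (H : HalfTurn n) → ∃[ H′ ] τ {n} H ℝ.< τ {ℕ.suc n} H′
  half-turn-suc {n} H = extend (ℝ.last-root (Im-continuous (ℕ.suc n)) t₀ 0<-f (T , eventually))
    where
    t₀ : ℝ.Carrier
    t₀ = τ H
    0<-f : ℝ.0# ℝ.< ℝ.- Im (ℕ.suc n) t₀
    0<-f = ℝ.0<-resp (begin
      ℝ.- Re n t₀                                 ≈⟨ solve 2 (λ t Q → :- Q := :- (t :* con (+ 0) :+ con (+ 1) :* Q)) ℝ.refl t₀ (Re n t₀) ⟩
      ℝ.- (t₀ ℝ.* ℝ.0# ℝ.+ ℝ.1# ℝ.* Re n t₀)       ≈⟨ ℝ.-‿cong (ℝ.+-congʳ (ℝ.*-congˡ (Im≈0 H))) ⟨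
      ℝ.- Im (ℕ.suc n) t₀                         ∎) (Re<0 H)
    asymptotics = Re-dominates n ℝ.0# ℝ.≤-refl
    T = proj₁ asymptotics
    eventually : ∀ t → T ℝ.≤ t → ℝ.0# ℝ.< Im (ℕ.suc n) t
    eventually t T≤t =
      let 0≤T , T≤ = proj₂ asymptotics
          0<Re , 0≤Im = T≤ t T≤t
      in ℝ.0<-resp (solve 3 (λ t Q P → t :* P :+ (Q :- con (+ 0) :* P) := t :* P :+ con (+ 1) :* Q) ℝ.refl t (Re n t) (Im n t))
           (ℝ.0<+′ (ℝ.*-nonNegative (ℝ.≤-trans 0≤T T≤t) 0≤Im) 0<Re)
    extend : (∃[ s ] t₀ ℝ.< s × Im (ℕ.suc n) s ℝ.≈ ℝ.0# × (∀ t → s ℝ.< t → ℝ.0# ℝ.< Im (ℕ.suc n) t)) →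
           ∃[ H′ ] t₀ ℝ.< τ {ℕ.suc n} H′
    extend (s , t₀<s , e , s<) = record
      { τ = s ; 0≤τ = ℝ.≤-trans (0≤τ H) (proj₁ t₀<s) ; Im≈0 = e ; beyond = s<
      -- The imaginary part of (s - i)(s + i)^(n+1) = (s² + 1)(s + i)^n. Since s lies beyond the old
      -- `τ`, the right-hand side has positive imaginary part.
      ; Re<0 = ℝ.0<-resp (begin
          (s ℝ.* s ℝ.+ ℝ.1#) ℝ.* P
            ≈⟨ solve 3 (λ s Q P → (s :* s :+ con (+ 1)) :* P
                 := :- (s :* Q :- con (+ 1) :* P) :+ s :* (s :* P :+ con (+ 1) :* Q)) ℝ.refl s Q P ⟩
          ℝ.- Re (ℕ.suc n) s ℝ.+ s ℝ.* Im (ℕ.suc n) s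
            ≈⟨ ℝ.+-congˡ (ℝ.trans (ℝ.*-congˡ e) (ℝ.zeroʳ s)) ⟩
          ℝ.- Re (ℕ.suc n) s ℝ.+ ℝ.0#
            ≈⟨ ℝ.+-identityʳ _ ⟩
          ℝ.- Re (ℕ.suc n) s ∎)
          (ℝ.0<* (ℝ.0<+′ (ℝ.0≤² s) ℝ.0<1) (beyond H s t₀<s))
      } , t₀<s
      where
      Q P : ℝ.Carrier
      Q = Re n s
      P = Im n s

  abstract
    half-turn : ∀ m → HalfTurn (2 ℕ.+ m)
    half-turn ℕ.zero    = half-turn-2
    half-turn (ℕ.suc m) = proj₁ (half-turn-suc (half-turn m))

    0<τ : ∀ m → ℝ.0# ℝ.< τ (half-turn (ℕ.suc m))
    0<τ m = let 0≤τ₀ = 0≤τ (half-turn m)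
                t₀≤s , t₀≉s = proj₂ (half-turn-suc (half-turn m))
            in ℝ.≤-trans 0≤τ₀ t₀≤s , λ e → t₀≉s (ℝ.≤-antisym t₀≤s (ℝ.≤-respˡ e 0≤τ₀))

  abstract
    real-root : ∀ k {c} → ℝ.0# ℝ.< c → ∃[ s ] ℝ.0# ℝ.< s × s ℝ.^ ℕ.suc k ℝ.≈ c
    real-root k {c} 0<c =
      let s , 0<s , e , _ = ℝ.last-root (ℝ.+-continuous (^-continuous (ℕ.suc k)) (ℝ.const-continuous (ℝ.- c)))
            ℝ.0# (ℝ.0<-resp (solve 2 (λ c z → c := :- (con (+ 0) :* z :- c)) ℝ.refl c (ℝ.0# ℝ.^ k)) 0<c)
            -- Beyond c + 1 one has t ≥ 1, so t^(k+1) ≥ t > c.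
            (c ℝ.+ ℝ.1# , eventually)
      in s , 0<s , (begin
        s ℝ.^ ℕ.suc k               ≈⟨ solve 2 (λ x c → x := x :- c :+ c) ℝ.refl (s ℝ.^ ℕ.suc k) c ⟩
        s ℝ.^ ℕ.suc k - c ℝ.+ c     ≈⟨ ℝ.+-congʳ e ⟩
        ℝ.0# ℝ.+ c                  ≈⟨ ℝ.+-identityˡ c ⟩
        c                           ∎)
      where
      eventually : ∀ t → c ℝ.+ ℝ.1# ℝ.≤ t → ℝ.0# ℝ.< t ℝ.^ ℕ.suc k - c
      eventually t c+1≤t =
        let 0≤d = ℝ.≤⇒0≤ c+1≤t
            0≤t-1 = ℝ.0≤-resp (solve 2 (λ t c → t :- (c :+ con (+ 1)) :+ c := t :- con (+ 1)) ℝ.refl t c)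
                      (ℝ.0≤+ 0≤d (proj₁ 0<c))
            0≤t = ℝ.0≤-resp (solve 1 (λ t → t :- con (+ 1) :+ con (+ 1) := t) ℝ.refl t) (ℝ.0≤+ 0≤t-1 (proj₁ ℝ.0<1))
        in ℝ.0<-resp (solve 3 (λ t c x → t :* (x :- con (+ 1)) :+ (t :- (c :+ con (+ 1))) :+ con (+ 1) := t :* x :- c)
                        ℝ.refl t c (t ℝ.^ k))
             (ℝ.0<+′ (ℝ.0≤+ (ℝ.*-nonNegative 0≤t (ℝ.1≤^ k 0≤t-1)) 0≤d) ℝ.0<1)

  PositiveReal : ℂ → Set ℓ
  PositiveReal w = Real w × ℝ.0# ℝ.< re w

  -- Only the direction of a power has to be matched: a real root of 1 / r corrects the modulus, and
  -- scaling by a positive real preserves the upper half plane.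
  rescale-root : ∀ k {y w r} → ℝ.0# ℝ.< im y → ℝ.0# ℝ.< r → y ^ ℕ.suc k ≈ ofℝ r * w →
    ∃[ x ] ℝ.0# ℝ.< im x × x ^ ℕ.suc k ≈ w
  rescale-root k {y} {w} {r} 0<y 0<r e =
    let s , 0<s , s^ = real-root k (ℝ.0<⁻¹ 0<r) in
    ofℝ s * y , ℝ.0<-resp (ℝ.sym (proj₂ (ofℝ-*ˡ s y))) (ℝ.0<* 0<s 0<y) , (R.begin
      (ofℝ s * y) ^ ℕ.suc k                     R.≈⟨ ^-distrib-* (ofℝ s) y (ℕ.suc k) ⟩
      ofℝ s ^ ℕ.suc k * y ^ ℕ.suc k             R.≈⟨ *-cong (trans (ofℝ-^ s (ℕ.suc k)) (ofℝ-cong s^)) e ⟩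
      ofℝ (r ℝ.⁻¹) * (ofℝ r * w)                R.≈⟨ *-assoc (ofℝ (r ℝ.⁻¹)) (ofℝ r) w ⟨
      ofℝ (r ℝ.⁻¹) * ofℝ r * w                  R.≈⟨ *-congʳ (trans (ofℝ-* (r ℝ.⁻¹) r) (ofℝ-cong
                                                       (ℝ.trans (ℝ.*-comm (r ℝ.⁻¹) r) (ℝ.inverseʳ r (ℝ.>⇒≉0 0<r))))) ⟩
      1# * w                                    R.≈⟨ *-identityˡ w ⟩
      w                                         R.∎)
    where module R = ℂ-Reasoning

  -- The cross product `F` of (t + i)^n and w is negative at `τ`, where the power is a negative
  -- real, and eventually positive. At its root the two are parallel, and they point the same way
  -- because both imaginary parts are positive.
  arc : ∀ {n} (H : HalfTurn n) w → ℝ.0# ℝ.< im w →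
    ∃[ u ] τ H ℝ.< u × ∃[ r ] ℝ.0# ℝ.< r × line u ^ n ≈ ofℝ r * w
  arc {n} H (a +i b) 0<b = found (ℝ.last-root F-continuous (τ H) 0<-f (T , eventually))
    where
    F : ℝ.Carrier → ℝ.Carrier
    F t = Re n t ℝ.* b ℝ.+ ℝ.- (Im n t ℝ.* a)
    F-continuous : ℝ.Continuous F
    F-continuous = ℝ.+-continuous (ℝ.*-continuous (Re-continuous n) (ℝ.const-continuous b))
      (ℝ.neg-continuous (ℝ.*-continuous (Im-continuous n) (ℝ.const-continuous a)))
    b*b⁻¹ : b ℝ.* b ℝ.⁻¹ ℝ.≈ ℝ.1#
    b*b⁻¹ = ℝ.inverseʳ b (ℝ.>⇒≉0 0<b)
    0<-f : ℝ.0# ℝ.< ℝ.- F (τ H)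
    0<-f = ℝ.0<-resp (begin
      ℝ.- Re n (τ H) ℝ.* b               ≈⟨ solve 3 (λ Q a b → :- Q :* b := :- (Q :* b :- con (+ 0) :* a)) ℝ.refl (Re n (τ H)) a b ⟩
      ℝ.- (Re n (τ H) ℝ.* b - ℝ.0# ℝ.* a) ≈⟨ ℝ.-‿cong (ℝ.+-congˡ (ℝ.-‿cong (ℝ.*-congʳ (Im≈0 H)))) ⟨
      ℝ.- F (τ H)                        ∎) (ℝ.0<* (Re<0 H) 0<b)
    A = proj₁ (ℝ.bounded a)
    ∣a∣≤A = proj₂ (ℝ.bounded a)
    -- With slope A / b, domination gives b Re > A Im ≥ a Im, which is positivity of `F`.
    asymptotics = Re-dominates n (A ℝ.* b ℝ.⁻¹) (ℝ.*-nonNegative (ℝ.∣∣≤⇒0≤ ∣a∣≤A) (proj₁ (ℝ.0<⁻¹ 0<b)))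
    T = proj₁ asymptotics
    eventually : ∀ t → T ℝ.≤ t → ℝ.0# ℝ.< F t
    eventually t T≤t =
      let p , q = proj₂ (proj₂ asymptotics) t T≤t in
      ℝ.0<-resp (begin
        b ℝ.* (Re n t - A ℝ.* b ℝ.⁻¹ ℝ.* Im n t) ℝ.+ (A - a) ℝ.* Im n t
          ≈⟨ solve 6 (λ b i A a Q P → b :* (Q :- A :* i :* P) :+ (A :- a) :* P
                := Q :* b :- P :* a :+ (A :* P :- b :* i :* (A :* P)))
               ℝ.refl b (b ℝ.⁻¹) A a (Re n t) (Im n t) ⟩
        F t ℝ.+ (A ℝ.* Im n t - b ℝ.* b ℝ.⁻¹ ℝ.* (A ℝ.* Im n t))
          ≈⟨ ℝ.+-congˡ (ℝ.+-congˡ (ℝ.-‿cong (ℝ.trans (ℝ.*-congʳ b*b⁻¹) (ℝ.*-identityˡ _)))) ⟩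
        F t ℝ.+ (A ℝ.* Im n t - A ℝ.* Im n t)
          ≈⟨ ℝ.trans (ℝ.+-congˡ (ℝ.-‿inverseʳ _)) (ℝ.+-identityʳ _) ⟩
        F t ∎)
        (ℝ.0<+ (ℝ.0<* 0<b p) (ℝ.*-nonNegative (proj₁ ∣a∣≤A) q))
    found : (∃[ u ] τ H ℝ.< u × F u ℝ.≈ ℝ.0# × (∀ t → u ℝ.< t → ℝ.0# ℝ.< F t)) →
            ∃[ u ] τ H ℝ.< u × ∃[ r ] ℝ.0# ℝ.< r × line u ^ n ≈ ofℝ r * (a +i b)
    found (u , τ<u , e , _) = u , τ<u , Im n u ℝ.* b ℝ.⁻¹ , ℝ.0<* (beyond H u τ<u) (ℝ.0<⁻¹ 0<b) ,
      trans
        ( (begin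
            Re n u                                       ≈⟨ ℝ.*-identityʳ _ ⟨
            Re n u ℝ.* ℝ.1#                              ≈⟨ ℝ.*-congˡ b*b⁻¹ ⟨
            Re n u ℝ.* (b ℝ.* b ℝ.⁻¹)                    ≈⟨ solve 5 (λ Q b i P a → Q :* (b :* i)
                                                              := (Q :* b :- P :* a) :* i :+ P :* i :* a)
                                                              ℝ.refl (Re n u) b (b ℝ.⁻¹) (Im n u) a ⟩
            F u ℝ.* b ℝ.⁻¹ ℝ.+ Im n u ℝ.* b ℝ.⁻¹ ℝ.* a   ≈⟨ ℝ.+-congʳ (ℝ.trans (ℝ.*-congʳ e) (ℝ.zeroˡ _)) ⟩
            ℝ.0# ℝ.+ Im n u ℝ.* b ℝ.⁻¹ ℝ.* a             ≈⟨ ℝ.+-identityˡ _ ⟩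
            Im n u ℝ.* b ℝ.⁻¹ ℝ.* a                      ∎)
        , (begin
            Im n u                                       ≈⟨ ℝ.*-identityʳ _ ⟨
            Im n u ℝ.* ℝ.1#                              ≈⟨ ℝ.*-congˡ b*b⁻¹ ⟨
            Im n u ℝ.* (b ℝ.* b ℝ.⁻¹)                    ≈⟨ solve 3 (λ P b i → P :* (b :* i) := P :* i :* b) ℝ.refl (Im n u) b (b ℝ.⁻¹) ⟩
            Im n u ℝ.* b ℝ.⁻¹ ℝ.* b                      ∎) )
        (sym (ofℝ-*ˡ _ (a +i b)))

  half-turn-power : ∀ {n} (H : HalfTurn n) → line (τ H) ^ n ≈ ofℝ (Re n (τ H))
  half-turn-power H = ℝ.refl , Im≈0 H

  abstract
    -- For im w < 0 the root is the product of a point on the arc of - w and the half-turn point τ + i.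
    root-in-upper-half-plane : ∀ m w → w ≉ 0# →
      (∃[ x ] ℝ.0# ℝ.< im x × x ^ (2 ℕ.+ m) ≈ w) ⊎ (m ≡ 0 × PositiveReal w)
    root-in-upper-half-plane m w w≉0 with ℝ.sign (im w)
    ... | ℝ.positive 0<b =
      let u , _ , r , 0<r , e = arc (half-turn m) w 0<b
      in inj₁ (rescale-root (ℕ.suc m) ℝ.0<1 0<r e)
    ... | ℝ.negative b<0 =
      let H = half-turn m
          u , τ<u , r , 0<r , e = arc H (- w) b<0
      in inj₁ (rescale-root (ℕ.suc m) {line u * line (τ H)}
        (ℝ.0<-resp (solve 2 (λ u t → u :- t :+ (t :+ t) := u :* con (+ 1) :+ con (+ 1) :* t) ℝ.refl u (τ H))
          (ℝ.0<+ (ℝ.<⇒0< τ<u) (ℝ.0≤+ (0≤τ H) (0≤τ H))))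
        (ℝ.0<* 0<r (Re<0 H))
        (trans (^-distrib-* (line u) (line (τ H)) (2 ℕ.+ m))
          (trans (*-cong e (half-turn-power H)) (lemma r (Re (2 ℕ.+ m) (τ H)) w))))
      where
      lemma : ∀ r q w → ofℝ r * - w * ofℝ q ≈ ofℝ (r ℝ.* ℝ.- q) * w
      lemma r q (a +i b) =
        solve 4 (λ r q a b → (r :* :- a :- con (+ 0) :* :- b) :* q :- (r :* :- b :+ con (+ 0) :* :- a) :* con (+ 0)
          := r :* :- q :* a :- con (+ 0) :* b) ℝ.refl r q a b ,
        solve 4 (λ r q a b → (r :* :- a :- con (+ 0) :* :- b) :* con (+ 0) :+ (r :* :- b :+ con (+ 0) :* :- a) :* q
          := r :* :- q :* b :+ con (+ 0) :* a) ℝ.refl r q a b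
    ... | ℝ.zero b≈0 with ℝ.sign (re w)
    ...   | ℝ.zero a≈0 = ⊥-elim (w≉0 (a≈0 , b≈0))
    -- A negative real is reached by the half-turn point itself.
    ...   | ℝ.negative a<0 =
      let H = half-turn m
      in inj₁ (rescale-root (ℕ.suc m) {line (τ H)} ℝ.0<1 (ℝ.0<* (Re<0 H) (ℝ.0<⁻¹ a<0))
        (trans (half-turn-power H) (real-multiple (Re (2 ℕ.+ m) (τ H)) a<0)))
      where
      real-multiple : ∀ q → ℝ.0# ℝ.< ℝ.- re w → ofℝ q ≈ ofℝ (ℝ.- q ℝ.* (ℝ.- re w) ℝ.⁻¹) * w
      real-multiple q 0<-a =
        let a = re w ; i = (ℝ.- re w) ℝ.⁻¹ in
        trans
          ( (begin
              q                          ≈⟨ ℝ.*-identityʳ q ⟨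
              q ℝ.* ℝ.1#                 ≈⟨ ℝ.*-congˡ (ℝ.inverseʳ (ℝ.- a) (ℝ.>⇒≉0 0<-a)) ⟨
              q ℝ.* (ℝ.- a ℝ.* i)        ≈⟨ solve 3 (λ q a i → q :* (:- a :* i) := :- q :* i :* a) ℝ.refl q a i ⟩
              ℝ.- q ℝ.* i ℝ.* a          ∎)
          , ℝ.trans (ℝ.sym (ℝ.zeroʳ _)) (ℝ.*-congˡ (ℝ.sym b≈0)) )
          (sym (ofℝ-*ˡ _ w))
    ...   | ℝ.positive 0<a with m
    ...     | ℕ.zero   = inj₂ (≡.refl , b≈0 , 0<a)
    -- Two half turns make a full turn: the n-th power of (τ + i)² is a positive real. This square
    -- has imaginary part 2 τ, which is positive for n ≥ 3 but zero for n = 2.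
    ...     | ℕ.suc m′ =
      let H = half-turn (ℕ.suc m′)
          q = Re (3 ℕ.+ m′) (τ H)
      in inj₁ (rescale-root (ℕ.suc (ℕ.suc m′)) {line (τ H) * line (τ H)}
        (ℝ.0<-resp (solve 1 (λ t → t :+ t := t :* con (+ 1) :+ con (+ 1) :* t) ℝ.refl (τ H))
          (ℝ.0<+ (0<τ m′) (0≤τ H)))
        (ℝ.0<* (ℝ.0<* (Re<0 H) (Re<0 H)) (ℝ.0<⁻¹ 0<a))
        (trans (^-distrib-* (line (τ H)) (line (τ H)) (3 ℕ.+ m′))
          (trans (*-cong (half-turn-power H) (half-turn-power H)) (trans (ofℝ-* q q) (real-multiple q)))))
      where
      real-multiple : ∀ q → ofℝ (q ℝ.* q) ≈ ofℝ (ℝ.- q ℝ.* ℝ.- q ℝ.* (re w) ℝ.⁻¹) * w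
      real-multiple q =
        let a = re w ; i = (re w) ℝ.⁻¹ in
        trans
          ( (begin
              q ℝ.* q                    ≈⟨ ℝ.*-identityʳ _ ⟨
              q ℝ.* q ℝ.* ℝ.1#           ≈⟨ ℝ.*-congˡ (ℝ.inverseʳ a (ℝ.>⇒≉0 0<a)) ⟨
              q ℝ.* q ℝ.* (a ℝ.* i)      ≈⟨ solve 3 (λ q a i → q :* q :* (a :* i) := :- q :* :- q :* i :* a) ℝ.refl q a i ⟩
              ℝ.- q ℝ.* ℝ.- q ℝ.* i ℝ.* a ∎)
          , ℝ.trans (ℝ.sym (ℝ.zeroʳ _)) (ℝ.*-congˡ (ℝ.sym b≈0)) )
          (sym (ofℝ-*ˡ _ w))

    -- Any root will do here, so the positive reals that the half plane may miss are served by a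
    -- real root.
    root : ∀ k {w} → w ≉ 0# → ∃[ u ] u ^ ℕ.suc k ≈ w
    root ℕ.zero    {w} _ = w , *-identityʳ w
    root (ℕ.suc m) {w} w≉0 with root-in-upper-half-plane m w w≉0
    ... | inj₁ (x , _ , e) = x , e
    ... | inj₂ (_ , b≈0 , 0<a) =
      let s , _ , e = real-root (ℕ.suc m) 0<a
      in ofℝ s , trans (ofℝ-^ s (2 ℕ.+ m)) (e , ℝ.sym b≈0)

-- Finite sums in a commutative monoid with at most two non-neutral terms.

module SparseSums {c ℓ} (M : CommutativeMonoid c ℓ) where

  open CommutativeMonoid M renaming (_∙_ to _⊕_)
  open MonoidSum M public using (sum; sum-cong-≋; sum-cong-≗; ∑-distrib-+)
  open MonoidSum M using (sum-replicate-zero)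

  sum-ε : ∀ {n} (t : Fin n → Carrier) → (∀ i → t i ≈ ε) → sum t ≈ ε
  sum-ε {n} t t≈ε = trans (sum-cong-≋ t≈ε) (sum-replicate-zero n)

  sum-single : ∀ {n} (t : Fin n → Carrier) i → (∀ j → j ≢ i → t j ≈ ε) → sum t ≈ t i
  sum-single t Fin.zero    t≈ε = trans (∙-congˡ (sum-ε _ λ j → t≈ε (Fin.suc j) λ ())) (identityʳ _)
  sum-single t (Fin.suc i) t≈ε = trans (∙-congʳ (t≈ε Fin.zero λ ())) (trans (identityˡ _)
    (sum-single (t ∘ Fin.suc) i λ j j≢i → t≈ε (Fin.suc j) (j≢i ∘ Fin.suc-injective)))

  sum-pair : ∀ {n} (t : Fin n → Carrier) i j → i ≢ j → (∀ k → k ≢ i → k ≢ j → t k ≈ ε) →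
    sum t ≈ t i ⊕ t j
  sum-pair t Fin.zero Fin.zero i≢j _ = ⊥-elim (i≢j ≡.refl)
  sum-pair t Fin.zero (Fin.suc j) _ t≈ε = ∙-congˡ (sum-single (t ∘ Fin.suc) j λ k k≢j →
    t≈ε (Fin.suc k) (λ ()) (k≢j ∘ Fin.suc-injective))
  sum-pair t (Fin.suc i) Fin.zero _ t≈ε = trans (∙-congˡ (sum-single (t ∘ Fin.suc) i λ k k≢i →
    t≈ε (Fin.suc k) (k≢i ∘ Fin.suc-injective) λ ())) (comm _ _)
  sum-pair t (Fin.suc i) (Fin.suc j) i≢j t≈ε = trans (∙-congʳ (t≈ε Fin.zero (λ ()) λ ())) (trans (identityˡ _)
    (sum-pair (t ∘ Fin.suc) i j (i≢j ∘ ≡.cong Fin.suc) λ k k≢i k≢j →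
      t≈ε (Fin.suc k) (k≢i ∘ Fin.suc-injective) (k≢j ∘ Fin.suc-injective)))

-- Exponents of a single variable.

module Variables {n : ℕ} where

  z-same : ∀ p q → exp (z {n} p q) p q ≡ 1
  z-same p q with p Fin.≟ p | q Fin.≟ q
  ... | yes _  | yes _  = ≡.refl
  ... | no p≢p | _      = ⊥-elim (p≢p ≡.refl)
  ... | yes _  | no q≢q = ⊥-elim (q≢q ≡.refl)

  z-flip : ∀ p q → exp (z {n} p q) q p ≡ 1
  z-flip p q = ≡.trans (exp-sym (z p q) q p) (z-same p q)

  z-other : ∀ p q {k l : Fin n} → ¬ (k ≡ p × l ≡ q) → ¬ (l ≡ p × k ≡ q) → exp (z p q) k l ≡ 0
  z-other p q {k} {l} a b with k Fin.≟ p | l Fin.≟ q | l Fin.≟ p | k Fin.≟ q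
  ... | yes c | yes d | _     | _     = ⊥-elim (a (c , d))
  ... | yes _ | no  _ | yes c | yes d = ⊥-elim (b (c , d))
  ... | yes _ | no  _ | yes _ | no  _ = ≡.refl
  ... | yes _ | no  _ | no  _ | _     = ≡.refl
  ... | no  _ | _     | yes c | yes d = ⊥-elim (b (c , d))
  ... | no  _ | _     | yes _ | no  _ = ≡.refl
  ... | no  _ | _     | no  _ | _     = ≡.refl

-- Evaluation of monomials and of formal sums.

module Evaluation {ℓ} (ℝ : CompleteOrderedField ℓ) where

  private
    module ℝ = OrderedField ℝ
    open ℝ using (solve; con; _:+_; _:*_; _:-_; :-_; _:=_; _-_)
    module ∑ = SparseSums ℝ.+-commutativeMonoid

  open Complex ℝ
  open ComplexField ℝ
  open Variables
  module ∏ = SparseSums *-commutativeMonoid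
  open SetoidReasoning setoid

  Matrix : ℕ → Set ℓ
  Matrix n = Fin n → Fin n → ℂ

  product-≉0 : ∀ {n} (t : Fin n → ℂ) → (∀ i → t i ≉ 0#) → product t ≉ 0#
  product-≉0 {ℕ.zero}  t _   = 1≉0
  product-≉0 {ℕ.suc n} t t≉0 = *-≉0 (t≉0 Fin.zero) (product-≉0 (t ∘ Fin.suc) (t≉0 ∘ Fin.suc))

  product-≈0 : ∀ {n} (t : Fin n → ℂ) i → t i ≈ 0# → product t ≈ 0#
  product-≈0 t Fin.zero    e = trans (*-congʳ e) (zeroˡ (product (t ∘ Fin.suc)))
  product-≈0 t (Fin.suc i) e = trans (*-congˡ (product-≈0 (t ∘ Fin.suc) i e)) (zeroʳ (t Fin.zero))

  1^ : ∀ k → 1# ^ k ≈ 1#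
  1^ ℕ.zero    = refl
  1^ (ℕ.suc k) = trans (*-identityˡ (1# ^ k)) (1^ k)

  module _ {n : ℕ} where

    factor : Exponent n → Matrix n → Matrix n
    factor α M i j = if ⌊ i Fin.≤? j ⌋ then M i j ^ exp α i j else 1#

    factor-≤ : ∀ α M {i j} → i Fin.≤ j → factor α M i j ≡ M i j ^ exp α i j
    factor-≤ α M {i} {j} i≤j with i Fin.≤? j
    ... | yes _  = ≡.refl
    ... | no i≰j = ⊥-elim (i≰j i≤j)

    factor-≈1 : ∀ α M i j → (i Fin.≤ j → M i j ^ exp α i j ≈ 1#) → factor α M i j ≈ 1#
    factor-≈1 α M i j e with i Fin.≤? j
    ... | yes p = e p
    ... | no  _ = refl

    evalMonomial-cong : ∀ {α β} {M N : Matrix n} → α ≐ β → (∀ i j → M i j ≈ N i j) →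
      evalMonomial α M ≈ evalMonomial β N
    evalMonomial-cong {α} {β} {M} {N} α≐β M≈N = ∏.sum-cong-≋ λ i → ∏.sum-cong-≋ λ j → pointwise i j
      where
      pointwise : ∀ i j → factor α M i j ≈ factor β N i j
      pointwise i j with i Fin.≤? j
      ... | yes _ = trans (^-congˡ (exp α i j) (M≈N i j)) (reflexive (≡.cong (N i j ^_) (α≐β i j)))
      ... | no  _ = refl

    evalMonomial-* : ∀ α (M N : Matrix n) →
      evalMonomial α (λ i j → M i j * N i j) ≈ evalMonomial α M * evalMonomial α N
    evalMonomial-* α M N = begin
      product (λ i → product (factor α (λ i j → M i j * N i j) i))
        ≈⟨ ∏.sum-cong-≋ (λ i → ∏.sum-cong-≋ (pointwise i)) ⟩
      product (λ i → product (λ j → factor α M i j * factor α N i j))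
        ≈⟨ ∏.sum-cong-≋ (λ i → ∏.∑-distrib-+ (factor α M i) (factor α N i)) ⟩
      product (λ i → product (factor α M i) * product (factor α N i))
        ≈⟨ ∏.∑-distrib-+ (λ i → product (factor α M i)) (λ i → product (factor α N i)) ⟩
      evalMonomial α M * evalMonomial α N ∎
      where
      pointwise : ∀ i j → factor α (λ i j → M i j * N i j) i j ≈ factor α M i j * factor α N i j
      pointwise i j with i Fin.≤? j
      ... | yes _ = ^-distrib-* (M i j) (N i j) (exp α i j)
      ... | no  _ = sym (*-identityˡ 1#)

    evalMonomial-≉0 : ∀ α (M : Matrix n) → (∀ i j → M i j ≉ 0#) → evalMonomial α M ≉ 0#
    evalMonomial-≉0 α M M≉0 = product-≉0 _ λ i → product-≉0 (factor α M i) (pointwise i)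
      where
      pointwise : ∀ i j → factor α M i j ≉ 0#
      pointwise i j with i Fin.≤? j
      ... | yes _ = ^-≉0 (M≉0 i j) (exp α i j)
      ... | no  _ = 1≉0

    evalMonomial-≈0 : ∀ α (M : Matrix n) {i j} → i Fin.≤ j → exp α i j ≢ 0 → M i j ≈ 0# →
      evalMonomial α M ≈ 0#
    evalMonomial-≈0 α M {i} {j} i≤j α≢0 Mij≈0 = product-≈0 _ i (product-≈0 (factor α M i) j
      (trans (reflexive (factor-≤ α M i≤j)) (0^ (exp α i j) α≢0)))
      where
      0^ : ∀ k → k ≢ 0 → M i j ^ k ≈ 0#
      0^ ℕ.zero    k≢0 = ⊥-elim (k≢0 ≡.refl)
      0^ (ℕ.suc k) _   = trans (*-congʳ Mij≈0) (zeroˡ (M i j ^ k))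

    evalMonomial-diagonal : ∀ α (M : Matrix n) → (∀ i j → i ≢ j → M i j ≈ 1#) →
      evalMonomial α M ≈ product λ i → M i i ^ exp α i i
    evalMonomial-diagonal α M M≈1 = ∏.sum-cong-≋ λ i → trans
      (∏.sum-single (factor α M i) i λ j j≢i → factor-≈1 α M i j λ _ →
        trans (^-congˡ (exp α i j) (M≈1 i j (j≢i ∘ ≡.sym))) (1^ (exp α i j)))
      (reflexive (factor-≤ α M Fin.≤-refl))

    evalMonomial-single : ∀ α {p q} → p Fin.≤ q → (M : Matrix n) →
      (∀ i j → i Fin.≤ j → ¬ (i ≡ p × j ≡ q) → M i j ≈ 1#) → evalMonomial α M ≈ M p q ^ exp α p q
    evalMonomial-single α {p} {q} p≤q M M≈1 = begin
      product (λ i → product (factor α M i))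
        ≈⟨ ∏.sum-single _ p (λ i i≢p → ∏.sum-ε (factor α M i) λ j → factor-≈1 α M i j λ i≤j →
             trans (^-congˡ (exp α i j) (M≈1 i j i≤j (i≢p ∘ proj₁))) (1^ (exp α i j))) ⟩
      product (factor α M p)
        ≈⟨ ∏.sum-single (factor α M p) q (λ j j≢q → factor-≈1 α M p j λ p≤j →
             trans (^-congˡ (exp α p j) (M≈1 p j p≤j (j≢q ∘ proj₂))) (1^ (exp α p j))) ⟩
      factor α M p q
        ≡⟨ factor-≤ α M p≤q ⟩
      M p q ^ exp α p q ∎

    -- The matrix has u at (p, q) and (q, p) and 1 elsewhere. Only the position on or above the
    -- diagonal contributes a factor, hence the two cases for the order of p and q.
    evalMonomial-variable : ∀ α p q (u : ℂ) →
      evalMonomial α (λ i j → u ^ exp (z p q) i j) ≈ u ^ exp α p q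
    evalMonomial-variable α p q u with Fin.≤-total p q
    ... | inj₁ p≤q = trans
      (evalMonomial-single α p≤q _ λ i j i≤j ¬pq → reflexive (≡.cong (u ^_) (z-other p q ¬pq
        λ { (≡.refl , ≡.refl) → ¬pq (Fin.≤-antisym i≤j p≤q , Fin.≤-antisym p≤q i≤j) })))
      (^-congˡ (exp α p q) (trans (reflexive (≡.cong (u ^_) (z-same p q))) (*-identityʳ u)))
    ... | inj₂ q≤p = trans
      (evalMonomial-single α q≤p _ λ i j i≤j ¬qp → reflexive (≡.cong (u ^_) (z-other p q
        (λ { (≡.refl , ≡.refl) → ¬qp (Fin.≤-antisym i≤j q≤p , Fin.≤-antisym q≤p i≤j) })
        λ (j≡p , i≡q) → ¬qp (i≡q , j≡p))))
      (trans (^-congˡ (exp α q p) (trans (reflexive (≡.cong (u ^_) (z-flip p q))) (*-identityʳ u)))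
        (reflexive (≡.cong (u ^_) (exp-sym α q p))))

    ⌊≐?⌋-yes : ∀ {α β : Exponent n} {a} {A : Set a} {x y : A} → α ≐ β → (if ⌊ α ≐? β ⌋ then x else y) ≡ x
    ⌊≐?⌋-yes {α} {β} p with α ≐? β
    ... | yes _ = ≡.refl
    ... | no ¬p = ⊥-elim (¬p p)

    ⌊≐?⌋-no : ∀ {α β : Exponent n} {a} {A : Set a} {x y : A} → ¬ (α ≐ β) → (if ⌊ α ≐? β ⌋ then x else y) ≡ y
    ⌊≐?⌋-no {α} {β} ¬p with α ≐? β
    ... | yes p = ⊥-elim (¬p p)
    ... | no _  = ≡.refl

    -- A formal sum may list a monomial several times. Removing all its occurrences at once splits
    -- off `coeff f β` times that monomial, which makes evaluation depend on coefficients only.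
    remove : Exponent n → Polynomial n → Polynomial n
    remove β []            = []
    remove β ((c , α) ∷ f) = if ⌊ α ≐? β ⌋ then remove β f else (c , α) ∷ remove β f

    coeff-remove-≐ : ∀ {β γ} f → β ≐ γ → coeff (remove β f) γ ≈ 0#
    coeff-remove-≐ [] _ = refl
    coeff-remove-≐ {β} {γ} ((c , α) ∷ f) β≐γ with α ≐? β
    ... | yes _  = coeff-remove-≐ f β≐γ
    ... | no α≭β = trans
      (reflexive (⌊≐?⌋-no {α} {γ} λ α≐γ → α≭β λ i j → ≡.trans (α≐γ i j) (≡.sym (β≐γ i j))))
      (coeff-remove-≐ f β≐γ)

    coeff-remove-≭ : ∀ {β γ} f → ¬ (β ≐ γ) → coeff (remove β f) γ ≈ coeff f γ
    coeff-remove-≭ [] _ = refl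
    coeff-remove-≭ {β} {γ} ((c , α) ∷ f) β≭γ with α ≐? β
    ... | yes α≐β = trans (coeff-remove-≭ f β≭γ)
      (reflexive (≡.sym (⌊≐?⌋-no {α} {γ} λ α≐γ → β≭γ λ i j → ≡.trans (≡.sym (α≐β i j)) (α≐γ i j))))
    ... | no _ with α ≐? γ
    ...   | yes _ = +-congˡ (coeff-remove-≭ f β≭γ)
    ...   | no  _ = coeff-remove-≭ f β≭γ

    length-remove : ∀ β f → length (remove β f) ℕ.≤ length f
    length-remove β []            = z≤n
    length-remove β ((c , α) ∷ f) with α ≐? β
    ... | yes _ = ℕ.m≤n⇒m≤1+n (length-remove β f)
    ... | no  _ = s≤s (length-remove β f)

    eval-remove : ∀ β f M → eval f M ≈ coeff f β * evalMonomial β M + eval (remove β f) M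
    eval-remove β [] M = sym (trans (+-congʳ (zeroˡ (evalMonomial β M))) (+-identityˡ 0#))
    eval-remove β ((c , α) ∷ f) M with α ≐? β
    ... | yes α≐β = begin
      c * evalMonomial α M + eval f M
        ≈⟨ +-cong (*-congˡ (evalMonomial-cong {α} {β} {M} {M} α≐β λ i j → refl)) (eval-remove β f M) ⟩
      c * m + (coeff f β * m + r)   ≈⟨ ℂ-solve 4 (λ c d m r → c ⊗ m ⊕ (d ⊗ m ⊕ r) ⊜ (c ⊕ d) ⊗ m ⊕ r) refl c (coeff f β) m r ⟩
      (c + coeff f β) * m + r       ∎
      where
      m r : ℂ
      m = evalMonomial β M
      r = eval (remove β f) M
    ... | no _ = begin
      c * evalMonomial α M + eval f M
        ≈⟨ +-congˡ (eval-remove β f M) ⟩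
      t + (d + r)   ≈⟨ ℂ-solve 3 (λ t d r → t ⊕ (d ⊕ r) ⊜ d ⊕ (t ⊕ r)) refl t d r ⟩
      d + (t + r)   ∎
      where
      t d r : ℂ
      t = c * evalMonomial α M
      d = coeff f β * evalMonomial β M
      r = eval (remove β f) M

    eval-≈0 : ∀ f M → (∀ γ → coeff f γ ≈ 0#) → eval f M ≈ 0#
    eval-≈0 f M = bounded-length (length f) f ℕ.≤-refl
      where
      -- The recursion is on a bound for the length, because `remove β f` is shorter than `f` but
      -- not a structural part of it.
      bounded-length : ∀ k f → length f ℕ.≤ k → (∀ γ → coeff f γ ≈ 0#) → eval f M ≈ 0#
      bounded-length _         []              _       _   = refl
      bounded-length (ℕ.suc k) f@((c , β) ∷ g) (s≤s g≤k) f≈0 = begin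
        eval f M
          ≈⟨ eval-remove β f M ⟩
        coeff f β * evalMonomial β M + eval (remove β f) M
          ≈⟨ +-cong (trans (*-congʳ (f≈0 β)) (zeroˡ (evalMonomial β M)))
                    (bounded-length k (remove β f) shorter rest≈0) ⟩
        0# + 0#
          ≈⟨ +-identityˡ 0# ⟩
        0# ∎
        where
        shorter : length (remove β f) ℕ.≤ k
        shorter = ℕ.≤-trans (ℕ.≤-reflexive (≡.cong length {x = remove β f} {y = remove β g} (⌊≐?⌋-yes {β} {β} λ _ _ → ≡.refl)))
                    (ℕ.≤-trans (length-remove β g) g≤k)
        rest≈0 : ∀ γ → coeff (remove β f) γ ≈ 0#
        rest≈0 γ with β ≐? γ
        ... | yes β≐γ = coeff-remove-≐ f β≐γ
        ... | no β≭γ  = trans (coeff-remove-≭ f β≭γ) (f≈0 γ)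

    eval-binomial : ∀ {α β} f → ¬ (α ≐ β) → (∀ γ → ¬ (γ ≐ α) → ¬ (γ ≐ β) → coeff f γ ≈ 0#) → ∀ M →
      eval f M ≈ coeff f α * evalMonomial α M + coeff f β * evalMonomial β M
    eval-binomial {α} {β} f α≭β f≈0 M = begin
      eval f M
        ≈⟨ eval-remove α f M ⟩
      a + eval (remove α f) M
        ≈⟨ +-congˡ (eval-remove β (remove α f) M) ⟩
      a + (coeff (remove α f) β * evalMonomial β M + eval (remove β (remove α f)) M)
        ≈⟨ +-congˡ (+-cong (*-congʳ (coeff-remove-≭ f α≭β)) (eval-≈0 (remove β (remove α f)) M rest≈0)) ⟩
      a + (coeff f β * evalMonomial β M + 0#)
        ≈⟨ +-congˡ (+-identityʳ _) ⟩
      a + coeff f β * evalMonomial β M ∎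
      where
      a : ℂ
      a = coeff f α * evalMonomial α M
      rest≈0 : ∀ γ → coeff (remove β (remove α f)) γ ≈ 0#
      rest≈0 γ with β ≐? γ | α ≐? γ
      ... | yes β≐γ | _       = coeff-remove-≐ (remove α f) β≐γ
      ... | no β≭γ  | yes α≐γ = trans (coeff-remove-≭ (remove α f) β≭γ) (coeff-remove-≐ f α≐γ)
      ... | no β≭γ  | no α≭γ  = trans (coeff-remove-≭ (remove α f) β≭γ) (trans (coeff-remove-≭ f α≭γ)
        (f≈0 γ (λ p → α≭γ λ i j → ≡.sym (p i j)) (λ p → β≭γ λ i j → ≡.sym (p i j))))

  -- Positive definiteness of the test matrices.

  sum-0≤ : ∀ {n} (t : Fin n → ℝ.Carrier) → (∀ i → ℝ.0# ℝ.≤ t i) → ℝ.0# ℝ.≤ ∑.sum t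
  sum-0≤ {ℕ.zero}  t _   = ℝ.≤-refl
  sum-0≤ {ℕ.suc n} t 0≤t = ℝ.0≤+ (0≤t Fin.zero) (sum-0≤ (t ∘ Fin.suc) (0≤t ∘ Fin.suc))

  sum-0< : ∀ {n} (t : Fin n → ℝ.Carrier) → (∀ i → ℝ.0# ℝ.≤ t i) → ∀ i → ℝ.0# ℝ.< t i → ℝ.0# ℝ.< ∑.sum t
  sum-0< t 0≤t Fin.zero    p = ℝ.0<+ p (sum-0≤ (t ∘ Fin.suc) (0≤t ∘ Fin.suc))
  sum-0< t 0≤t (Fin.suc i) p = ℝ.0<+′ (0≤t Fin.zero) (sum-0< (t ∘ Fin.suc) (0≤t ∘ Fin.suc) i p)

  conjugate-square : ∀ x a → a ℝ.* (x ℝ.* x) ℝ.≈ x ℝ.* a ℝ.* x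
  conjugate-square x a = solve 2 (λ x a → a :* (x :* x) := x :* a :* x) ℝ.refl x a

  zero-entry : ∀ x {a} y → a ℝ.≈ ℝ.0# → x ℝ.* a ℝ.* y ℝ.≈ ℝ.0#
  zero-entry x {a} y a≈0 = ℝ.trans (ℝ.*-congʳ (ℝ.trans (ℝ.*-congˡ a≈0) (ℝ.zeroʳ x))) (ℝ.zeroˡ y)

  diagonal-positive-definite : ∀ {n} (A : Fin n → Fin n → ℝ.Carrier) →
    (∀ i → ℝ.0# ℝ.< A i i) → (∀ i j → i ≢ j → A i j ℝ.≈ ℝ.0#) → PositiveDefinite A
  diagonal-positive-definite A 0<A A≈0 v (i , vi≉0) = ℝ.0<-resp
    (ℝ.sym (∑.sum-cong-≋ λ i → ∑.sum-single _ i λ j j≢i → zero-entry (v i) (v j) (A≈0 i j (j≢i ∘ ≡.sym))))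
    (sum-0< _ (λ i → ℝ.0≤-resp (conjugate-square (v i) (A i i)) (ℝ.*-nonNegative (proj₁ (0<A i)) (ℝ.0≤² (v i))))
      i (ℝ.0<-resp (conjugate-square (v i) (A i i)) (ℝ.0<* (0<A i) (ℝ.0<² vi≉0))))

  -- Completing the square: with b = A k l, the quadratic form is
  -- (r − b²) vₖ² + (vₗ + b vₖ)² + Σ vᵢ² over i ≠ k, l.
  two-by-two-positive-definite : ∀ {n} (A : Fin n → Fin n → ℝ.Carrier) {k l} → k ≢ l →
    (∀ i → i ≢ k → A i i ℝ.≈ ℝ.1#) → A k l ℝ.≈ A l k →
    (∀ i j → i ≢ j → ¬ (i ≡ k × j ≡ l) → ¬ (i ≡ l × j ≡ k) → A i j ℝ.≈ ℝ.0#) →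
    ℝ.0# ℝ.< A k k - A k l ℝ.* A k l → PositiveDefinite A
  two-by-two-positive-definite {n} A {k} {l} k≢l A≈1 Akl≈Alk A≈0 0<det v v≉0 =
    ℝ.0<-resp sum≈ (positive v≉0)
    where
    module R = SetoidReasoning ℝ.setoid
    b d : ℝ.Carrier
    b = A k l
    -- Moving this amount from row k to row l turns the row sums into the summands of the completed
    -- square and leaves the total unchanged.
    d = b ℝ.* v k ℝ.* v l ℝ.+ b ℝ.* b ℝ.* (v k ℝ.* v k)
    row correction : Fin n → ℝ.Carrier
    row i = ∑.sum λ j → v i ℝ.* A i j ℝ.* v j
    correction i with i Fin.≟ k | i Fin.≟ l
    ... | yes _ | _     = ℝ.- d
    ... | no  _ | yes _ = d
    ... | no  _ | no  _ = ℝ.0#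
    row-k : row k ℝ.≈ v k ℝ.* A k k ℝ.* v k ℝ.+ v k ℝ.* b ℝ.* v l
    row-k = ∑.sum-pair _ k l k≢l λ j j≢k j≢l → zero-entry (v k) (v j)
      (A≈0 k j (j≢k ∘ ≡.sym) (j≢l ∘ proj₂) (k≢l ∘ proj₁))
    row-l : row l ℝ.≈ v l ℝ.* b ℝ.* v k ℝ.+ v l ℝ.* ℝ.1# ℝ.* v l
    row-l = ℝ.trans
      (∑.sum-pair _ k l k≢l λ j j≢k j≢l → zero-entry (v l) (v j)
        (A≈0 l j (j≢l ∘ ≡.sym) (k≢l ∘ ≡.sym ∘ proj₁) (j≢k ∘ proj₂)))
      (ℝ.+-cong (ℝ.*-congʳ (ℝ.*-congˡ (ℝ.sym Akl≈Alk))) (ℝ.*-congʳ (ℝ.*-congˡ (A≈1 l (k≢l ∘ ≡.sym)))))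
    row-other : ∀ {i} → i ≢ k → i ≢ l → row i ℝ.≈ v i ℝ.* ℝ.1# ℝ.* v i
    row-other {i} i≢k i≢l = ℝ.trans
      (∑.sum-single _ i λ j j≢i → zero-entry (v i) (v j) (A≈0 i j (j≢i ∘ ≡.sym) (i≢k ∘ proj₁) (i≢l ∘ proj₁)))
      (ℝ.*-congʳ (ℝ.*-congˡ (A≈1 i i≢k)))
    correction-k : correction k ℝ.≈ ℝ.- d
    correction-k with k Fin.≟ k
    ... | yes _  = ℝ.refl
    ... | no k≢k = ⊥-elim (k≢k ≡.refl)
    correction-l : correction l ℝ.≈ d
    correction-l with l Fin.≟ k | l Fin.≟ l
    ... | yes l≡k | _      = ⊥-elim (k≢l (≡.sym l≡k))
    ... | no _    | yes _  = ℝ.refl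
    ... | no _    | no l≢l = ⊥-elim (l≢l ≡.refl)
    correction-other : ∀ i → i ≢ k → i ≢ l → correction i ℝ.≈ ℝ.0#
    correction-other i i≢k i≢l with i Fin.≟ k | i Fin.≟ l
    ... | yes i≡k | _       = ⊥-elim (i≢k i≡k)
    ... | no _    | yes i≡l = ⊥-elim (i≢l i≡l)
    ... | no _    | no _    = ℝ.refl
    sum≈ : ∑.sum (λ i → row i ℝ.+ correction i) ℝ.≈ ∑.sum row
    sum≈ = R.begin
      ∑.sum (λ i → row i ℝ.+ correction i)          R.≈⟨ ∑.∑-distrib-+ row correction ⟩
      ∑.sum row ℝ.+ ∑.sum correction                R.≈⟨ ℝ.+-congˡ (∑.sum-pair correction k l k≢l correction-other) ⟩
      ∑.sum row ℝ.+ (correction k ℝ.+ correction l) R.≈⟨ ℝ.+-congˡ (ℝ.+-cong correction-k correction-l) ⟩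
      ∑.sum row ℝ.+ (ℝ.- d ℝ.+ d)                   R.≈⟨ solve 2 (λ x d → x :+ (:- d :+ d) := x) ℝ.refl (∑.sum row) d ⟩
      ∑.sum row                                     R.∎
    term-k : (A k k - b ℝ.* b) ℝ.* (v k ℝ.* v k) ℝ.≈ row k ℝ.+ correction k
    term-k = ℝ.trans
      (solve 4 (λ a b x y → (a :- b :* b) :* (x :* x)
        := x :* a :* x :+ x :* b :* y :+ :- (b :* x :* y :+ b :* b :* (x :* x))) ℝ.refl (A k k) b (v k) (v l))
      (ℝ.sym (ℝ.+-cong row-k correction-k))
    term-l : (v l ℝ.+ b ℝ.* v k) ℝ.* (v l ℝ.+ b ℝ.* v k) ℝ.≈ row l ℝ.+ correction l
    term-l = ℝ.trans
      (solve 3 (λ b x y → (y :+ b :* x) :* (y :+ b :* x)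
        := y :* b :* x :+ y :* con (+ 1) :* y :+ (b :* x :* y :+ b :* b :* (x :* x))) ℝ.refl b (v k) (v l))
      (ℝ.sym (ℝ.+-cong row-l correction-l))
    term-other : ∀ {i} → i ≢ k → i ≢ l → v i ℝ.* v i ℝ.≈ row i ℝ.+ correction i
    term-other {i} i≢k i≢l = ℝ.trans
      (solve 1 (λ x → x :* x := x :* con (+ 1) :* x :+ con (+ 0)) ℝ.refl (v i))
      (ℝ.sym (ℝ.+-cong (row-other i≢k i≢l) (correction-other i i≢k i≢l)))
    nonnegative : ∀ i → ℝ.0# ℝ.≤ row i ℝ.+ correction i
    nonnegative i = by-cases (i Fin.≟ k) (i Fin.≟ l)
      where
      by-cases : Dec (i ≡ k) → Dec (i ≡ l) → ℝ.0# ℝ.≤ row i ℝ.+ correction i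
      by-cases (yes ≡.refl) _ = ℝ.0≤-resp term-k (ℝ.*-nonNegative (proj₁ 0<det) (ℝ.0≤² (v k)))
      by-cases (no _) (yes ≡.refl) = ℝ.0≤-resp term-l (ℝ.0≤² _)
      by-cases (no i≢k) (no i≢l) = ℝ.0≤-resp (term-other i≢k i≢l) (ℝ.0≤² (v i))
    positive : ∃[ i ] v i ℝ.≉ ℝ.0# → ℝ.0# ℝ.< ∑.sum (λ i → row i ℝ.+ correction i)
    -- The entry `v k` is examined first: the square in row l can vanish although `v l` does not,
    -- but only when `v k` is non-zero, and then row k is positive.
    positive (i , vi≉0) = by-cases (v k ℝ.≈? ℝ.0#) (i Fin.≟ l)
      where
      by-cases : Dec (v k ℝ.≈ ℝ.0#) → Dec (i ≡ l) → ℝ.0# ℝ.< ∑.sum (λ i → row i ℝ.+ correction i)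
      by-cases (no vk≉0) _ = sum-0< _ nonnegative k (ℝ.0<-resp term-k (ℝ.0<* 0<det (ℝ.0<² vk≉0)))
      by-cases (yes vk≈0) (yes ≡.refl) = sum-0< _ nonnegative l (ℝ.0<-resp
        (ℝ.trans (ℝ.sym (ℝ.*-cong eq eq)) term-l) (ℝ.0<² vi≉0))
        where
        eq : v l ℝ.+ b ℝ.* v k ℝ.≈ v l
        eq = ℝ.trans (ℝ.+-congˡ (ℝ.trans (ℝ.*-congˡ vk≈0) (ℝ.zeroʳ b))) (ℝ.+-identityʳ (v l))
      by-cases (yes vk≈0) (no i≢l) = sum-0< _ nonnegative i (ℝ.0<-resp
        (term-other (λ { ≡.refl → vi≉0 vk≈0 }) i≢l) (ℝ.0<² vi≉0))

-- Consequences of non-vanishing for the diagonal exponents.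

module Stability {ℓ} (ℝ : CompleteOrderedField ℓ) where

  private
    module ℝ = OrderedField ℝ
    open ℝ using (solve; con; _:+_; _:*_; _:-_; :-_; _:=_; _-_)

  open Complex ℝ
  open ComplexField ℝ
  open ComplexRoots ℝ
  open Evaluation ℝ
  open Variables
  open SetoidReasoning setoid
  private module Σℕ = SparseSums ℕ.+-0-commutativeMonoid

  𝕚 : ℂ
  𝕚 = ℝ.0# +i ℝ.1#

  𝕚≉0 : 𝕚 ≉ 0#
  𝕚≉0 = 0<im⇒≉0 ℝ.0<1

  NonVanishing : ∀ {n} → ℂ → Exponent n → ℂ → Exponent n → Set ℓ
  NonVanishing c₁ α c₂ β = ∀ M → Symmetric M → PositiveDefinite (λ i j → im (M i j)) →
    c₁ * evalMonomial α M + c₂ * evalMonomial β M ≉ 0#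

  module _ {n : ℕ} where

    -- The constant off the diagonal is 0 to annihilate the off-diagonal variables and 1 to make
    -- them invisible. Both are real, so the imaginary part is a diagonal matrix.
    diagonalMatrix : (Fin n → ℂ) → ℂ → Matrix n
    diagonalMatrix x c i j = if ⌊ i Fin.≟ j ⌋ then x i else c

    diagonalMatrix-≡ : ∀ x c i → diagonalMatrix x c i i ≡ x i
    diagonalMatrix-≡ x c i with i Fin.≟ i
    ... | yes _  = ≡.refl
    ... | no i≢i = ⊥-elim (i≢i ≡.refl)

    diagonalMatrix-≢ : ∀ x c {i j} → i ≢ j → diagonalMatrix x c i j ≡ c
    diagonalMatrix-≢ x c {i} {j} i≢j with i Fin.≟ j
    ... | yes i≡j = ⊥-elim (i≢j i≡j)
    ... | no _    = ≡.refl

    diagonalMatrix-symmetric : ∀ x c → Symmetric (diagonalMatrix x c)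
    diagonalMatrix-symmetric x c i j with i Fin.≟ j
    ... | yes ≡.refl = reflexive (≡.sym (diagonalMatrix-≡ x c i))
    ... | no i≢j     = reflexive (≡.sym (diagonalMatrix-≢ x c (i≢j ∘ ≡.sym)))

    diagonalMatrix-positive-definite : ∀ x c → (∀ i → ℝ.0# ℝ.< im (x i)) → Real c →
      PositiveDefinite (λ i j → im (diagonalMatrix x c i j))
    diagonalMatrix-positive-definite x c 0<x c-real = diagonal-positive-definite _
      (λ i → ℝ.0<-resp (ℝ.sym (proj₂ (reflexive (diagonalMatrix-≡ x c i)))) (0<x i))
      (λ i j i≢j → ℝ.trans (proj₂ (reflexive (diagonalMatrix-≢ x c i≢j))) c-real)

    one-diagonal : ∀ {c₁ c₂} {α β : Exponent n} → NonVanishing c₁ α c₂ β →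
      ∀ {i j k l} → i ≢ j → exp α i j ≢ 0 → k ≢ l → exp β k l ≢ 0 → ⊥
    one-diagonal {c₁} {c₂} {α} {β} nonvanishing i≢j α≢0 k≢l β≢0 =
      nonvanishing D (diagonalMatrix-symmetric _ _)
        (diagonalMatrix-positive-definite _ _ (λ _ → ℝ.0<1) ℝ.refl)
        (trans (+-cong (vanish c₁ α i≢j α≢0) (vanish c₂ β k≢l β≢0)) (+-identityˡ 0#))
      where
      D : Matrix n
      D = diagonalMatrix (λ _ → 𝕚) 0#
      vanish : ∀ c γ {i j} → i ≢ j → exp γ i j ≢ 0 → c * evalMonomial γ D ≈ 0#
      vanish c γ {i} {j} i≢j γ≢0 with Fin.≤-total i j
      ... | inj₁ i≤j = trans (*-congˡ (evalMonomial-≈0 γ D i≤j γ≢0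
                         (reflexive (diagonalMatrix-≢ _ _ i≢j)))) (zeroʳ c)
      ... | inj₂ j≤i = trans (*-congˡ (evalMonomial-≈0 γ D j≤i (γ≢0 ∘ ≡.trans (exp-sym γ i j))
                         (reflexive (diagonalMatrix-≢ _ _ (i≢j ∘ ≡.sym))))) (zeroʳ c)

    -- By truncation, `surplus α β i` and `surplus β α i` are the positive and negative parts of
    -- α_ii - β_ii, and their sum is the absolute value. Summed over i they are the traces of the
    -- two reduced monomials.
    surplus : Exponent n → Exponent n → Fin n → ℕ
    surplus α β i = exp α i i ∸ exp β i i

    product-^ : ∀ (y : ℂ) {m} (f : Fin m → ℕ) → product (λ i → y ^ f i) ≈ y ^ Σℕ.sum f
    product-^ y {ℕ.zero}  f = refl
    product-^ y {ℕ.suc m} f = trans (*-congˡ (product-^ y (f ∘ Fin.suc)))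
      (sym (^-homo-* y (f Fin.zero) (Σℕ.sum (f ∘ Fin.suc))))

    -- The relation x^b / x^a = ± y^|a - b| with denominators cleared. For `a ≤ b` the witness is y;
    -- otherwise it is -1/y, where x y = -1 yields one sign for each of the a - b excess factors.
    power-law : ∀ {y} → y ≉ 0# → ∀ a b → Dec (a ℕ.≤ b) → ∃[ x ] (ℝ.0# ℝ.< im y → ℝ.0# ℝ.< im x) ×
      (- 1#) ^ (a ∸ b) * x ^ b ≈ x ^ a * y ^ ((a ∸ b) ℕ.+ (b ∸ a))
    power-law {y} y≉0 a b (yes a≤b) = y , (λ p → p) , (begin
      (- 1#) ^ (a ∸ b) * y ^ b                ≡⟨ ≡.cong (λ e → (- 1#) ^ e * y ^ b) (ℕ.m≤n⇒m∸n≡0 a≤b) ⟩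
      1# * y ^ b                              ≈⟨ *-identityˡ (y ^ b) ⟩
      y ^ b                                   ≡⟨ ≡.cong (y ^_) (≡.sym (ℕ.m+[n∸m]≡n a≤b)) ⟩
      y ^ (a ℕ.+ (b ∸ a))                     ≈⟨ ^-homo-* y a (b ∸ a) ⟩
      y ^ a * y ^ (b ∸ a)                     ≡⟨ ≡.cong (λ e → y ^ a * y ^ (e ℕ.+ (b ∸ a))) (≡.sym (ℕ.m≤n⇒m∸n≡0 a≤b)) ⟩
      y ^ a * y ^ ((a ∸ b) ℕ.+ (b ∸ a))       ∎)
    power-law {y} y≉0 a b (no a≰b) = x , upper , (begin
      (- 1#) ^ d * x ^ b                      ≈⟨ *-congʳ (^-congˡ d x*y) ⟨
      (x * y) ^ d * x ^ b                     ≈⟨ *-congʳ (^-distrib-* x y d) ⟩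
      x ^ d * y ^ d * x ^ b                   ≈⟨ ℂ-solve 3 (λ p q r → p ⊗ q ⊗ r ⊜ r ⊗ p ⊗ q) refl (x ^ d) (y ^ d) (x ^ b) ⟩
      x ^ b * x ^ d * y ^ d                   ≈⟨ *-congʳ (^-homo-* x b d) ⟨
      x ^ (b ℕ.+ d) * y ^ d                   ≡⟨ ≡.cong₂ (λ e e′ → x ^ e * y ^ e′) (ℕ.m+[n∸m]≡n b≤a)
                                                   (≡.sym (≡.trans (≡.cong (d ℕ.+_) (ℕ.m≤n⇒m∸n≡0 b≤a)) (ℕ.+-identityʳ d))) ⟩
      x ^ a * y ^ (d ℕ.+ (b ∸ a))             ∎)
      where
      d : ℕ
      d = a ∸ b
      b≤a : b ℕ.≤ a
      b≤a = ℕ.<⇒≤ (ℕ.≰⇒> a≰b)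
      x : ℂ
      x = - (y ⁻¹)
      x*y : x * y ≈ - 1#
      x*y = trans (ℂ-solve 2 (λ y i → ⊝ i ⊗ y ⊜ ⊝ (y ⊗ i)) refl y (y ⁻¹)) (-‿cong (*-inverseʳ y≉0))
      upper : ℝ.0# ℝ.< im y → ℝ.0# ℝ.< im x
      upper p = ℝ.0<-resp (solve 2 (λ b i → b :* i := :- (:- b :* i)) ℝ.refl (im y) (norm y ℝ.⁻¹))
        (ℝ.0<* p (ℝ.0<⁻¹ (0<norm y≉0)))

    module _ {c₁ c₂} {α β : Exponent n} (c₁≉0 : c₁ ≉ 0#) (c₂≉0 : c₂ ≉ 0#)
      (nonvanishing : NonVanishing c₁ α c₂ β) where

      private
        distance : ℕ
        distance = Σℕ.sum (λ i → surplus α β i ℕ.+ surplus β α i)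

        σ : ℂ
        σ = (- 1#) ^ Σℕ.sum (surplus α β)

        σ≉0 : σ ≉ 0#
        σ≉0 = ^-≉0 (-≉0 1≉0) (Σℕ.sum (surplus α β))

        -- With a and b the values of the two monomials, σ b = a y^N, so c₁ a + c₂ b = 0 is
        -- equivalent to y^N being this number.
        w : ℂ
        w = - (σ * (c₁ / c₂))

        w≉0 : w ≉ 0#
        w≉0 = -≉0 (*-≉0 σ≉0 (*-≉0 c₁≉0 (⁻¹≉0 c₂≉0)))

        -- Off-diagonal entries 1 and diagonal entries y or −1/y turn
        -- Z^β / Z^α into ± y^distance.
        no-root : ∀ y → ℝ.0# ℝ.< im y → ¬ (y ^ distance ≈ w)
        no-root y 0<y y^N≈w = *-≉0 σ≉0
          (nonvanishing D (diagonalMatrix-symmetric x 1#) (diagonalMatrix-positive-definite x 1# 0<x ℝ.refl))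
          (begin
            σ * (c₁ * a + c₂ * b)          ≈⟨ ℂ-solve 5 (λ s p a q b → s ⊗ (p ⊗ a ⊕ q ⊗ b) ⊜ s ⊗ p ⊗ a ⊕ q ⊗ (s ⊗ b)) refl σ c₁ a c₂ b ⟩
            σ * c₁ * a + c₂ * (σ * b)      ≈⟨ +-congˡ (*-congˡ (trans relation (*-congˡ y^N≈w))) ⟩
            σ * c₁ * a + c₂ * (a * w)      ≈⟨ ℂ-solve 5 (λ s p a q i → s ⊗ p ⊗ a ⊕ q ⊗ (a ⊗ ⊝ (s ⊗ (p ⊗ i)))
                                                ⊜ s ⊗ p ⊗ a ⊕ ⊝ (s ⊗ p ⊗ a ⊗ (q ⊗ i))) refl σ c₁ a c₂ (c₂ ⁻¹) ⟩
            t + - (t * (c₂ * c₂ ⁻¹))       ≈⟨ +-congˡ (-‿cong (trans (*-congˡ (*-inverseʳ c₂≉0)) (*-identityʳ t))) ⟩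
            t + - t                        ≈⟨ -‿inverseʳ t ⟩
            0#                             ∎)
          where
          y≉0 : y ≉ 0#
          y≉0 = 0<im⇒≉0 0<y
          law = λ i → power-law y≉0 (exp α i i) (exp β i i) (exp α i i ℕ.≤? exp β i i)
          x : Fin n → ℂ
          x i = proj₁ (law i)
          0<x : ∀ i → ℝ.0# ℝ.< im (x i)
          0<x i = proj₁ (proj₂ (law i)) 0<y
          D : Matrix n
          D = diagonalMatrix x 1#
          a b t : ℂ
          a = evalMonomial α D
          b = evalMonomial β D
          t = σ * c₁ * a
          at-D : ∀ γ → evalMonomial γ D ≈ product (λ i → x i ^ exp γ i i)
          at-D γ = trans
            (evalMonomial-diagonal γ D λ i j i≢j → reflexive (diagonalMatrix-≢ x 1# i≢j))
            (∏.sum-cong-≋ λ i → reflexive (≡.cong (_^ exp γ i i) (diagonalMatrix-≡ x 1# i)))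
          relation : σ * b ≈ a * y ^ distance
          relation = begin
            σ * b
              ≈⟨ *-cong (sym (product-^ (- 1#) (surplus α β))) (at-D β) ⟩
            product (λ i → (- 1#) ^ surplus α β i) * product (λ i → x i ^ exp β i i)
              ≈⟨ ∏.∑-distrib-+ (λ i → (- 1#) ^ surplus α β i) (λ i → x i ^ exp β i i) ⟨
            product (λ i → (- 1#) ^ surplus α β i * x i ^ exp β i i)
              ≈⟨ ∏.sum-cong-≋ (λ i → proj₂ (proj₂ (law i))) ⟩
            product (λ i → x i ^ exp α i i * y ^ (surplus α β i ℕ.+ surplus β α i))
              ≈⟨ ∏.∑-distrib-+ (λ i → x i ^ exp α i i) (λ i → y ^ (surplus α β i ℕ.+ surplus β α i)) ⟩
            product (λ i → x i ^ exp α i i) * product (λ i → y ^ (surplus α β i ℕ.+ surplus β α i))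
              ≈⟨ *-cong (sym (at-D α)) (product-^ y (λ i → surplus α β i ℕ.+ surplus β α i)) ⟩
            a * y ^ distance ∎

      -- A total of 2 or more would allow a root of `w` in the half plane, hence a zero of the
      -- binomial, except when the total is exactly 2 and `w` is a positive real. The sign in the
      -- conclusion still contains the parity of the surplus of α, which is resolved in the
      -- classification.
      diagonal-distance : Σℕ.sum (surplus α β) ℕ.+ Σℕ.sum (surplus β α) ℕ.≤ 2 ×
        (Σℕ.sum (surplus α β) ℕ.+ Σℕ.sum (surplus β α) ≡ 2 →
          PositiveReal (- ((- 1#) ^ Σℕ.sum (surplus α β) * (c₁ / c₂))))
      diagonal-distance = classify _ (Σℕ.∑-distrib-+ (surplus α β) (surplus β α))
        where
        classify : ∀ N → distance ≡ N → N ℕ.≤ 2 × (N ≡ 2 → PositiveReal w)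
        classify 0 _ = z≤n , λ ()
        classify 1 _ = s≤s z≤n , λ ()
        classify (ℕ.suc (ℕ.suc m)) e = from-root (root-in-upper-half-plane m w w≉0)
          where
          from-root : (∃[ y ] ℝ.0# ℝ.< im y × y ^ (2 ℕ.+ m) ≈ w) ⊎ (m ≡ 0 × PositiveReal w) →
            2 ℕ.+ m ℕ.≤ 2 × (2 ℕ.+ m ≡ 2 → PositiveReal w)
          from-root (inj₁ (y , 0<y , y^≈w)) = ⊥-elim (no-root y 0<y (trans (reflexive (≡.cong (y ^_) e)) y^≈w))
          from-root (inj₂ (≡.refl , w-pos)) = s≤s (s≤s z≤n) , λ _ → w-pos

      -- Balance between an off-diagonal variable and the diagonal variables of its indices.

      module _ {k l} (k≢l : k ≢ l) {e} (αkl : exp α k l ≡ ℕ.suc e) (βkl : exp β k l ≡ 0) where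

        private
          base : Matrix n
          base = diagonalMatrix (λ _ → 𝕚) 1#

          -- The base matrix with its (k, k) entry multiplied by r and its (k, l) and (l, k) entries
          -- by u. Writing these factors as powers indexed by the exponents of single variables lets
          -- multiplicativity of monomials separate r and u from the base value.
          perturbed : ℝ.Carrier → ℂ → Matrix n
          perturbed r u i j = base i j * (ofℝ r ^ exp (z k k) i j * u ^ exp (z k l) i j)

          entry : ∀ r u {i j p q} → exp (z k k) i j ≡ p → exp (z k l) i j ≡ q →
            perturbed r u i j ≈ base i j * (ofℝ r ^ p * u ^ q)
          entry r u {i} {j} p q = *-congˡ {base i j} (reflexive (≡.cong₂ (λ p q → ofℝ r ^ p * u ^ q) p q))

          perturbed-kk : ∀ r u → im (perturbed r u k k) ℝ.≈ r
          perturbed-kk r u = ℝ.trans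
            (proj₂ (trans (entry r u {k} {k} (z-same k k) (z-other k l (k≢l ∘ proj₂) (k≢l ∘ proj₂)))
              (*-congʳ (reflexive (diagonalMatrix-≡ _ _ k)))))
            (proj₂ {A = _ ℝ.≈ ℝ.0#} (trans
              (ℂ-solve 2 (λ x r → x ⊗ (r ⊗ 1′ ⊗ 1′) ⊜ r ⊗ x) refl 𝕚 (ofℝ r))
              (trans (ofℝ-*ˡ r 𝕚) (ℝ.zeroʳ r , ℝ.*-identityʳ r))))
            where
            1′ = ℂ-con (+ 1)

          perturbed-ii : ∀ r u {i} → i ≢ k → im (perturbed r u i i) ℝ.≈ ℝ.1#
          perturbed-ii r u {i} i≢k = proj₂ {A = _ ℝ.≈ ℝ.0#}
            (trans (entry r u {i} {i} (z-other k k (i≢k ∘ proj₁) (i≢k ∘ proj₁))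
                (z-other k l (i≢k ∘ proj₁) (i≢k ∘ proj₁)))
              (trans (*-congʳ (reflexive (diagonalMatrix-≡ _ _ i)))
                (ℂ-solve 1 (λ x → x ⊗ (ℂ-con (+ 1) ⊗ ℂ-con (+ 1)) ⊜ x) refl 𝕚)))

          off-diagonal : ∀ r u {i j q} → i ≢ j → exp (z k l) i j ≡ q → perturbed r u i j ≈ u ^ q
          off-diagonal r u {i} {j} {q} i≢j e = trans
            (entry r u {i} {j} (z-other k k (λ (p , q) → i≢j (≡.trans p (≡.sym q))) (λ (p , q) → i≢j (≡.trans q (≡.sym p)))) e)
            (trans (*-congʳ (reflexive (diagonalMatrix-≢ _ _ i≢j)))
              (ℂ-solve 1 (λ x → ℂ-con (+ 1) ⊗ (ℂ-con (+ 1) ⊗ x) ⊜ x) refl (u ^ q)))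

          perturbed-kl : ∀ r u → perturbed r u k l ≈ u
          perturbed-kl r u = trans (off-diagonal r u {k} {l} k≢l (z-same k l)) (*-identityʳ u)

          perturbed-lk : ∀ r u → perturbed r u l k ≈ u
          perturbed-lk r u = trans (off-diagonal r u {l} {k} (k≢l ∘ ≡.sym) (z-flip k l)) (*-identityʳ u)

          perturbed-symmetric : ∀ r u → Symmetric (perturbed r u)
          perturbed-symmetric r u i j = *-cong (diagonalMatrix-symmetric _ _ i j)
            (reflexive (≡.cong₂ (λ p q → ofℝ r ^ p * u ^ q) (exp-sym (z k k) i j) (exp-sym (z k l) i j)))

          perturbed-positive-definite : ∀ r u → ℝ.0# ℝ.< r - im u ℝ.* im u →
            PositiveDefinite (λ i j → im (perturbed r u i j))
          perturbed-positive-definite r u 0<det = two-by-two-positive-definite _ k≢l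
            (λ i i≢k → perturbed-ii r u i≢k)
            (proj₂ (trans (perturbed-kl r u) (sym (perturbed-lk r u))))
            (λ i j i≢j ¬kl ¬lk → proj₂ (off-diagonal r u {i} {j} i≢j (z-other k l ¬kl (λ (p , q) → ¬lk (q , p)))))
            (ℝ.0<-resp (ℝ.sym (ℝ.+-cong (perturbed-kk r u) (ℝ.-‿cong (ℝ.*-cong
              (proj₂ (perturbed-kl r u)) (proj₂ (perturbed-kl r u)))))) 0<det)

          evalMonomial-perturbed : ∀ γ r u → evalMonomial γ (perturbed r u) ≈
            evalMonomial γ base * (ofℝ r ^ exp γ k k * u ^ exp γ k l)
          evalMonomial-perturbed γ r u = begin
            evalMonomial γ (perturbed r u)
              ≈⟨ evalMonomial-* γ base (λ i j → ofℝ r ^ exp (z k k) i j * u ^ exp (z k l) i j) ⟩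
            evalMonomial γ base * evalMonomial γ (λ i j → ofℝ r ^ exp (z k k) i j * u ^ exp (z k l) i j)
              ≈⟨ *-congˡ (evalMonomial-* γ (λ i j → ofℝ r ^ exp (z k k) i j) (λ i j → u ^ exp (z k l) i j)) ⟩
            evalMonomial γ base * (evalMonomial γ (λ i j → ofℝ r ^ exp (z k k) i j) * evalMonomial γ (λ i j → u ^ exp (z k l) i j))
              ≈⟨ *-congˡ (*-cong (evalMonomial-variable γ k k (ofℝ r)) (evalMonomial-variable γ k l u)) ⟩
            evalMonomial γ base * (ofℝ r ^ exp γ k k * u ^ exp γ k l) ∎

          base≉0 : ∀ i j → base i j ≉ 0#
          base≉0 i j with i Fin.≟ j
          ... | yes _ = 𝕚≉0
          ... | no _  = 1≉0

          -- The base values are absorbed into the coefficients; no entry of `base` is zero, so `C₁`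
          -- can be divided by. Vanishing at `perturbed r u` then reads u^(e+1) r^a = κ r^b.
          C₁ C₂ κ : ℂ
          C₁ = c₁ * evalMonomial α base
          C₂ = c₂ * evalMonomial β base
          κ  = - (C₂ * C₁ ⁻¹)

          C₁≉0 : C₁ ≉ 0#
          C₁≉0 = *-≉0 c₁≉0 (evalMonomial-≉0 α base base≉0)

          κ≉0 : κ ≉ 0#
          κ≉0 = -≉0 (*-≉0 (*-≉0 c₂≉0 (evalMonomial-≉0 β base base≉0)) (⁻¹≉0 C₁≉0))

          a b : ℕ
          a = exp α k k
          b = exp β k k

          -- The imaginary part of the matrix is the identity except for r at (k, k) and Im u at (k,
          -- l) and (l, k), so r > (Im u)² would make it positive definite at a zero.
          root-is-large : ∀ r u → u ^ ℕ.suc e * ofℝ r ^ a ≈ κ * ofℝ r ^ b → ¬ (ℝ.0# ℝ.< r - im u ℝ.* im u)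
          root-is-large r u u^e 0<det = nonvanishing (perturbed r u) (perturbed-symmetric r u)
            (perturbed-positive-definite r u 0<det) (begin
              c₁ * evalMonomial α (perturbed r u) + c₂ * evalMonomial β (perturbed r u)
                ≈⟨ +-cong (*-congˡ (evalMonomial-perturbed α r u)) (*-congˡ (evalMonomial-perturbed β r u)) ⟩
              c₁ * (α₀ * (ofℝ r ^ a * u ^ exp α k l)) + c₂ * (β₀ * (ofℝ r ^ b * u ^ exp β k l))
                ≡⟨ ≡.cong₂ (λ p q → c₁ * (α₀ * (ofℝ r ^ a * u ^ p)) + c₂ * (β₀ * (ofℝ r ^ b * u ^ q))) αkl βkl ⟩
              c₁ * (α₀ * (ofℝ r ^ a * u ^ ℕ.suc e)) + c₂ * (β₀ * (ofℝ r ^ b * 1#))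
                ≈⟨ ℂ-solve 7 (λ c₁ α₀ x v c₂ β₀ y → c₁ ⊗ (α₀ ⊗ (x ⊗ v)) ⊕ c₂ ⊗ (β₀ ⊗ (y ⊗ ℂ-con (+ 1)))
                     ⊜ c₁ ⊗ α₀ ⊗ (v ⊗ x) ⊕ c₂ ⊗ β₀ ⊗ y) refl c₁ α₀ (ofℝ r ^ a) (u ^ ℕ.suc e) c₂ β₀ (ofℝ r ^ b) ⟩
              C₁ * (u ^ ℕ.suc e * ofℝ r ^ a) + C₂ * ofℝ r ^ b
                ≈⟨ +-congʳ (*-congˡ u^e) ⟩
              C₁ * (κ * ofℝ r ^ b) + C₂ * ofℝ r ^ b
                ≈⟨ ℂ-solve 4 (λ p q i y → p ⊗ (⊝ (q ⊗ i) ⊗ y) ⊕ q ⊗ y ⊜ q ⊗ y ⊕ ⊝ (q ⊗ y ⊗ (p ⊗ i)))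
                     refl C₁ C₂ (C₁ ⁻¹) (ofℝ r ^ b) ⟩
              C₂ * ofℝ r ^ b + - (C₂ * ofℝ r ^ b * (C₁ * C₁ ⁻¹))
                ≈⟨ +-congˡ (-‿cong (trans (*-congˡ (*-inverseʳ C₁≉0)) (*-identityʳ _))) ⟩
              C₂ * ofℝ r ^ b + - (C₂ * ofℝ r ^ b)
                ≈⟨ -‿inverseʳ (C₂ * ofℝ r ^ b) ⟩
              0# ∎)
            where
            α₀ β₀ : ℂ
            α₀ = evalMonomial α base
            β₀ = evalMonomial β base

          -- From r ≤ (Im u)² ≤ |u|² one gets r^(e+1) ≤ |u|^(2(e+1)). Squared moduli in the equation
          -- for u then eliminate u and leave an inequality in r alone, whichever root was chosen.
          norm-bound : ∀ r u → ℝ.0# ℝ.< r → u ^ ℕ.suc e * ofℝ r ^ a ≈ κ * ofℝ r ^ b →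
            ℝ.0# ℝ.≤ norm κ ℝ.* r ℝ.^ (b ℕ.+ b) - r ℝ.^ (ℕ.suc e ℕ.+ (a ℕ.+ a))
          norm-bound r u 0<r eq = ℝ.0≤-resp
            (R.begin
              (norm u ℝ.^ ℕ.suc e - r ℝ.^ ℕ.suc e) ℝ.* r ℝ.^ (a ℕ.+ a)
                R.≈⟨ solve 3 (λ x y w → (x :- y) :* w := x :* w :- y :* w) ℝ.refl (norm u ℝ.^ ℕ.suc e) (r ℝ.^ ℕ.suc e) (r ℝ.^ (a ℕ.+ a)) ⟩
              norm u ℝ.^ ℕ.suc e ℝ.* r ℝ.^ (a ℕ.+ a) - r ℝ.^ ℕ.suc e ℝ.* r ℝ.^ (a ℕ.+ a)
                R.≈⟨ ℝ.+-cong norms (ℝ.-‿cong (ℝ.sym (ℝ.^-homo-* r (ℕ.suc e) (a ℕ.+ a)))) ⟩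
              norm κ ℝ.* r ℝ.^ (b ℕ.+ b) - r ℝ.^ (ℕ.suc e ℕ.+ (a ℕ.+ a)) R.∎)
            (ℝ.*-nonNegative (ℝ.^-mono (ℕ.suc e) (proj₁ 0<r) r≤norm) (ℝ.0≤^ (a ℕ.+ a) (proj₁ 0<r)))
            where
            module R = SetoidReasoning ℝ.setoid
            r≤norm : ℝ.0# ℝ.≤ norm u - r
            r≤norm with ℝ.sign (norm u - r)
            ... | ℝ.positive p = proj₁ p
            ... | ℝ.zero p     = ℝ.≤-reflexive (ℝ.sym p)
            ... | ℝ.negative p = ⊥-elim (root-is-large r u eq (ℝ.0<-resp
              (solve 3 (λ x y r → :- (x :* x :+ y :* y :- r) :+ x :* x := r :- y :* y) ℝ.refl (re u) (im u) r)
              (ℝ.0<+ p (ℝ.0≤² (re u)))))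
            norm-ofℝ-^ : ∀ m → norm (ofℝ r ^ m) ℝ.≈ r ℝ.^ (m ℕ.+ m)
            norm-ofℝ-^ m = ℝ.trans (norm-cong (ofℝ-^ r m)) (ℝ.trans
              (solve 1 (λ x → x :* x :+ con (+ 0) :* con (+ 0) := x :* x) ℝ.refl (r ℝ.^ m))
              (ℝ.sym (ℝ.^-homo-* r m m)))
            norms : norm u ℝ.^ ℕ.suc e ℝ.* r ℝ.^ (a ℕ.+ a) ℝ.≈ norm κ ℝ.* r ℝ.^ (b ℕ.+ b)
            norms = R.begin
              norm u ℝ.^ ℕ.suc e ℝ.* r ℝ.^ (a ℕ.+ a)     R.≈⟨ ℝ.*-cong (norm-^ u (ℕ.suc e)) (norm-ofℝ-^ a) ⟨
              norm (u ^ ℕ.suc e) ℝ.* norm (ofℝ r ^ a)    R.≈⟨ norm-* (u ^ ℕ.suc e) (ofℝ r ^ a) ⟨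
              norm (u ^ ℕ.suc e * ofℝ r ^ a)             R.≈⟨ norm-cong eq ⟩
              norm (κ * ofℝ r ^ b)                       R.≈⟨ norm-* κ (ofℝ r ^ b) ⟩
              norm κ ℝ.* norm (ofℝ r ^ b)                R.≈⟨ ℝ.*-congˡ (norm-ofℝ-^ b) ⟩
              norm κ ℝ.* r ℝ.^ (b ℕ.+ b)                 R.∎

          solution : ∀ r → ℝ.0# ℝ.< r → ∃[ u ] u ^ ℕ.suc e * ofℝ r ^ a ≈ κ * ofℝ r ^ b
          solution r 0<r =
            let u , u^≈ = root e (*-≉0 (*-≉0 κ≉0 (^-≉0 r≉0 b)) (⁻¹≉0 (^-≉0 r≉0 a))) in u , (begin
              u ^ ℕ.suc e * ofℝ r ^ a                                ≈⟨ *-congʳ u^≈ ⟩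
              κ * ofℝ r ^ b * (ofℝ r ^ a) ⁻¹ * ofℝ r ^ a             ≈⟨ ℂ-solve 3 (λ t i x → t ⊗ i ⊗ x ⊜ t ⊗ (x ⊗ i)) refl
                                                                         (κ * ofℝ r ^ b) ((ofℝ r ^ a) ⁻¹) (ofℝ r ^ a) ⟩
              κ * ofℝ r ^ b * (ofℝ r ^ a * (ofℝ r ^ a) ⁻¹)           ≈⟨ *-congˡ (*-inverseʳ (^-≉0 r≉0 a)) ⟩
              κ * ofℝ r ^ b * 1#                                     ≈⟨ *-identityʳ _ ⟩
              κ * ofℝ r ^ b                                          ∎)
            where
            r≉0 : ofℝ r ≉ 0#
            r≉0 (p , _) = ℝ.>⇒≉0 0<r p

        -- Each r > 0 admits some u solving the equation, so the bound on r holds throughout and its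
        -- two exponents agree. Only z_kk is varied; the statement for l follows by exchanging the
        -- indices.
        off-diagonal-balance : ℕ.suc e ℕ.+ (exp α k k ℕ.+ exp α k k) ≡ exp β k k ℕ.+ exp β k k
        off-diagonal-balance = ℝ.same-growth (0<norm κ≉0) _ _ λ r 0<r →
          let u , eq = solution r 0<r in norm-bound r u 0<r eq

-- Sums of natural numbers.

module NaturalSums where

  open SparseSums ℕ.+-0-commutativeMonoid public

  sum-mono : ∀ {m} {s t : Fin m → ℕ} → (∀ i → s i ℕ.≤ t i) → sum s ℕ.≤ sum t
  sum-mono {ℕ.zero}  _   = z≤n
  sum-mono {ℕ.suc m} s≤t = ℕ.+-mono-≤ (s≤t Fin.zero) (sum-mono (s≤t ∘ Fin.suc))

  sum≡0 : ∀ {m} (t : Fin m → ℕ) → sum t ≡ 0 → ∀ i → t i ≡ 0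
  sum≡0 t e Fin.zero    = ℕ.m+n≡0⇒m≡0 (t Fin.zero) e
  sum≡0 t e (Fin.suc i) = sum≡0 (t ∘ Fin.suc) (ℕ.m+n≡0⇒n≡0 (t Fin.zero) e) i

  sum≡suc : ∀ {m} (t : Fin m → ℕ) {k} → sum t ≡ ℕ.suc k →
    ∃[ i ] ∃[ s ] t i ≡ ℕ.suc (s i) × (∀ j → j ≢ i → t j ≡ s j) × sum s ≡ k
  sum≡suc {ℕ.suc m} t {k} e with t Fin.zero in t₀
  ... | ℕ.suc p = Fin.zero , s , t₀ , rest , ℕ.suc-injective e
    where
    s : Fin (ℕ.suc m) → ℕ
    s Fin.zero    = p
    s (Fin.suc i) = t (Fin.suc i)
    rest : ∀ j → j ≢ Fin.zero → t j ≡ s j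
    rest Fin.zero    0≢0 = ⊥-elim (0≢0 ≡.refl)
    rest (Fin.suc j) _   = ≡.refl
  ... | ℕ.zero with sum≡suc (t ∘ Fin.suc) e
  ...   | i , s′ , tᵢ , t≡s , Σs = Fin.suc i , s , tᵢ , rest , Σs
    where
    s : Fin (ℕ.suc m) → ℕ
    s Fin.zero    = 0
    s (Fin.suc i) = s′ i
    rest : ∀ j → j ≢ Fin.suc i → t j ≡ s j
    rest Fin.zero    _ = t₀
    rest (Fin.suc j) j≢i = t≡s j (j≢i ∘ ≡.cong Fin.suc)

-- Greatest common divisors and diagonal monomials of degree at most 2.

module Exponents {n : ℕ} where

  open Variables
  private module Σℕ = NaturalSums

  infixl 7 _⊓ₑ_
  infixl 6 _∸ₑ_

  -- The greatest common divisor of two monomials, and the cofactor left in the first after dividing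
  -- by it, since a - min (a, b) is truncated subtraction.
  _⊓ₑ_ _∸ₑ_ : Exponent n → Exponent n → Exponent n
  α ⊓ₑ β = record
    { exp     = λ i j → exp α i j ℕ.⊓ exp β i j
    ; exp-sym = λ i j → ≡.cong₂ ℕ._⊓_ (exp-sym α i j) (exp-sym β i j) }
  α ∸ₑ β = record
    { exp     = λ i j → exp α i j ∸ exp β i j
    ; exp-sym = λ i j → ≡.cong₂ _∸_ (exp-sym α i j) (exp-sym β i j) }

  ⊓-∙-∸ : ∀ α β → α ⊓ₑ β ∙ (α ∸ₑ β) ≐ α
  ⊓-∙-∸ α β i j = ≡.trans (≡.cong (ℕ._+ (exp α i j ∸ exp β i j)) (ℕ.⊓-comm (exp α i j) (exp β i j)))
    (ℕ.m⊓n+n∸m≡n (exp β i j) (exp α i j))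

  ⊓-∙-∸′ : ∀ α β → α ⊓ₑ β ∙ (β ∸ₑ α) ≐ β
  ⊓-∙-∸′ α β i j = ℕ.m⊓n+n∸m≡n (exp α i j) (exp β i j)

  diagonal-⊓ : ∀ α {β} → Diagonal β → Diagonal (α ⊓ₑ β)
  diagonal-⊓ α β-diag i j i≢j = ≡.trans (≡.cong (exp α i j ℕ.⊓_) (β-diag i j i≢j)) (ℕ.⊓-zeroʳ (exp α i j))

  diagonal-∸ : ∀ {α} β → Diagonal α → Diagonal (α ∸ₑ β)
  diagonal-∸ β α-diag i j i≢j = ≡.trans (≡.cong (_∸ exp β i j) (α-diag i j i≢j)) (ℕ.0∸n≡0 (exp β i j))

  diagonal-z : ∀ i → Diagonal (z {n} i i)
  diagonal-z i k l k≢l = z-other i i {k} {l} (λ (p , q) → k≢l (≡.trans p (≡.sym q))) (λ (p , q) → k≢l (≡.trans q (≡.sym p)))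

  diagonal-∙ : ∀ {α β : Exponent n} → Diagonal α → Diagonal β → Diagonal (α ∙ β)
  diagonal-∙ p q i j i≢j = ≡.cong₂ ℕ._+_ (p i j i≢j) (q i j i≢j)

  diagonal-≐ : ∀ {α β : Exponent n} → Diagonal α → Diagonal β → (∀ i → exp α i i ≡ exp β i i) → α ≐ β
  diagonal-≐ p q e i j with i Fin.≟ j
  ... | yes ≡.refl = e i
  ... | no i≢j     = ≡.trans (p i j i≢j) (≡.sym (q i j i≢j))

  diagonal? : ∀ (α : Exponent n) → (∃[ i ] ∃[ j ] i ≢ j × exp α i j ≢ 0) ⊎ Diagonal α
  diagonal? α with Fin.any? (λ i → Fin.any? λ j → ¬? (i Fin.≟ j) ×-dec ¬? (exp α i j ℕ.≟ 0))
  ... | yes (i , j , p) = inj₁ (i , j , p)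
  ... | no ¬p           = inj₂ λ i j i≢j → decidable-stable (exp α i j ℕ.≟ 0) λ q → ¬p (i , j , i≢j , q)

  -- At every entry one of the two truncated differences is 0, and so is the exponent of any common
  -- divisor.
  ∸-noCommonFactor : ∀ α β → NoCommonFactor (α ∸ₑ β) (β ∸ₑ α)
  ∸-noCommonFactor α β δ (_ , p) (_ , q) i j with ℕ.≤-total (exp α i j) (exp β i j)
  ... | inj₁ α≤β = ℕ.m+n≡0⇒m≡0 (exp δ i j) (≡.trans (≡.sym (p i j)) (ℕ.m≤n⇒m∸n≡0 α≤β))
  ... | inj₂ β≤α = ℕ.m+n≡0⇒m≡0 (exp δ i j) (≡.trans (≡.sym (q i j)) (ℕ.m≤n⇒m∸n≡0 β≤α))

  trace : Exponent n → ℕ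
  trace α = Σℕ.sum λ i → exp α i i

  -- On the diagonal `twice` doubles the exponents, so bounding each difference by the sum of the
  -- two exponents gives twice the total degree. This is the source of the bound 4.
  2∥-∥≤ : ∀ {α β : Exponent n} → Diagonal α → Diagonal β → trace α ℕ.+ trace β ℕ.≤ 2 → 2∥ α - β ∥ ℕ.≤ 2 ℕ.* 2
  2∥-∥≤ {α} {β} α-diag β-diag ≤2 = begin
    2∥ α - β ∥
      ≡⟨ Σℕ.sum-cong-≗ (λ i → Σℕ.sum-single _ i λ j j≢i →
           ≡.cong₂ ∣_-_∣ (twice-off {α} α-diag (j≢i ∘ ≡.sym)) (twice-off {β} β-diag (j≢i ∘ ≡.sym))) ⟩
    Σℕ.sum (λ i → ∣ twice α i i - twice β i i ∣)
      ≤⟨ Σℕ.sum-mono pointwise ⟩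
    Σℕ.sum (λ i → s i ℕ.+ s i)
      ≡⟨ Σℕ.∑-distrib-+ s s ⟩
    Σℕ.sum s ℕ.+ Σℕ.sum s
      ≡⟨ ≡.cong₂ ℕ._+_ total total ⟩
    (trace α ℕ.+ trace β) ℕ.+ (trace α ℕ.+ trace β)
      ≤⟨ ℕ.+-mono-≤ ≤2 ≤2 ⟩
    2 ℕ.* 2 ∎
    where
    open ℕ.≤-Reasoning
    s : Fin n → ℕ
    s i = exp α i i ℕ.+ exp β i i
    total : Σℕ.sum s ≡ trace α ℕ.+ trace β
    total = Σℕ.∑-distrib-+ (λ i → exp α i i) (λ i → exp β i i)
    twice-off : ∀ {γ : Exponent n} → Diagonal γ → ∀ {i j} → i ≢ j → twice γ i j ≡ 0
    twice-off γ-diag {i} {j} i≢j with i Fin.≟ j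
    ... | yes i≡j = ⊥-elim (i≢j i≡j)
    ... | no _    = γ-diag i j i≢j
    twice-on : ∀ (γ : Exponent n) i → twice γ i i ≡ 2 ℕ.* exp γ i i
    twice-on γ i with i Fin.≟ i
    ... | yes _  = ≡.refl
    ... | no i≢i = ⊥-elim (i≢i ≡.refl)
    pointwise : ∀ i → ∣ twice α i i - twice β i i ∣ ℕ.≤ s i ℕ.+ s i
    pointwise i = begin
      ∣ twice α i i - twice β i i ∣             ≡⟨ ≡.cong₂ ∣_-_∣ (twice-on α i) (twice-on β i) ⟩
      ∣ 2 ℕ.* a - 2 ℕ.* b ∣                     ≤⟨ ℕ.∣m-n∣≤m⊔n (2 ℕ.* a) (2 ℕ.* b) ⟩
      2 ℕ.* a ℕ.⊔ 2 ℕ.* b                       ≤⟨ ℕ.m⊔n≤m+n (2 ℕ.* a) (2 ℕ.* b) ⟩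
      2 ℕ.* a ℕ.+ 2 ℕ.* b                       ≡⟨ ≡.sym (ℕ.*-distribˡ-+ 2 a b) ⟩
      2 ℕ.* (a ℕ.+ b)                           ≡⟨ ≡.cong (a ℕ.+ b ℕ.+_) (ℕ.+-identityʳ (a ℕ.+ b)) ⟩
      s i ℕ.+ s i                               ∎
      where
      a b : ℕ
      a = exp α i i
      b = exp β i i

  -- Splits one diagonal variable off a monomial of positive degree; one or two such steps exhaust
  -- degrees 1 and 2.
  variable-in-trace : ∀ (t : Fin n → ℕ) {k} → Σℕ.sum t ≡ ℕ.suc k →
    ∃[ i ] ∃[ s ] (∀ j → t j ≡ exp (z {n} i i) j j ℕ.+ s j) × Σℕ.sum s ≡ k
  variable-in-trace t e with Σℕ.sum≡suc t e
  ... | i , s , tᵢ , t≡s , Σs = i , s , pointwise , Σs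
    where
    pointwise : ∀ j → t j ≡ exp (z {n} i i) j j ℕ.+ s j
    pointwise j with j Fin.≟ i
    ... | yes ≡.refl = tᵢ
    ... | no j≢i     = t≡s j j≢i

  trace≡0 : ∀ {α : Exponent n} → Diagonal α → trace α ≡ 0 → α ≐ 𝟙
  trace≡0 {α} α-diag e = diagonal-≐ {α} {𝟙} α-diag (λ _ _ _ → ≡.refl) (Σℕ.sum≡0 (λ i → exp α i i) e)

  trace≡1 : ∀ {α : Exponent n} → Diagonal α → trace α ≡ 1 → ∃[ i ] α ≐ z {n} i i
  trace≡1 {α} α-diag e with variable-in-trace (λ i → exp α i i) e
  ... | i , s , α≡ , Σs = i , diagonal-≐ {α} {z i i} α-diag (diagonal-z i)
    λ j → ≡.trans (α≡ j) (≡.trans (≡.cong (exp (z {n} i i) j j ℕ.+_) (Σℕ.sum≡0 s Σs j)) (ℕ.+-identityʳ _))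

  trace≡2 : ∀ {α : Exponent n} → Diagonal α → trace α ≡ 2 → ∃[ i ] ∃[ j ] α ≐ z {n} i i ∙ z j j
  trace≡2 {α} α-diag e with variable-in-trace (λ i → exp α i i) e
  ... | i , s , α≡ , Σs with variable-in-trace s Σs
  ...   | j , s′ , s≡ , Σs′ = i , j , diagonal-≐ {α} {z i i ∙ z j j} α-diag (diagonal-∙ {z i i} {z j j} (diagonal-z i) (diagonal-z j))
    λ p → ≡.trans (α≡ p) (≡.cong (exp (z {n} i i) p p ℕ.+_) (≡.trans (s≡ p)
      (≡.trans (≡.cong (exp (z {n} j j) p p ℕ.+_) (Σℕ.sum≡0 s′ Σs′ p)) (ℕ.+-identityʳ _))))

  z-support : ∀ {i p} → exp (z {n} i i) p p ≢ 0 → p ≡ i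
  z-support {i} {p} e = decidable-stable (p Fin.≟ i) λ p≢i → e (z-other i i (p≢i ∘ proj₁) (p≢i ∘ proj₁))

  zz-support : ∀ {i j p} → exp (z {n} i i ∙ z j j) p p ≢ 0 → p ≡ i ⊎ p ≡ j
  zz-support {i} {j} {p} e with p Fin.≟ i | p Fin.≟ j
  ... | yes p≡i | _       = inj₁ p≡i
  ... | no _    | yes p≡j = inj₂ p≡j
  ... | no _    | no _    = ⊥-elim (e ≡.refl)

  -- Degree 0 contains no variable and degree 1 only one, so two distinct indices use up the whole
  -- degree 2.
  two-variables : ∀ {α : Exponent n} {k l} → Diagonal α → trace α ℕ.≤ 2 → k ≢ l → exp α k k ≢ 0 → exp α l l ≢ 0 →
    trace α ≡ 2 × α ≐ z k k ∙ z l l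
  two-variables {α} {k} {l} α-diag ≤2 k≢l αk αl = classify (trace α) ≡.refl ≤2
    where
    classify : ∀ m → trace α ≡ m → m ℕ.≤ 2 → m ≡ 2 × α ≐ z k k ∙ z l l
    classify 0 e _ = ⊥-elim (αk (trace≡0 {α} α-diag e k k))
    classify 1 e _ = let i , α≐ = trace≡1 {α} α-diag e in
      ⊥-elim (k≢l (≡.trans (z-support {i} {k} (αk ∘ ≡.trans (α≐ k k))) (≡.sym (z-support {i} {l} (αl ∘ ≡.trans (α≐ l l))))))
    classify 2 e _ with trace≡2 {α} α-diag e
    ... | i , j , α≐ with zz-support {i} {j} {k} (αk ∘ ≡.trans (α≐ k k)) | zz-support {i} {j} {l} (αl ∘ ≡.trans (α≐ l l))
    ...   | inj₁ ≡.refl | inj₁ ≡.refl = ⊥-elim (k≢l ≡.refl)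
    ...   | inj₁ ≡.refl | inj₂ ≡.refl = ≡.refl , α≐
    ...   | inj₂ ≡.refl | inj₁ ≡.refl = ≡.refl , λ p q → ≡.trans (α≐ p q) (ℕ.+-comm (exp (z {n} i i) p q) (exp (z {n} j j) p q))
    ...   | inj₂ ≡.refl | inj₂ ≡.refl = ⊥-elim (k≢l ≡.refl)
    classify (ℕ.suc (ℕ.suc (ℕ.suc _))) _ (s≤s (s≤s ()))

-- The two forms of a stable binomial.

module Classification {ℓ} (ℝ : CompleteOrderedField ℓ) where

  private
    module ℝ = OrderedField ℝ

  open Complex ℝ
  open ComplexField ℝ
  open ComplexRoots ℝ using (PositiveReal)
  open Evaluation ℝ
  open Stability ℝ
  open Variables
  open Exponents

  module _ {n : ℕ} where

    coeff-cong : ∀ (f : Polynomial n) {α β} → α ≐ β → coeff f α ≈ coeff f β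
    coeff-cong []            _   = refl
    coeff-cong ((c , γ) ∷ f) {α} {β} α≐β with γ ≐? α | γ ≐? β
    ... | yes _   | yes _   = +-congˡ (coeff-cong f α≐β)
    ... | no _    | no _    = coeff-cong f α≐β
    ... | yes γ≐α | no γ≭β  = ⊥-elim (γ≭β λ i j → ≡.trans (γ≐α i j) (α≐β i j))
    ... | no γ≭α  | yes γ≐β = ⊥-elim (γ≭α λ i j → ≡.trans (γ≐β i j) (≡.sym (α≐β i j)))

    SupportedOn : Polynomial n → Exponent n → Exponent n → Set ℓ
    SupportedOn f α β = ∀ γ → ¬ (γ ≐ α) → ¬ (γ ≐ β) → coeff f γ ≈ 0#

    -- The cofactors enter only through their products with γ, so that they can be the truncated
    -- differences themselves or explicit monomials such as `z k k ∙ z l l`.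
    factorisation : ∀ f {α β} γ δ₁ δ₂ → ¬ (α ≐ β) → SupportedOn f α β → γ ∙ δ₁ ≐ α → γ ∙ δ₂ ≐ β →
      f ≈ₚ term 1# γ *ₚ (term (coeff f α) δ₁ +ₚ term (coeff f β) δ₂)
    factorisation f {α} {β} γ δ₁ δ₂ α≭β support p q η = by-cases (α ≐? η) (β ≐? η)
      where
      a b : ℂ
      a = coeff f α
      b = coeff f β
      first second : Polynomial n
      first  = (1# * a , γ ∙ δ₁) ∷ second
      second = (1# * b , γ ∙ δ₂) ∷ []
      α≐η⇒ : α ≐ η → γ ∙ δ₁ ≐ η
      α≐η⇒ α≐η i j = ≡.trans (p i j) (α≐η i j)
      β≐η⇒ : β ≐ η → γ ∙ δ₂ ≐ η
      β≐η⇒ β≐η i j = ≡.trans (q i j) (β≐η i j)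
      α≭η⇒ : ¬ (α ≐ η) → ¬ (γ ∙ δ₁ ≐ η)
      α≭η⇒ α≭η r = α≭η λ i j → ≡.trans (≡.sym (p i j)) (r i j)
      β≭η⇒ : ¬ (β ≐ η) → ¬ (γ ∙ δ₂ ≐ η)
      β≭η⇒ β≭η r = β≭η λ i j → ≡.trans (≡.sym (q i j)) (r i j)
      by-cases : Dec (α ≐ η) → Dec (β ≐ η) → coeff f η ≈ coeff first η
      by-cases (yes α≐η) (yes β≐η) = ⊥-elim (α≭β λ i j → ≡.trans (α≐η i j) (≡.sym (β≐η i j)))
      by-cases (yes α≐η) (no β≭η) = trans (coeff-cong f {η} {α} λ i j → ≡.sym (α≐η i j)) (trans
        (sym (trans (+-cong (*-identityˡ a) (reflexive (⌊≐?⌋-no {α = γ ∙ δ₂} {η} (β≭η⇒ β≭η)))) (+-identityʳ a)))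
        (reflexive (≡.sym (⌊≐?⌋-yes {α = γ ∙ δ₁} {η} (α≐η⇒ α≐η)))))
      by-cases (no α≭η) (yes β≐η) = trans (coeff-cong f {η} {β} λ i j → ≡.sym (β≐η i j)) (trans
        (sym (trans (+-identityʳ (1# * b)) (*-identityˡ b)))
        (reflexive (≡.sym (≡.trans (⌊≐?⌋-no {α = γ ∙ δ₁} {η} (α≭η⇒ α≭η)) (⌊≐?⌋-yes {α = γ ∙ δ₂} {η} (β≐η⇒ β≐η))))))
      by-cases (no α≭η) (no β≭η) = trans
        (support η (λ r → α≭η λ i j → ≡.sym (r i j)) (λ r → β≭η λ i j → ≡.sym (r i j)))
        (reflexive (≡.sym (≡.trans (⌊≐?⌋-no {α = γ ∙ δ₁} {η} (α≭η⇒ α≭η)) (⌊≐?⌋-no {α = γ ∙ δ₂} {η} (β≭η⇒ β≭η)))))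

    DiagonalForm OffDiagonalForm Form : Polynomial n → Set ℓ
    DiagonalForm f =
      ∃[ c₁ ] ∃[ c₂ ] ∃[ γ ] c₁ ≉ 0# × c₂ ≉ 0# × Diagonal γ ×
        ( OnlyDiagonalVariables f
        × ∃[ α₁ ] ∃[ α₂ ]
            f ≈ₚ term 1# γ *ₚ (term c₁ α₁ +ₚ term c₂ α₂)
          × NoCommonFactor α₁ α₂
          × 2∥ α₁ - α₂ ∥ ℕ.≤ 2 ℕ.* 2
          × (¬ (α₁ ≐ 𝟙) ⊎ ¬ (α₂ ≐ 𝟙))
          × ( (∃[ i ] ⟅ α₁ , α₂ ⟆≐⟅ 𝟙 , z i i ⟆)
            ⊎ (∃[ i ] ∃[ j ] ⟅ α₁ , α₂ ⟆≐⟅ z i i , z j j ⟆ × NonNegativeReal (c₁ / c₂))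
            ⊎ (∃[ i ] ∃[ j ] ⟅ α₁ , α₂ ⟆≐⟅ 𝟙 , z i i ∙ z j j ⟆ × NegativeReal (c₁ / c₂))
            )
        )
    OffDiagonalForm f =
      ∃[ c₁ ] ∃[ c₂ ] ∃[ γ ] c₁ ≉ 0# × c₂ ≉ 0# × Diagonal γ ×
        ( ∃[ i ] ∃[ j ] i Fin.< j
        × f ≈ₚ term 1# γ *ₚ (term c₁ (z i i ∙ z j j) +ₚ term c₂ (z i j ∙ z i j))
        × Real (c₁ / c₂)
        )
    Form f = DiagonalForm f ⊎ OffDiagonalForm f

    real-resp : ∀ {v w} → v ≈ w → Real v → Real w
    real-resp (_ , p) = ℝ.trans (ℝ.sym p)

    positive-resp : ∀ {v w} → v ≈ w → PositiveReal v → PositiveReal w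
    positive-resp e (p , q) = real-resp e p , ℝ.0<-resp (proj₁ e) q

    neg-negative : ∀ {w} → PositiveReal (- w) → NegativeReal w
    neg-negative {w} (p , q) =
      ℝ.trans (ℝ.solve 1 (λ x → x ℝ.:= ℝ.:- ℝ.:- x) ℝ.refl (im w)) (ℝ.trans (ℝ.-‿cong p) ℝ.-0#≈0#) ,
      ℝ.0<⇒< (ℝ.0<-resp (ℝ.sym (ℝ.+-identityˡ _)) q)

    module _ (f : Polynomial n) {α β : Exponent n} (α≭β : ¬ (α ≐ β)) (cα≉0 : coeff f α ≉ 0#)
      (cβ≉0 : coeff f β ≉ 0#) (support : SupportedOn f α β)
      (nonvanishing : NonVanishing (coeff f α) α (coeff f β) β) where

      private
        δ₁ δ₂ γ : Exponent n
        δ₁ = α ∸ₑ β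
        δ₂ = β ∸ₑ α
        γ  = α ⊓ₑ β
        q : ℂ
        q = coeff f α / coeff f β

        factored : f ≈ₚ term 1# γ *ₚ (term (coeff f α) δ₁ +ₚ term (coeff f β) δ₂)
        factored = factorisation f γ δ₁ δ₂ α≭β support (⊓-∙-∸ α β) (⊓-∙-∸′ α β)

        distance : trace δ₁ ℕ.+ trace δ₂ ℕ.≤ 2 ×
          (trace δ₁ ℕ.+ trace δ₂ ≡ 2 → PositiveReal (- ((- 1#) ^ trace δ₁ * q)))
        distance = diagonal-distance {α = α} {β} cα≉0 cβ≉0 nonvanishing

        not-both-𝟙 : δ₁ ≐ 𝟙 → δ₂ ≐ 𝟙 → ⊥
        not-both-𝟙 p q = α≭β λ i j → ≡.trans (≡.sym (⊓-∙-∸ α β i j)) (≡.trans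
          (≡.cong (exp γ i j ℕ.+_) (≡.trans (p i j) (≡.sym (q i j)))) (⊓-∙-∸′ α β i j))

        -- The parity of `trace δ₁` decides the sign of the quotient: degrees (1, 1) make q itself
        -- positive, degrees (0, 2) and (2, 0) make its negative positive.
        plus-sign : - ((- 1#) ^ 1 * q) ≈ q
        plus-sign = ℂ-solve 1 (λ q → ⊝ (⊝ ℂ-con (+ 1) ⊗ ℂ-con (+ 1) ⊗ q) ⊜ q) refl q

        minus-sign₀ : - ((- 1#) ^ 0 * q) ≈ - q
        minus-sign₀ = ℂ-solve 1 (λ q → ⊝ (ℂ-con (+ 1) ⊗ q) ⊜ ⊝ q) refl q

        minus-sign₂ : - ((- 1#) ^ 2 * q) ≈ - q
        minus-sign₂ = ℂ-solve 1 (λ q → ⊝ (⊝ ℂ-con (+ 1) ⊗ (⊝ ℂ-con (+ 1) ⊗ ℂ-con (+ 1)) ⊗ q) ⊜ ⊝ q) refl q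

      diagonal-form : Diagonal α → Diagonal β → DiagonalForm f
      diagonal-form α-diag β-diag =
        coeff f α , coeff f β , γ , cα≉0 , cβ≉0 , diagonal-⊓ α {β} β-diag ,
        only-diagonal , δ₁ , δ₂ , factored , ∸-noCommonFactor α β ,
        2∥-∥≤ {α = δ₁} {δ₂} δ₁-diag δ₂-diag (proj₁ distance) , non-trivial ,
        shape (trace δ₁) (trace δ₂) ≡.refl ≡.refl (proj₁ distance) (proj₂ distance)
        where
        δ₁-diag : Diagonal δ₁
        δ₁-diag = diagonal-∸ {α = α} β α-diag
        δ₂-diag : Diagonal δ₂
        δ₂-diag = diagonal-∸ {α = β} α β-diag
        only-diagonal : OnlyDiagonalVariables f
        only-diagonal η cη≉0 = by-cases (η ≐? α) (η ≐? β)
          where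
          by-cases : Dec (η ≐ α) → Dec (η ≐ β) → Diagonal η
          by-cases (yes p) _       = λ i j i≢j → ≡.trans (p i j) (α-diag i j i≢j)
          by-cases (no _)  (yes p) = λ i j i≢j → ≡.trans (p i j) (β-diag i j i≢j)
          by-cases (no p)  (no p′) = ⊥-elim (cη≉0 (support η p p′))
        non-trivial : ¬ (δ₁ ≐ 𝟙) ⊎ ¬ (δ₂ ≐ 𝟙)
        non-trivial = by-cases (δ₁ ≐? 𝟙)
          where
          by-cases : Dec (δ₁ ≐ 𝟙) → ¬ (δ₁ ≐ 𝟙) ⊎ ¬ (δ₂ ≐ 𝟙)
          by-cases (yes p) = inj₂ (not-both-𝟙 p)
          by-cases (no ¬p) = inj₁ ¬p
        shape : ∀ s t → trace δ₁ ≡ s → trace δ₂ ≡ t → s ℕ.+ t ℕ.≤ 2 →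
          (s ℕ.+ t ≡ 2 → PositiveReal (- ((- 1#) ^ s * q))) →
          (∃[ i ] ⟅ δ₁ , δ₂ ⟆≐⟅ 𝟙 , z i i ⟆)
            ⊎ (∃[ i ] ∃[ j ] ⟅ δ₁ , δ₂ ⟆≐⟅ z i i , z j j ⟆ × NonNegativeReal q)
            ⊎ (∃[ i ] ∃[ j ] ⟅ δ₁ , δ₂ ⟆≐⟅ 𝟙 , z i i ∙ z j j ⟆ × NegativeReal q)
        shape 0 0 p q _ _ = ⊥-elim (not-both-𝟙 (trace≡0 {α = δ₁} δ₁-diag p) (trace≡0 {α = δ₂} δ₂-diag q))
        shape 0 1 p q _ _ =
          let i , e = trace≡1 {α = δ₂} δ₂-diag q in inj₁ (i , inj₁ (trace≡0 {α = δ₁} δ₁-diag p , e))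
        shape 1 0 p q _ _ =
          let i , e = trace≡1 {α = δ₁} δ₁-diag p in inj₁ (i , inj₂ (e , trace≡0 {α = δ₂} δ₂-diag q))
        shape 0 2 p q _ sgn =
          let i , j , e = trace≡2 {α = δ₂} δ₂-diag q in
          inj₂ (inj₂ (i , j , inj₁ (trace≡0 {α = δ₁} δ₁-diag p , e) ,
            neg-negative (positive-resp minus-sign₀ (sgn ≡.refl))))
        shape 2 0 p q _ sgn =
          let i , j , e = trace≡2 {α = δ₁} δ₁-diag p in
          inj₂ (inj₂ (i , j , inj₂ (e , trace≡0 {α = δ₂} δ₂-diag q) ,
            neg-negative (positive-resp minus-sign₂ (sgn ≡.refl))))
        shape 1 1 p q _ sgn =
          let i , d = trace≡1 {α = δ₁} δ₁-diag p
              j , e = trace≡1 {α = δ₂} δ₂-diag q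
              r , s = positive-resp plus-sign (sgn ≡.refl)
          in inj₂ (inj₁ (i , j , inj₁ (d , e) , r , proj₁ s))
        shape 0 (ℕ.suc (ℕ.suc (ℕ.suc _))) _ _ (s≤s (s≤s ())) _
        shape 1 (ℕ.suc (ℕ.suc _)) _ _ (s≤s (s≤s ())) _
        shape 2 (ℕ.suc _) _ _ (s≤s (s≤s ())) _
        shape (ℕ.suc (ℕ.suc (ℕ.suc _))) _ _ _ (s≤s (s≤s ())) _

      nonvanishing-sym : NonVanishing (coeff f β) β (coeff f α) α
      nonvanishing-sym M M-sym M-pd e = nonvanishing M M-sym M-pd
        (trans (ℂ-solve 2 (λ x y → x ⊕ y ⊜ y ⊕ x) refl _ _) e)

      -- Here β carries the off-diagonal variables.
      off-diagonal-form : Diagonal α → ∀ {k l} → k Fin.< l → exp β k l ≢ 0 → OffDiagonalForm f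
      off-diagonal-form α-diag {k} {l} k<l βkl≢0 =
        coeff f α , coeff f β , γ , cα≉0 , cβ≉0 , γ-diag , k , l , k<l ,
        factorisation f γ (z k k ∙ z l l) (z k l ∙ z k l) α≭β support
          (λ i j → ≡.trans (≡.cong (exp γ i j ℕ.+_) (≡.sym (δ₁≐ i j))) (⊓-∙-∸ α β i j))
          (λ i j → ≡.trans (≡.cong (exp γ i j ℕ.+_) (≡.sym (δ₂≐ i j))) (⊓-∙-∸′ α β i j)) ,
        -- The reduced monomials have traces 2 and 0, so the sign condition for total 2 applies and
        -- makes the quotient real.
        proj₁ (neg-negative (positive-resp minus-sign₂
          (≡.subst (λ s → PositiveReal (- ((- 1#) ^ s * q))) trace-δ₁
            (proj₂ distance (≡.cong₂ ℕ._+_ trace-δ₁ trace-δ₂)))))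
        where
        k≢l : k ≢ l
        k≢l = Fin.<⇒≢ k<l
        γ-diag : Diagonal γ
        γ-diag i j i≢j = ≡.cong (ℕ._⊓ exp β i j) (α-diag i j i≢j)
        δ₁-diag : Diagonal δ₁
        δ₁-diag = diagonal-∸ {α = α} β α-diag

        -- This is `off-diagonal-balance` with α and β exchanged, because β carries z_ij: 2 α_ii = 2
        -- β_ii + exp β i j. In particular β_ii ≤ α_ii, so the truncated difference in `δ₁` is the
        -- true one.
        balance : ∀ {i j} → i ≢ j → exp β i j ≢ 0 → exp β i j ≡ exp δ₁ i i ℕ.+ exp δ₁ i i
        balance {i} {j} i≢j βij≢0 = cancel (exp α i i) (exp β i i) (exp β i j) (from-suc (exp β i j) βij≢0 ≡.refl)
          where
          from-suc : ∀ e → e ≢ 0 → exp β i j ≡ e →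
            e ℕ.+ (exp β i i ℕ.+ exp β i i) ≡ exp α i i ℕ.+ exp α i i
          from-suc ℕ.zero    0≢0 _  = ⊥-elim (0≢0 ≡.refl)
          from-suc (ℕ.suc e) _   eq = off-diagonal-balance {α = β} {α} cβ≉0 cα≉0 nonvanishing-sym i≢j eq (α-diag i j i≢j)
          cancel : ∀ a b e → e ℕ.+ (b ℕ.+ b) ≡ a ℕ.+ a → e ≡ (a ∸ b) ℕ.+ (a ∸ b)
          cancel a       ℕ.zero    e eq = ≡.trans (≡.sym (ℕ.+-identityʳ e)) eq
          cancel ℕ.zero  (ℕ.suc b) e eq = ⊥-elim (ℕ.m+1+n≢0 e eq)
          cancel (ℕ.suc a) (ℕ.suc b) e eq = cancel a b e (ℕ.suc-injective (ℕ.suc-injective (≡.trans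
            (≡.sym (≡.trans (≡.cong (λ c → e ℕ.+ ℕ.suc c) (ℕ.+-suc b b))
              (≡.trans (ℕ.+-suc e _) (≡.cong ℕ.suc (ℕ.+-suc e _)))))
            (≡.trans eq (≡.cong ℕ.suc (ℕ.+-suc a a))))))

        δ₁≢0 : ∀ {i j} → i ≢ j → exp β i j ≢ 0 → exp δ₁ i i ≢ 0
        δ₁≢0 i≢j βij≢0 e = βij≢0 (≡.trans (balance i≢j βij≢0) (≡.cong₂ ℕ._+_ e e))

        flip≢0 : ∀ {i j} → exp β i j ≢ 0 → exp β j i ≢ 0
        flip≢0 {i} {j} βij≢0 = βij≢0 ∘ ≡.trans (exp-sym β i j)

        -- By symmetry of β the balance holds at l as well as at k, so z_kk and z_ll both occur in
        -- `δ₁`, and the degree bound leaves room for nothing else.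
        both = two-variables {α = δ₁} δ₁-diag (ℕ.m+n≤o⇒m≤o (trace δ₁) (proj₁ distance)) k≢l
          (δ₁≢0 k≢l βkl≢0) (δ₁≢0 (k≢l ∘ ≡.sym) (flip≢0 βkl≢0))

        trace-δ₁ : trace δ₁ ≡ 2
        trace-δ₁ = proj₁ both

        δ₁≐ : δ₁ ≐ z k k ∙ z l l
        δ₁≐ = proj₂ both

        trace-δ₂ : trace δ₂ ≡ 0
        trace-δ₂ = ℕ.n≤0⇒n≡0 (ℕ.+-cancelˡ-≤ 2 (trace δ₂) 0
          (≡.subst (λ s → s ℕ.+ trace δ₂ ℕ.≤ 2) trace-δ₁ (proj₁ distance)))

        -- Any off-diagonal variable z_ij of β forces z_ii and z_jj into `δ₁`, which contains only
        -- z_kk and z_ll.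
        support-β : ∀ {i j} → i ≢ j → exp β i j ≢ 0 → (i ≡ k × j ≡ l) ⊎ (j ≡ k × i ≡ l)
        support-β {i} {j} i≢j βij≢0
          with zz-support {i = k} {l} {i} (δ₁≢0 i≢j βij≢0 ∘ ≡.trans (δ₁≐ i i))
             | zz-support {i = k} {l} {j} (δ₁≢0 (i≢j ∘ ≡.sym) (flip≢0 βij≢0) ∘ ≡.trans (δ₁≐ j j))
        ... | inj₁ p | inj₂ q = inj₁ (p , q)
        ... | inj₂ p | inj₁ q = inj₂ (q , p)
        ... | inj₁ p | inj₁ q = ⊥-elim (i≢j (≡.trans p (≡.sym q)))
        ... | inj₂ p | inj₂ q = ⊥-elim (i≢j (≡.trans p (≡.sym q)))

        βkl≡2 : exp β k l ≡ 2
        βkl≡2 = ≡.trans (balance k≢l βkl≢0) (≡.cong₂ ℕ._+_ δ₁kk≡1 δ₁kk≡1)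
          where
          δ₁kk≡1 : exp δ₁ k k ≡ 1
          δ₁kk≡1 = ≡.trans (δ₁≐ k k) (≡.cong₂ ℕ._+_ (z-same k k) (z-other l l (k≢l ∘ proj₁) (k≢l ∘ proj₁)))

        δ₂≐ : δ₂ ≐ z k l ∙ z k l
        δ₂≐ i j = by-cases (i Fin.≟ j) (exp β i j ℕ.≟ 0)
          where
          open ≡.≡-Reasoning
          by-cases : Dec (i ≡ j) → Dec (exp β i j ≡ 0) → exp δ₂ i j ≡ exp (z k l ∙ z k l) i j
          -- `δ₁` has used the whole degree bound, so `δ₂` has trace 0 and no diagonal variable.
          by-cases (yes ≡.refl) _ = ≡.trans (NaturalSums.sum≡0 (λ i → exp δ₂ i i) trace-δ₂ i) (≡.sym (≡.cong₂ ℕ._+_ zero zero))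
            where
            zero : exp (z k l) i i ≡ 0
            zero = z-other k l {i} {i} (λ (p , q) → k≢l (≡.trans (≡.sym p) q)) (λ (p , q) → k≢l (≡.trans (≡.sym p) q))
          by-cases (no i≢j) (yes βij≡0) = ≡.trans (≡.cong (_∸ exp α i j) βij≡0)
            (≡.trans (ℕ.0∸n≡0 (exp α i j)) (≡.sym (≡.cong₂ ℕ._+_ zero zero)))
            where
            zero : exp (z k l) i j ≡ 0
            zero = z-other k l {i} {j} (λ { (≡.refl , ≡.refl) → βkl≢0 βij≡0 })
              (λ { (≡.refl , ≡.refl) → flip≢0 βkl≢0 βij≡0 })
          by-cases (no i≢j) (no βij≢0) with support-β i≢j βij≢0
          ... | inj₁ (≡.refl , ≡.refl) = begin
            exp β k l ∸ exp α k l      ≡⟨ ≡.cong (exp β k l ∸_) (α-diag k l k≢l) ⟩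
            exp β k l                  ≡⟨ βkl≡2 ⟩
            2                          ≡⟨ ≡.cong₂ ℕ._+_ (z-same k l) (z-same k l) ⟨
            exp (z k l ∙ z k l) k l    ∎
          ... | inj₂ (≡.refl , ≡.refl) = begin
            exp β l k ∸ exp α l k      ≡⟨ ≡.cong (exp β l k ∸_) (α-diag l k (k≢l ∘ ≡.sym)) ⟩
            exp β l k                  ≡⟨ exp-sym β l k ⟩
            exp β k l                  ≡⟨ βkl≡2 ⟩
            2                          ≡⟨ ≡.cong₂ ℕ._+_ (z-flip k l) (z-flip k l) ⟨
            exp (z k l ∙ z k l) l k    ∎

    form : ∀ f → PsdStable f → Binomial f → Form f
    form f stable (α , β , α≭β , cα≉0 , cβ≉0 , support) = by-cases (diagonal? α) (diagonal? β)
      where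
      nonvanishing : NonVanishing (coeff f α) α (coeff f β) β
      nonvanishing M M-sym M-pd e = stable M M-sym M-pd (trans (eval-binomial {α = α} {β} f α≭β support M) e)
      β≭α : ¬ (β ≐ α)
      β≭α p = α≭β λ i j → ≡.sym (p i j)
      support′ : SupportedOn f β α
      support′ γ p q = support γ q p
      nonvanishing′ : NonVanishing (coeff f β) β (coeff f α) α
      nonvanishing′ = nonvanishing-sym f {α} {β} α≭β cα≉0 cβ≉0 support nonvanishing
      OffDiagonal : Exponent n → Set
      OffDiagonal α = ∃[ i ] ∃[ j ] i ≢ j × exp α i j ≢ 0
      ordered : ∀ η → OffDiagonal η → ∃[ k ] ∃[ l ] k Fin.< l × exp η k l ≢ 0
      ordered η (k , l , k≢l , ηkl≢0) with Fin.<-cmp k l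
      ... | tri< k<l _ _ = k , l , k<l , ηkl≢0
      ... | tri≈ _ k≡l _ = ⊥-elim (k≢l k≡l)
      ... | tri> _ _ l<k = l , k , l<k , ηkl≢0 ∘ ≡.trans (exp-sym η k l)
      by-cases : OffDiagonal α ⊎ Diagonal α → OffDiagonal β ⊎ Diagonal β → Form f
      by-cases (inj₁ (_ , _ , p , q)) (inj₁ (_ , _ , r , s)) =
        ⊥-elim (one-diagonal {α = α} {β} nonvanishing p q r s)
      by-cases (inj₂ p) (inj₂ q) = inj₁ (diagonal-form f {α} {β} α≭β cα≉0 cβ≉0 support nonvanishing p q)
      by-cases (inj₂ p) (inj₁ q) = let _ , _ , k<l , β≢0 = ordered β q in
        inj₂ (off-diagonal-form f {α} {β} α≭β cα≉0 cβ≉0 support nonvanishing p k<l β≢0)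
      by-cases (inj₁ p) (inj₂ q) = let _ , _ , k<l , α≢0 = ordered α p in
        inj₂ (off-diagonal-form f {β} {α} β≭α cβ≉0 cα≉0 support′ nonvanishing′ q k<l α≢0)

open import Data.Fin.Base using (_<_)
open import Data.Nat.Base using (_≤_; _*_)

theorem5p5 : ∀ {ℓ} (ℝ : CompleteOrderedField ℓ) → let open Complex ℝ hiding (_*_) in
  ∀ (n : ℕ) (f : Polynomial n) → PsdStable f → Binomial f →
  ∃[ c₁ ] ∃[ c₂ ] ∃[ γ ] c₁ ≉ 0# × c₂ ≉ 0# × Diagonal γ ×
    ( ( OnlyDiagonalVariables f
      × ∃[ α₁ ] ∃[ α₂ ]
          f ≈ₚ term 1# γ *ₚ (term c₁ α₁ +ₚ term c₂ α₂)
        × NoCommonFactor α₁ α₂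
        × 2∥ α₁ - α₂ ∥ ≤ 2 * 2
        × (¬ (α₁ ≐ 𝟙) ⊎ ¬ (α₂ ≐ 𝟙))
        × ( (∃[ i ] ⟅ α₁ , α₂ ⟆≐⟅ 𝟙 , z i i ⟆)
          ⊎ (∃[ i ] ∃[ j ] ⟅ α₁ , α₂ ⟆≐⟅ z i i , z j j ⟆ × NonNegativeReal (c₁ / c₂))
          ⊎ (∃[ i ] ∃[ j ] ⟅ α₁ , α₂ ⟆≐⟅ 𝟙 , z i i ∙ z j j ⟆ × NegativeReal (c₁ / c₂))
          )
      )
    ⊎ ( ∃[ i ] ∃[ j ] i < j
        × f ≈ₚ term 1# γ *ₚ (term c₁ (z i i ∙ z j j) +ₚ term c₂ (z i j ∙ z i j))
        × Real (c₁ / c₂)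
      )
    )
theorem5p5 ℝ n f stable binomial with Classification.form ℝ f stable binomial
... | inj₁ (c₁ , c₂ , γ , p , q , r , s) = c₁ , c₂ , γ , p , q , r , inj₁ s
... | inj₂ (c₁ , c₂ , γ , p , q , r , s) = c₁ , c₂ , γ , p , q , r , inj₂ s
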